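{- Let $G$ be a graph. (i) Suppose that $F(G,4)\le 3$. Then $G$ is $\mathbb{Z}_3$-connected unless $G$ contains a bridge. (Thus, under the assumption $F(G,4)\le 3$, $G$ is $\mathbb{Z}_3$-connected if and only if $\kappa'(G)\ge 2$.) (ii) Suppose that $F(G,4)=0$. Then for every vertex $v\in V(G)$ with $d_G(v)\le 7$, if $\kappa'(G-v)\ge 2$, then $G$ is $\langle\mathbb{Z}_3\rangle$-extendable at $v$.
   Context: Graphs are finite, have no loops, and may have multiple edges. $F(G,k)$ denotes the minimum number of edges (possibly parallel to existing edges) that must be added to $G$, on the same vertex set, to obtain a supergraph with $k$ pairwise edge-disjoint spanning trees; in particular $F(G,k)=0$ if and only if $G$ has $k$ edge-disjoint spanning trees. A bridge is a cut-edge. $\kappa'(G)$ is the edge-connectivity; $\kappa'(G)\ge 2$ means that $G$ is connected and has no bridge (a one-vertex graph counts as satisfying this). For an orientation $D$, $d_D^+(v)$ and $d_D^-(v)$ denote the out-degree and in-degree of $v$. A zero-sum function of $G$ is a map $\beta: V(G)\to\mathbb{Z}_3$ with $\sum_{v\in V(G)}\beta(v)=0$ in $\mathbb{Z}_3$; a $\beta$-orientation of $G$ is an orientation $D$ of $G$ with $d_D^+(v)-d_D^-(v)=\beta(v)$ in $\mathbb{Z}_3$ for every $v\in V(G)$. $G$ is $\mathbb{Z}_3$-connected if it admits a $\beta$-orientation for every zero-sum function $\beta$ of $G$. $E_G(z_0)$ is the set of edges incident with $z_0$; a pre-orientation $D_{z_0}$ of $E_G(z_0)$ is an orientation of just these edges.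 $G$ is $\langle\mathbb{Z}_3\rangle$-extendable at $z_0$ if for every zero-sum function $\beta$ of $G$ and every pre-orientation $D_{z_0}$ of $E_G(z_0)$ with $d_{D_{z_0}}^+(z_0)-d_{D_{z_0}}^-(z_0)\equiv\beta(z_0)\pmod 3$, $D_{z_0}$ can be extended to a $\beta$-orientation of $G$. -}

module Defs where

import Algebra.Properties.CommutativeMonoid.Sum
open import Data.Bool using (Bool; true; false)
open import Data.Fin using (Fin; toℕ; _≟_; splitAt)
open import Data.Fin.Subset using (Subset; _∈_; ⊤; ∁; _∩_; _-_; ∣_∣; Nonempty; Empty)
open import Data.Fin.Subset.Properties using (∈⊤; x∈∁p⇒x∉p; x∈p∧x≢y⇒x∈p-y; p─q⊆p)
open import Data.Integer using (ℤ; +_; _⊖_) renaming (_-_ to _-ℤ_)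
import Data.Integer.Divisibility as ℤ
open import Data.List using (List; []; _∷_)
open import Data.List.Relation.Unary.Unique.Propositional using (Unique)
open import Data.Maybe using (Maybe; just; Is-just)
import Data.Maybe as Maybe
open import Data.Maybe.Properties using (≡-dec)
open import Data.Nat using (ℕ; _+_; _≤_)
open import Data.Nat.Divisibility using (_∣_)
open import Data.Nat.Properties using (+-0-commutativeMonoid)
open import Data.Product using (Σ; ∃; ∃₂; _×_; _,_; proj₁; proj₂; swap)
open import Data.Sum using (_⊎_; inj₁; inj₂; [_,_]′)
open import Data.Vec using (tabulate)
open import Data.Vec.Properties using (lookup∘tabulate; lookup⇒[]=)
open import Function using (_∘_; _⇔_)
open import Relation.Binary.Construct.Closure.ReflexiveTransitive using (Star; ε; _◅_)
open import Relation.Binary.PropositionalEquality using (_≡_; _≢_; refl; trans)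
open import Relation.Nullary using (¬_; does; _⊎-dec_)
open import Relation.Nullary.Decidable using (dec-true)
open import Relation.Unary using (Pred; Decidable)

open Algebra.Properties.CommutativeMonoid.Sum +-0-commutativeMonoid using (sum)

comprehension : ∀ {m ℓ} {P : Pred (Fin m) ℓ} → Decidable P → Subset m
comprehension P? = tabulate (does ∘ P?)

-- A loopless multigraph with vertex set Fin n and edge set Fin m.  The order
-- of the two ends of an edge carries no meaning; it only serves as a
-- reference for describing orientations.
record Graph (n m : ℕ) : Set where
  field
    ends     : Fin m → Fin n × Fin n
    loopless : ∀ e → proj₁ (ends e) ≢ proj₂ (ends e)

open Graph public

module _ {n m : ℕ} (G : Graph n m) where

  Joins : Fin m → Fin n → Fin n → Set
  Joins e u v = ends G e ≡ (u , v) ⊎ ends G e ≡ (v , u)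

  Incident : Fin n → Fin m → Set
  Incident v e = proj₁ (ends G e) ≡ v ⊎ proj₂ (ends G e) ≡ v

  incident? : ∀ v → Decidable (Incident v)
  incident? v e = (proj₁ (ends G e) ≟ v) ⊎-dec (proj₂ (ends G e) ≟ v)

  incidentEdges : Fin n → Subset m
  incidentEdges v = comprehension (incident? v)

  -- This counts edges, so parallel edges count separately; it is the degree
  -- because there are no loops.
  degree : Fin n → ℕ
  degree v = ∣ incidentEdges v ∣

  record Subgraph : Set where
    field
      vertices : Subset n
      edges    : Subset m
      closed   : ∀ {e v} → e ∈ edges → Incident v e → v ∈ vertices

open Subgraph public

module _ {n m : ℕ} {G : Graph n m} where

  Step : Subgraph G → Fin n → Fin n → Set
  Step H u v = ∃ λ e → e ∈ edges H × Joins G e u v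

  Walk : Subgraph G → Fin n → Fin n → Set
  Walk H = Star (Step H)

  edgesOf : ∀ H {u v} → Walk H u v → List (Fin m)
  edgesOf H ε             = []
  edgesOf H ((e , _) ◅ w) = e ∷ edgesOf H w

  -- The final vertex is omitted, so a closed walk lists its base point once.
  verticesOf : ∀ H {u v} → Walk H u v → List (Fin n)
  verticesOf H ε                 = []
  verticesOf H (_◅_ {i = u} _ w) = u ∷ verticesOf H w

  -- Two parallel edges form a cycle of length 2; uniqueness of the edges
  -- excludes traversing one edge back and forth.
  IsCycle : ∀ H {u} → Walk H u u → Set
  IsCycle H w = edgesOf H w ≢ [] × Unique (edgesOf H w) × Unique (verticesOf H w)

  Acyclic : Subgraph G → Set
  Acyclic H = ∀ u (w : Walk H u u) → ¬ IsCycle H w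

  Connected : Subgraph G → Set
  Connected H = Nonempty (vertices H) ×
                (∀ {u v} → u ∈ vertices H → v ∈ vertices H → Walk H u v)

  IsTree : Subgraph G → Set
  IsTree H = Connected H × Acyclic H

  deleteEdge : Subgraph G → Fin m → Subgraph G
  deleteEdge H e = record
    { vertices = vertices H
    ; edges    = edges H - e
    ; closed   = λ e′∈ → closed H (p─q⊆p (edges H) _ e′∈)
    }

  -- Deleting e separates two vertices of one component of H.
  IsBridge : Subgraph G → Fin m → Set
  IsBridge H e = e ∈ edges H × (∃₂ λ u v → Walk H u v × ¬ Walk (deleteEdge H e) u v)

  HasBridge : Subgraph G → Set
  HasBridge H = ∃ (IsBridge H)

  -- Edge-connectivity at least 2, where a single vertex qualifies.
  κ′≥2 : Subgraph G → Set
  κ′≥2 H = Connected H × ¬ HasBridge H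

module _ {n m : ℕ} (G : Graph n m) where

  spanning : Subset m → Subgraph G
  spanning S = record { vertices = ⊤ ; edges = S ; closed = λ _ _ → ∈⊤ }

  whole : Subgraph G
  whole = spanning ⊤

  deleteVertex : Fin n → Subgraph G
  deleteVertex v = record
    { vertices = ⊤ - v
    ; edges    = ∁ (incidentEdges G v)
    ; closed   = λ {e} e∈ inc → x∈p∧x≢y⇒x∈p-y ∈⊤ λ { refl →
        x∈∁p⇒x∉p e∈ (lookup⇒[]= e _
          (trans (lookup∘tabulate _ e) (dec-true (incident? G v e) inc))) }
    }

  DisjointSpanningTrees : ℕ → Set
  DisjointSpanningTrees k = Σ (Fin k → Subset m) λ T →
    (∀ i → IsTree (spanning (T i))) ×
    (∀ {i j} → i ≢ j → Empty (T i ∩ T j))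

addEdges : ∀ {n m f} → Graph n m → Graph n f → Graph n (m + f)
addEdges {n} {m} {f} G A = record
  { ends     = λ e → [ ends G , ends A ]′ (splitAt m e)
  ; loopless = λ e → noLoop (splitAt m e)
  }
  where
  noLoop : (x : Fin m ⊎ Fin f) → proj₁ ([ ends G , ends A ]′ x) ≢ proj₂ ([ ends G , ends A ]′ x)
  noLoop (inj₁ e) = loopless G e
  noLoop (inj₂ e) = loopless A e

module _ {n m : ℕ} (G : Graph n m) where

  Augmentable : ℕ → ℕ → Set
  Augmentable k f = Σ (Graph n f) λ A → DisjointSpanningTrees (addEdges G A) k

-- F[ G , k ]≡ f : the minimum number of edges whose addition to G yields k
-- edge-disjoint spanning trees is f.
F[_,_]≡_ : ∀ {n m} → Graph n m → ℕ → ℕ → Set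
F[ G , k ]≡ f = Augmentable G k f × (∀ f′ → Augmentable G k f′ → f ≤ f′)

-- Fin 3 holds the canonical residues of ℤ₃; equality in ℤ₃ of elements
-- computed from integers is expressed as congruence modulo 3.
ℤ₃ : Set
ℤ₃ = Fin 3

infix 4 _≈₃_
_≈₃_ : ℤ → ℤ₃ → Set
i ≈₃ b = + 3 ℤ.∣ (i -ℤ + toℕ b)

ZeroSum : ∀ {n} → (Fin n → ℤ₃) → Set
ZeroSum β = 3 ∣ sum (toℕ ∘ β)

-- true directs an edge from the first to the second of its reference ends,
-- false the other way round.
Orientation : ℕ → Set
Orientation m = Fin m → Bool

-- nothing marks the edges left undirected.
PartialOrientation : ℕ → Set
PartialOrientation m = Fin m → Maybe Bool

total : ∀ {m} → Orientation m → PartialOrientation m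
total D = just ∘ D

_Extends_ : ∀ {m} → Orientation m → PartialOrientation m → Set
D Extends P = ∀ e d → P e ≡ just d → D e ≡ d

module _ {n m : ℕ} (G : Graph n m) where

  -- (tail , head)
  arc : Fin m → Bool → Fin n × Fin n
  arc e true  = ends G e
  arc e false = swap (ends G e)

  tail head : PartialOrientation m → Fin m → Maybe (Fin n)
  tail D e = Maybe.map (proj₁ ∘ arc e) (D e)
  head D e = Maybe.map (proj₂ ∘ arc e) (D e)

  d⁺ d⁻ : PartialOrientation m → Fin n → ℕ
  d⁺ D v = ∣ comprehension (λ e → ≡-dec _≟_ (tail D e) (just v)) ∣
  d⁻ D v = ∣ comprehension (λ e → ≡-dec _≟_ (head D e) (just v)) ∣

  BalancedAt : (Fin n → ℤ₃) → PartialOrientation m → Fin n → Set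
  BalancedAt β D v = d⁺ D v ⊖ d⁻ D v ≈₃ β v

  IsβOrientation : (Fin n → ℤ₃) → Orientation m → Set
  IsβOrientation β D = ∀ v → BalancedAt β (total D) v

  ℤ₃-Connected : Set
  ℤ₃-Connected = ∀ β → ZeroSum β → ∃ (IsβOrientation β)

  IsPreOrientation : Fin n → PartialOrientation m → Set
  IsPreOrientation z P = ∀ e → Is-just (P e) ⇔ e ∈ incidentEdges G z

  ⟨ℤ₃⟩-ExtendableAt : Fin n → Set
  ⟨ℤ₃⟩-ExtendableAt z = ∀ β → ZeroSum β →
    ∀ P → IsPreOrientation z P → BalancedAt β P z →
    ∃ λ D → D Extends P × IsβOrientation β D

{-# OPTIONS --safe #-}
{-
By the easy half of the Nash-Williams–Tutte theorem, F(G,4) ≤ c makes every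
partition into k + 1 parts cross at least 4k − c edges; only this is used.  Deleting
a vertex of degree at most 7 raises c from 0 to at most 3, so (ii) is (i) for G − v
with the pre-oriented edges turned into prescribed charges.

For (i) with c = 3, induct on the number of vertices.  A proper part that is itself
dense is solved separately and contracted.  If there is none, every cut with at most
5 edges isolates a vertex x; x is removed and its edges are used to balance it, after
lifting one pair of them when deg x = 5.  What remains is 6-edge-connected.

That 6-edge-connected graphs are ℤ₃-connected is the theorem of Lovász, Thomassen, Wu
and Zhang.  The induction allows pre-oriented edges at one vertex z₀, here stubs, and
asks d(A) ≥ 4 + |τ(A)| for the other sets A and d(z₀) ≤ 4 + |τ(z₀)|, where τ(A) is
the residue in [−3, 3] of the prescribed net outflow, with the parity of d(A).  A set
of several vertices with d(A) ≤ 4 + |τ(A)| is contracted and then solved on its own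
with its boundary as stubs; at a vertex with d > 4 + |τ| edges are lifted; a vertex
with d = 4, τ = 0 is lifted away.  Otherwise d = 4 + |τ| at every vertex.  An edge
between vertices with τ of opposite signs is directed and deleted, and so is a stub
agreeing with the sign at its end.  If all signs agree and all stubs disagree, one
stub is exchanged for two opposite ones, as −1 ≡ 2 (mod 3), and an edge is deleted.

Whether a β-orientation exists is decidable, so the inductions may argue classically,
under a double negation.
-}

module Submission where

open import Defs
open import Algebra using (IsCommutativeMonoid)
import Algebra.Properties.CommutativeMonoid.Sum as VectorSum
open import Data.Bool using (Bool; true; false; not; _∧_; _∨_; _xor_; if_then_else_)
import Data.Bool.Properties as Bool
open import Data.Empty using (⊥)
open import Data.Fin using (Fin; zero; suc; _≟_; toℕ; _↑ˡ_; _↑ʳ_; join; splitAt; punchIn; punchOut)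
open import Data.Fin.Properties as Fin
  using (all?; injective⇒≤; splitAt-↑ˡ; splitAt⁻¹-↑ʳ; splitAt-join; join-splitAt;
         punchOut-injective; punchOut-punchIn; punchOut-cong; punchInᵢ≢i)
import Data.Fin.Subset as Subset
import Data.Fin.Subset.Properties as Subset
import Data.Integer as ℤ
import Data.Integer.Properties as ℤ
open import Data.List using (List; []; _∷_; _++_; map; length; filter; concatMap; tabulate; allFin)
open import Data.List.Membership.Propositional using (_∈_; find)
open import Data.List.Membership.Propositional.Properties using (∈-filter⁺; ∈-filter⁻; ∈-allFin)
open import Data.List.Properties
  using (filter-notAll; filter-accept; filter-reject; length-filter; length-map; length-++; tabulate-cong)
open import Data.List.Relation.Binary.Permutation.Homogeneous
  using (Permutation; refl; prep; swap) renaming (trans to _⨟_)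
import Data.List.Relation.Binary.Permutation.Homogeneous as Perm
import Data.List.Relation.Binary.Permutation.Setoid.Properties as PermSetoid
open import Data.List.Relation.Binary.Pointwise using (Pointwise; []; _∷_)
import Data.List.Relation.Binary.Pointwise as Pointwise
open import Data.List.Relation.Unary.All using (All; []; _∷_)
import Data.List.Relation.Unary.All as All
import Data.List.Relation.Unary.All.Properties as All
open import Data.List.Relation.Unary.Any using (Any; here; there)
import Data.List.Relation.Unary.Any as Any
open import Data.Maybe using (Maybe; just; nothing; fromMaybe; Is-just)
open import Data.Maybe.Properties using (≡-dec)
open import Data.Maybe.Relation.Unary.Any using () renaming (just to is-just)
open import Data.Nat using (ℕ; zero; suc; _+_; _*_; _≤_; _<_; z≤n; s≤s)
import Data.Nat.Divisibility as ℕ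
open import Data.Nat.Properties
  using (+-0-isCommutativeMonoid; +-0-commutativeMonoid; +-suc; +-assoc; +-comm; +-identityʳ;
         *-suc; *-identityʳ; ≤-refl; ≤-trans; ≤-reflexive; ≤-pred; ≰⇒>; <⇒≱; _≤?_; n≤1+n; n<1+n;
         m≤m+n; m≤n+m; +-mono-≤; +-monoˡ-≤; +-monoʳ-≤; +-monoʳ-<; +-cancelˡ-≤; +-cancelʳ-≤;
         m+n≡0⇒m≡0; m+n≡0⇒n≡0; suc-injective; module ≤-Reasoning)
open import Data.Nat.Solver using (module +-*-Solver)
open import Data.Product using (∃; ∃₂; _×_; _,_; proj₁; proj₂) renaming (swap to flip)
open import Data.Sum using (_⊎_; inj₁; inj₂; [_,_]′)
open import Data.Sum.Properties using (inj₁-injective; inj₂-injective)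
open import Data.Unit using (⊤; tt)
import Data.Vec as Vec
open import Data.Vec.Properties using (lookup∘tabulate; lookup⇒[]=; []=⇒lookup)
open import Function using (_∘_; _⇔_; mk⇔; Equivalence; case_of_)
open import Relation.Binary using (Setoid; IsEquivalence)
open import Relation.Binary.Construct.Closure.ReflexiveTransitive using (ε; _◅_; _◅◅_)
open import Relation.Binary.PropositionalEquality
  using (_≡_; _≢_; refl; sym; trans; cong; cong₂; subst; subst₂; isEquivalence; _≗_; setoid;
         module ≡-Reasoning)
open import Relation.Nullary using (¬_; Dec; yes; no; does; contradiction; ¬?)
open import Relation.Nullary.Decidable using (from-yes; ¬¬-excluded-middle; dec-true; dec-false; decidable-stable)
open import Relation.Unary using (Decidable)

-- Arithmetic modulo 3 and finite sums

-- The partition inequality replaces the trees because it suits the induction: partitions of a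
-- contracted graph are partitions of the original, and partitions of two complementary parts
-- combine into one of the whole. Adding a vertex of degree d to a partition of the rest as a part
-- of its own shows that deleting it turns the deficit c into c + d - 4. That is 3 when c = 3 and d
-- = 4, but 4 when d = 5, and there the lifted edge has to pay for the difference. A part to be
-- contracted is asked for deficit 2 instead of 3, because deficit 2 forces two edges across every
-- cut and so keeps bridges out.
--
-- In the second induction a residue modulo 3 and the parity of d determine τ modulo 6, so the
-- bounds on d become finite tables. By parity, d > 4 + |τ| means d ≥ 6 + |τ|, and this slack of two
-- is exactly the price of one lifting.

pattern 0₃ = zero
pattern 1₃ = suc zero
pattern 2₃ = suc (suc zero)

infixl 6 _⊕_
infix 8 ⊝_

_⊕_ : ℤ₃ → ℤ₃ → ℤ₃
0₃ ⊕ b  = b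
1₃ ⊕ 0₃ = 1₃
1₃ ⊕ 1₃ = 2₃
1₃ ⊕ 2₃ = 0₃
2₃ ⊕ 0₃ = 2₃
2₃ ⊕ 1₃ = 0₃
2₃ ⊕ 2₃ = 1₃

⊝_ : ℤ₃ → ℤ₃
⊝ 0₃ = 0₃
⊝ 1₃ = 2₃
⊝ 2₃ = 1₃

⊕-assoc : ∀ a b c → (a ⊕ b) ⊕ c ≡ a ⊕ (b ⊕ c)
⊕-assoc = from-yes (all? λ a → all? λ b → all? λ c → ((a ⊕ b) ⊕ c) ≟ (a ⊕ (b ⊕ c)))

⊕-comm : ∀ a b → a ⊕ b ≡ b ⊕ a
⊕-comm = from-yes (all? λ a → all? λ b → (a ⊕ b) ≟ (b ⊕ a))

⊕-identityʳ : ∀ a → a ⊕ 0₃ ≡ a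
⊕-identityʳ = from-yes (all? λ a → (a ⊕ 0₃) ≟ a)

⊕-cancelʳ : ∀ a b c → a ⊕ c ≡ b ⊕ c → a ≡ b
⊕-cancelʳ a b c eq = begin
  a               ≡⟨ undo a c ⟩
  (a ⊕ c) ⊕ ⊝ c   ≡⟨ cong (_⊕ ⊝ c) eq ⟩
  (b ⊕ c) ⊕ ⊝ c   ≡⟨ undo b c ⟨
  b               ∎
  where
  open ≡-Reasoning
  undo : ∀ a c → a ≡ (a ⊕ c) ⊕ ⊝ c
  undo = from-yes (all? λ a → all? λ c → a ≟ ((a ⊕ c) ⊕ ⊝ c))

⊕-⊝-cancel : ∀ a b → (a ⊕ ⊝ b) ⊕ b ≡ a
⊕-⊝-cancel = from-yes (all? λ a → all? λ b → ((a ⊕ ⊝ b) ⊕ b) ≟ a)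

⊕-0-isCommutativeMonoid : IsCommutativeMonoid _≡_ _⊕_ 0₃
⊕-0-isCommutativeMonoid = record
  { isMonoid = record
    { isSemigroup = record
      { isMagma = record { isEquivalence = isEquivalence ; ∙-cong = cong₂ _⊕_ }
      ; assoc = ⊕-assoc }
    ; identity = (λ _ → refl) , ⊕-identityʳ }
  ; comm = ⊕-comm }

-- Degrees are sums in ℕ and flows are sums in `ℤ₃`; the summation laws are shared by both.
module Sum {A : Set} {_∙_ : A → A → A} {ε : A} (M : IsCommutativeMonoid _≡_ _∙_ ε) where

  open IsCommutativeMonoid M using (assoc; comm; identityˡ; identityʳ)

  ∑ : {X : Set} → (X → A) → List X → A
  ∑ f []       = ε
  ∑ f (x ∷ xs) = f x ∙ ∑ f xs

  exchange : ∀ a b c → a ∙ (b ∙ c) ≡ b ∙ (a ∙ c)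
  exchange a b c = trans (sym (assoc a b c)) (trans (cong (_∙ c) (comm a b)) (assoc b a c))

  interchange : ∀ a b c d → (a ∙ b) ∙ (c ∙ d) ≡ (a ∙ c) ∙ (b ∙ d)
  interchange a b c d = trans (assoc a b (c ∙ d))
    (trans (cong (a ∙_) (exchange b c d)) (sym (assoc a c (b ∙ d))))

  module _ {X : Set} where

    ∑-cong-All : ∀ {f g : X → A} {xs} → All (λ x → f x ≡ g x) xs → ∑ f xs ≡ ∑ g xs
    ∑-cong-All []         = refl
    ∑-cong-All (eq ∷ eqs) = cong₂ _∙_ eq (∑-cong-All eqs)

    ∑-cong : ∀ {f g : X → A} → f ≗ g → ∀ xs → ∑ f xs ≡ ∑ g xs
    ∑-cong eq xs = ∑-cong-All (All.universal eq xs)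

    ∑-ε : ∀ (xs : List X) → ∑ (λ _ → ε) xs ≡ ε
    ∑-ε []       = refl
    ∑-ε (x ∷ xs) = trans (identityˡ _) (∑-ε xs)

    ∑-++ : ∀ (f : X → A) xs ys → ∑ f (xs ++ ys) ≡ ∑ f xs ∙ ∑ f ys
    ∑-++ f []       ys = sym (identityˡ _)
    ∑-++ f (x ∷ xs) ys = trans (cong (f x ∙_) (∑-++ f xs ys)) (sym (assoc _ _ _))

    ∑-∙ : ∀ (f g : X → A) xs → ∑ (λ x → f x ∙ g x) xs ≡ ∑ f xs ∙ ∑ g xs
    ∑-∙ f g []       = sym (identityˡ _)
    ∑-∙ f g (x ∷ xs) = trans (cong (_ ∙_) (∑-∙ f g xs)) (interchange _ _ _ _)

    ∑-map : ∀ {Y : Set} (f : Y → A) (h : X → Y) xs → ∑ f (map h xs) ≡ ∑ (f ∘ h) xs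
    ∑-map f h []       = refl
    ∑-map f h (x ∷ xs) = cong (_ ∙_) (∑-map f h xs)

    ∑-filter : ∀ (f : X → A) {P : X → Set} (P? : Decidable P) xs →
               ∑ f (filter P? xs) ≡ ∑ (λ x → if does (P? x) then f x else ε) xs
    ∑-filter f P? []       = refl
    ∑-filter f P? (x ∷ xs) with does (P? x)
    ... | true  = cong (f x ∙_) (∑-filter f P? xs)
    ... | false = trans (∑-filter f P? xs) (sym (identityˡ _))

    ∑-↭ : ∀ {R : X → X → Set} {f : X → A} → (∀ {x y} → R x y → f x ≡ f y) →
          ∀ {xs ys} → Permutation R xs ys → ∑ f xs ≡ ∑ f ys
    ∑-↭ resp (refl [])           = refl
    ∑-↭ resp (refl (r ∷ rs))     = cong₂ _∙_ (resp r) (∑-↭ resp (refl rs))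
    ∑-↭ resp (prep r p)          = cong₂ _∙_ (resp r) (∑-↭ resp p)
    ∑-↭ resp (swap r₁ r₂ p)      =
      trans (exchange _ _ _) (cong₂ _∙_ (resp r₂) (cong₂ _∙_ (resp r₁) (∑-↭ resp p)))
    ∑-↭ resp (p ⨟ q)         = trans (∑-↭ resp p) (∑-↭ resp q)

  ∑-concatMap : ∀ {X Y : Set} (f : Y → A) (h : X → List Y) xs →
                ∑ f (concatMap h xs) ≡ ∑ (∑ f ∘ h) xs
  ∑-concatMap f h []       = refl
  ∑-concatMap f h (x ∷ xs) =
    trans (∑-++ f (h x) (concatMap h xs)) (cong (_ ∙_) (∑-concatMap f h xs))

  ∑ᶠ : ∀ {m} → (Fin m → A) → A
  ∑ᶠ {zero}  f = ε
  ∑ᶠ {suc m} f = f zero ∙ ∑ᶠ (f ∘ suc)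

  ∑-tabulate : ∀ {X : Set} (f : X → A) {m} (g : Fin m → X) → ∑ f (tabulate g) ≡ ∑ᶠ (f ∘ g)
  ∑-tabulate f {zero}  g = refl
  ∑-tabulate f {suc m} g = cong (_ ∙_) (∑-tabulate f (g ∘ suc))

  ∑ᶠ-cong : ∀ {m} {f g : Fin m → A} → f ≗ g → ∑ᶠ f ≡ ∑ᶠ g
  ∑ᶠ-cong {zero}  eq = refl
  ∑ᶠ-cong {suc m} eq = cong₂ _∙_ (eq zero) (∑ᶠ-cong (eq ∘ suc))

  ∑ᶠ-ε : ∀ {m} {f : Fin m → A} → (∀ i → f i ≡ ε) → ∑ᶠ f ≡ ε
  ∑ᶠ-ε {zero}  eq = refl
  ∑ᶠ-ε {suc m} eq = trans (cong₂ _∙_ (eq zero) (∑ᶠ-ε (eq ∘ suc))) (identityˡ ε)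

  ∑ᶠ-∙ : ∀ {m} (f g : Fin m → A) → ∑ᶠ (λ i → f i ∙ g i) ≡ ∑ᶠ f ∙ ∑ᶠ g
  ∑ᶠ-∙ {zero}  f g = sym (identityˡ ε)
  ∑ᶠ-∙ {suc m} f g = trans (cong (_ ∙_) (∑ᶠ-∙ (f ∘ suc) (g ∘ suc))) (interchange _ _ _ _)

  ∑ᶠ-single : ∀ {m} (f : Fin m → A) i → (∀ j → j ≢ i → f j ≡ ε) → ∑ᶠ f ≡ f i
  ∑ᶠ-single f zero    eq = trans (cong (_ ∙_) (∑ᶠ-ε λ j → eq (suc j) λ ())) (identityʳ _)
  ∑ᶠ-single f (suc i) eq = trans (cong₂ _∙_ (eq zero λ ()) (∑ᶠ-single (f ∘ suc) i λ j j≢i →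
    eq (suc j) λ { refl → j≢i refl })) (identityˡ _)

  ∑ᶠ-swap : ∀ {m k} (f : Fin m → Fin k → A) → ∑ᶠ (λ i → ∑ᶠ (f i)) ≡ ∑ᶠ (λ j → ∑ᶠ (λ i → f i j))
  ∑ᶠ-swap {zero}  {k} f = sym (∑ᶠ-ε {k} λ _ → refl)
  ∑ᶠ-swap {suc m} f = trans (cong (∑ᶠ (f zero) ∙_) (∑ᶠ-swap (f ∘ suc))) (sym (∑ᶠ-∙ (f zero) (λ j → ∑ᶠ (λ i → f (suc i) j))))

module ℕ∑ = Sum +-0-isCommutativeMonoid
module ℤ₃∑ = Sum ⊕-0-isCommutativeMonoid

-- Double negation as a monad

infixl 1 _>>=_

return : ∀ {P : Set} → P → ¬ ¬ P
return p ¬p = ¬p p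

_>>=_ : ∀ {P Q : Set} → ¬ ¬ P → (P → ¬ ¬ Q) → ¬ ¬ Q
(p >>= f) ¬q = p λ x → f x ¬q

lem : ∀ {P : Set} → ¬ ¬ Dec P
lem = ¬¬-excluded-middle

-- Orientations of edge lists with stubs and charges

-- A stub (v , true) is an edge already directed from v to an auxiliary vertex z₀,
-- (v , false) one directed from z₀ to v.  Edge lists are undirected unless called
-- ds, and may contain loops.
Edge Stub Charge VSet : ℕ → Set
Edge n   = Fin n × Fin n
Stub n   = Fin n × Bool
Charge n = Fin n × ℤ₃
VSet n   = Fin n → Bool

sgn : Bool → ℤ₃
sgn true  = 1₃
sgn false = 2₃

ι : Bool → ℤ₃
ι true  = 1₃
ι false = 0₃

⟦_⟧ : Bool → ℕ
⟦ true ⟧  = 1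
⟦ false ⟧ = 0

infix 4 _~_ _≈_ _↭_

_~_ : ∀ {n} → Edge n → Edge n → Set
e ~ d = e ≡ d ⊎ e ≡ flip d

~-isEquivalence : ∀ {n} → IsEquivalence (_~_ {n})
~-isEquivalence = record
  { refl  = inj₁ refl
  ; sym   = λ { (inj₁ refl) → inj₁ refl ; (inj₂ refl) → inj₂ refl }
  ; trans = λ { (inj₁ refl) q → q
              ; (inj₂ refl) (inj₁ refl) → inj₂ refl
              ; (inj₂ refl) (inj₂ refl) → inj₁ refl } }

module ~ {n : ℕ} = IsEquivalence (~-isEquivalence {n})

edgeSetoid : ℕ → Setoid _ _
edgeSetoid n = record { Carrier = Edge n ; _≈_ = _~_ ; isEquivalence = ~-isEquivalence }

_≈_ : ∀ {n} → List (Edge n) → List (Edge n) → Set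
_≈_ = Permutation _~_

module ≈ {n : ℕ} = IsEquivalence (Perm.isEquivalence {R = _~_ {n}} ~.refl ~.sym)
module ≈-Properties {n : ℕ} = PermSetoid (edgeSetoid n)

_↭_ : ∀ {n} → List (Stub n) → List (Stub n) → Set
_↭_ = Permutation _≡_

↭-refl : ∀ {n} {st : List (Stub n)} → st ↭ st
↭-refl = refl (Pointwise.refl refl)

module _ {n : ℕ} where

  is : Fin n → VSet n
  is x v = does (x ≟ v)

  full : VSet n
  full _ = true

  infixr 7 _∩_

  _∩_ : VSet n → VSet n → VSet n
  (A ∩ C) v = A v ∧ C v

  cr : VSet n → Edge n → ℕ
  cr A (u , v) = ⟦ A u xor A v ⟧

  cut : VSet n → List (Edge n) → ℕ
  cut A = ℕ∑.∑ (cr A)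

  -- Two ends in `A` cancel, so the loops that contraction creates carry no flow and may stay in the
  -- list.
  fl : VSet n → Edge n → ℤ₃
  fl A (u , v) = ι (A u) ⊕ ⊝ ι (A v)

  net : VSet n → List (Edge n) → ℤ₃
  net A = ℤ₃∑.∑ (fl A)

  cnt : VSet n → Stub n → ℕ
  cnt A (v , _) = ⟦ A v ⟧

  stubs : VSet n → List (Stub n) → ℕ
  stubs A = ℕ∑.∑ (cnt A)

  sg : VSet n → Stub n → ℤ₃
  sg A (v , s) = if A v then sgn s else 0₃

  σ : VSet n → List (Stub n) → ℤ₃
  σ A = ℤ₃∑.∑ (sg A)

  ch : VSet n → Charge n → ℤ₃
  ch A (v , c) = if A v then c else 0₃

  chg : VSet n → List (Charge n) → ℤ₃
  chg A = ℤ₃∑.∑ (ch A)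

  deg : List (Edge n) → List (Stub n) → VSet n → ℕ
  deg es st A = cut A es + stubs A st

  -- U lists the vertices still in play and β the charges prescribed at them,
  -- which include the contribution of the stubs.
  record Sol (U : List (Fin n)) (es : List (Edge n)) (st : List (Stub n))
             (β : List (Charge n)) : Set where
    constructor mkSol
    field
      ds  : List (Edge n)
      ds~ : Pointwise _~_ ds es
      bal : ∀ {v} → v ∈ U → net (is v) ds ⊕ σ (is v) st ≡ chg (is v) β

  is-refl : ∀ x → is x x ≡ true
  is-refl x = dec-true (x ≟ x) refl

  is-≢ : ∀ {x y} → x ≢ y → is x y ≡ false
  is-≢ {x} {y} = dec-false (x ≟ y)

  is⇒≡ : ∀ {x y} → is x y ≡ true → x ≡ y
  is⇒≡ {x} {y} eq with yes x≡y ← x ≟ y = x≡y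

  separated : ∀ (A : VSet n) {x y} → A x ≡ true → A y ≡ false → x ≢ y
  separated A Ax Ay refl with () ← trans (sym Ax) Ay

  net-cong : ∀ {A A′ : VSet n} → A ≗ A′ → ∀ es → net A es ≡ net A′ es
  net-cong eq = ℤ₃∑.∑-cong λ (u , v) → cong₂ (λ a b → ι a ⊕ ⊝ ι b) (eq u) (eq v)

  σ-cong : ∀ {A A′ : VSet n} → A ≗ A′ → ∀ st → σ A st ≡ σ A′ st
  σ-cong eq = ℤ₃∑.∑-cong λ (v , s) → cong (if_then sgn s else 0₃) (eq v)

  chg-cong : ∀ {A A′ : VSet n} → A ≗ A′ → ∀ β → chg A β ≡ chg A′ β
  chg-cong eq = ℤ₃∑.∑-cong λ (v , c) → cong (if_then c else 0₃) (eq v)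

  cr-~ : ∀ (A : VSet n) {e d} → e ~ d → cr A e ≡ cr A d
  cr-~ A (inj₁ refl)                   = refl
  cr-~ A {d = u , v} (inj₂ refl) with A u | A v
  ... | true  | true  = refl
  ... | true  | false = refl
  ... | false | true  = refl
  ... | false | false = refl

  cut-≈ : ∀ A {es fs} → es ≈ fs → cut A es ≡ cut A fs
  cut-≈ A = ℕ∑.∑-↭ (cr-~ A)

  stubs-↭ : ∀ A {st st′} → st ↭ st′ → stubs A st ≡ stubs A st′
  stubs-↭ A = ℕ∑.∑-↭ (cong (cnt A))

  σ-↭ : ∀ A {st st′} → st ↭ st′ → σ A st ≡ σ A st′
  σ-↭ A = ℤ₃∑.∑-↭ (cong (sg A))

  Pointwise-~ : ∀ {ds es fs : List (Edge n)} → Pointwise _~_ ds es → Pointwise _~_ es fs →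
                Pointwise _~_ ds fs
  Pointwise-~ = Pointwise.transitive ~.trans

  -- Arcs are matched with edges by position, so a rearrangement of the edges has to carry the arcs
  -- along; the net outflow of every set survives.
  reorient : ∀ {ds es fs : List (Edge n)} → Pointwise _~_ ds es → es ≈ fs →
             ∃ λ ds′ → Pointwise _~_ ds′ fs × (∀ A → net A ds′ ≡ net A ds)
  reorient pw (refl pw′) = _ , Pointwise-~ pw pw′ , λ _ → refl
  reorient (r ∷ pw) (prep eq p) =
    let ds′ , pw′ , eq′ = reorient pw p in
    _ ∷ ds′ , ~.trans r eq ∷ pw′ , λ A → cong (_ ⊕_) (eq′ A)
  reorient (_∷_ {x = d₁} r₁ (_∷_ {x = d₂} r₂ pw)) (swap eq₁ eq₂ p) =
    let ds′ , pw′ , eq′ = reorient pw p in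
    d₂ ∷ d₁ ∷ ds′ , ~.trans r₂ eq₂ ∷ ~.trans r₁ eq₁ ∷ pw′ ,
    λ A → trans (ℤ₃∑.exchange (fl A d₂) (fl A d₁) _) (cong (λ z → fl A d₁ ⊕ (fl A d₂ ⊕ z)) (eq′ A))
  reorient pw (p ⨟ q) =
    let ds₁ , pw₁ , eq₁ = reorient pw p
        ds₂ , pw₂ , eq₂ = reorient pw₁ q in
    ds₂ , pw₂ , λ A → trans (eq₂ A) (eq₁ A)

  Sol-≈ : ∀ {U es fs st β} → es ≈ fs → Sol U es st β → Sol U fs st β
  Sol-≈ p (mkSol ds ds~ bal) =
    let ds′ , pw , eq = reorient ds~ p in
    mkSol ds′ pw λ {v} v∈ → trans (cong (_⊕ _) (eq (is v))) (bal v∈)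

  Sol-↭ : ∀ {U es st st′ β} → st ↭ st′ → Sol U es st β → Sol U es st′ β
  Sol-↭ p (mkSol ds pw bal) =
    mkSol ds pw λ {v} v∈ → trans (cong (net (is v) ds ⊕_) (sym (σ-↭ (is v) p))) (bal v∈)

  pull-edge : ∀ A (es : List (Edge n)) {c} → cut A es ≡ suc c →
    ∃₂ λ x y → ∃ λ es′ → es ≈ (x , y) ∷ es′ × A x ≡ true × A y ≡ false × cut A es′ ≡ c
  pull-edge A ((u , v) ∷ es) eq with A u in Au | A v in Av
  ... | true | false = u , v , es , ≈.refl , Au , Av , suc-injective eq
  ... | false | true =
    v , u , es , prep (inj₂ refl) ≈.refl , Av , Au , suc-injective eq
  ... | true | true =
    let x , y , es′ , p , Ax , Ay , eq′ = pull-edge A es eq in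
    x , y , (u , v) ∷ es′ , (prep ~.refl p ⨟ swap ~.refl ~.refl ≈.refl) , Ax , Ay ,
    trans (cong (_+ cut A es′) (cong₂ (λ a b → ⟦ a xor b ⟧) Au Av)) eq′
  ... | false | false =
    let x , y , es′ , p , Ax , Ay , eq′ = pull-edge A es eq in
    x , y , (u , v) ∷ es′ , (prep ~.refl p ⨟ swap ~.refl ~.refl ≈.refl) , Ax , Ay ,
    trans (cong (_+ cut A es′) (cong₂ (λ a b → ⟦ a xor b ⟧) Au Av)) eq′

  pull-stub : ∀ A (st : List (Stub n)) {c} → stubs A st ≡ suc c →
    ∃₂ λ x s → ∃ λ st′ → st ↭ (x , s) ∷ st′ × A x ≡ true × stubs A st′ ≡ c
  pull-stub A ((u , s) ∷ st) eq with A u in Au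
  ... | true  = u , s , st , ↭-refl , Au , suc-injective eq
  ... | false =
    let x , t , st′ , p , Ax , eq′ = pull-stub A st eq in
    x , t , (u , s) ∷ st′ , (prep refl p ⨟ swap refl refl ↭-refl) , Ax ,
    trans (cong (λ a → ⟦ a ⟧ + stubs A st′) Au) eq′

  -- The arc on the lifted edge is rerouted through `x`, which it enters and leaves once, so no
  -- balance changes.
  unlift-edges : ∀ {U x y w es st β} →
    Sol U ((y , w) ∷ es) st β → Sol U ((x , y) ∷ (x , w) ∷ es) st β
  unlift-edges {x = x} {y} {w} (mkSol (_ ∷ ds) (inj₁ refl ∷ pw) bal) =
    mkSol ((y , x) ∷ (x , w) ∷ ds) (inj₂ refl ∷ inj₁ refl ∷ pw) λ {v} v∈ →
      trans (cong (_⊕ _) (through (ι (is v x)) (ι (is v y)) (⊝ ι (is v w)) _)) (bal v∈)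
    where
    through : ∀ x y w r → (y ⊕ ⊝ x) ⊕ ((x ⊕ w) ⊕ r) ≡ (y ⊕ w) ⊕ r
    through = from-yes (all? λ x → all? λ y → all? λ w → all? λ r →
      ((y ⊕ ⊝ x) ⊕ ((x ⊕ w) ⊕ r)) ≟ ((y ⊕ w) ⊕ r))
  unlift-edges {x = x} {y} {w} (mkSol (_ ∷ ds) (inj₂ refl ∷ pw) bal) =
    mkSol ((x , y) ∷ (w , x) ∷ ds) (inj₁ refl ∷ inj₂ refl ∷ pw) λ {v} v∈ →
      trans (cong (_⊕ _) (through (ι (is v x)) (⊝ ι (is v y)) (ι (is v w)) _)) (bal v∈)
    where
    through : ∀ x y w r → (x ⊕ y) ⊕ ((w ⊕ ⊝ x) ⊕ r) ≡ (w ⊕ y) ⊕ r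
    through = from-yes (all? λ x → all? λ y → all? λ w → all? λ r →
      ((x ⊕ y) ⊕ ((w ⊕ ⊝ x) ⊕ r)) ≟ ((w ⊕ y) ⊕ r))

  -- The edge is directed so that it continues the stub: y → x → z₀ or z₀ → x → y.
  unlift-stub : ∀ {U x y t es st β} →
    Sol U es ((y , t) ∷ st) β → Sol U ((x , y) ∷ es) ((x , t) ∷ st) β
  unlift-stub {x = x} {y} {true} (mkSol ds pw bal) =
    mkSol ((y , x) ∷ ds) (inj₂ refl ∷ pw) λ {v} v∈ →
      trans (through (is v x) (is v y) _ _) (bal v∈)
    where
    through : ∀ a b r s → ((ι b ⊕ ⊝ ι a) ⊕ r) ⊕ ((if a then 1₃ else 0₃) ⊕ s) ≡
                          r ⊕ ((if b then 1₃ else 0₃) ⊕ s)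
    through true  true  = from-yes (all? λ r → all? λ s → (r ⊕ (1₃ ⊕ s)) ≟ (r ⊕ (1₃ ⊕ s)))
    through true  false = from-yes (all? λ r → all? λ s → ((2₃ ⊕ r) ⊕ (1₃ ⊕ s)) ≟ (r ⊕ s))
    through false true  = from-yes (all? λ r → all? λ s → ((1₃ ⊕ r) ⊕ s) ≟ (r ⊕ (1₃ ⊕ s)))
    through false false = λ r s → refl
  unlift-stub {x = x} {y} {false} (mkSol ds pw bal) =
    mkSol ((x , y) ∷ ds) (inj₁ refl ∷ pw) λ {v} v∈ →
      trans (through (is v x) (is v y) _ _) (bal v∈)
    where
    through : ∀ a b r s → ((ι a ⊕ ⊝ ι b) ⊕ r) ⊕ ((if a then 2₃ else 0₃) ⊕ s) ≡
                          r ⊕ ((if b then 2₃ else 0₃) ⊕ s)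
    through true  true  = from-yes (all? λ r → all? λ s → (r ⊕ (2₃ ⊕ s)) ≟ (r ⊕ (2₃ ⊕ s)))
    through true  false = from-yes (all? λ r → all? λ s → ((1₃ ⊕ r) ⊕ (2₃ ⊕ s)) ≟ (r ⊕ s))
    through false true  = from-yes (all? λ r → all? λ s → ((2₃ ⊕ r) ⊕ s) ≟ (r ⊕ (2₃ ⊕ s)))
    through false false = λ r s → refl

  -- An arc from x to y if s, and from y to x otherwise; pushing it changes the
  -- charge of x by sgn (not s) = − sgn s and that of y by sgn s.
  push : Bool → Fin n → Fin n → List (Charge n) → List (Charge n)
  push s x y β = (x , sgn (not s)) ∷ (y , sgn s) ∷ β

  unpush : ∀ s {U x y es st β} → Sol U es st (push s x y β) → Sol U ((x , y) ∷ es) st β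
  unpush true {x = x} {y} (mkSol ds pw bal) =
    mkSol ((x , y) ∷ ds) (inj₁ refl ∷ pw) λ {v} v∈ →
      through (is v x) (is v y) _ _ _ (bal v∈)
    where
    through : ∀ a b r s t → r ⊕ s ≡ (if a then 2₃ else 0₃) ⊕ ((if b then 1₃ else 0₃) ⊕ t) →
              ((ι a ⊕ ⊝ ι b) ⊕ r) ⊕ s ≡ t
    through a b r s t eq = trans (⊕-assoc (ι a ⊕ ⊝ ι b) r s)
      (trans (cong ((ι a ⊕ ⊝ ι b) ⊕_) eq) (cancel a b t))
      where
      cancel : ∀ a b t → (ι a ⊕ ⊝ ι b) ⊕ ((if a then 2₃ else 0₃) ⊕ ((if b then 1₃ else 0₃) ⊕ t)) ≡ t
      cancel true  true  = from-yes (all? λ t → (2₃ ⊕ (1₃ ⊕ t)) ≟ t)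
      cancel true  false = from-yes (all? λ t → (1₃ ⊕ (2₃ ⊕ t)) ≟ t)
      cancel false true  = from-yes (all? λ t → (2₃ ⊕ (1₃ ⊕ t)) ≟ t)
      cancel false false = λ t → refl
  unpush false {x = x} {y} (mkSol ds pw bal) =
    mkSol ((y , x) ∷ ds) (inj₂ refl ∷ pw) λ {v} v∈ →
      through (is v x) (is v y) _ _ _ (bal v∈)
    where
    through : ∀ a b r s t → r ⊕ s ≡ (if a then 1₃ else 0₃) ⊕ ((if b then 2₃ else 0₃) ⊕ t) →
              ((ι b ⊕ ⊝ ι a) ⊕ r) ⊕ s ≡ t
    through a b r s t eq = trans (⊕-assoc (ι b ⊕ ⊝ ι a) r s)
      (trans (cong ((ι b ⊕ ⊝ ι a) ⊕_) eq) (cancel a b t))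
      where
      cancel : ∀ a b t → (ι b ⊕ ⊝ ι a) ⊕ ((if a then 1₃ else 0₃) ⊕ ((if b then 2₃ else 0₃) ⊕ t)) ≡ t
      cancel true  true  = from-yes (all? λ t → (1₃ ⊕ (2₃ ⊕ t)) ≟ t)
      cancel true  false = from-yes (all? λ t → (2₃ ⊕ (1₃ ⊕ t)) ≟ t)
      cancel false true  = from-yes (all? λ t → (1₃ ⊕ (2₃ ⊕ t)) ≟ t)
      cancel false false = λ t → refl

-- Contraction and restriction

module _ {n : ℕ} where

  EndsIn : List (Fin n) → List (Edge n) → Set
  EndsIn U = All λ e → proj₁ e ∈ U × proj₂ e ∈ U

  Located : List (Fin n) → List (Edge n) → List (Stub n) → List (Charge n) → Set
  Located U es st β =
    EndsIn U es ×
    All (λ s → proj₁ s ∈ U) st × All (λ c → proj₁ c ∈ U) β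

  -- An orientation that solves the graph in which C is contracted to a point.
  record QuotientSol (C : VSet n) (U : List (Fin n)) (es : List (Edge n))
                     (st : List (Stub n)) (β : List (Charge n)) : Set where
    constructor mkQuotientSol
    field
      ds   : List (Edge n)
      ds~  : Pointwise _~_ ds es
      bal  : ∀ {v} → v ∈ U → C v ≡ false → net (is v) ds ⊕ σ (is v) st ≡ chg (is v) β
      balC : net C ds ⊕ σ C st ≡ chg C β

  member? : (C : VSet n) → Decidable (λ v → C v ≡ true)
  member? C v = C v Bool.≟ true

  inside? : (C : VSet n) → Decidable (λ e → C (proj₁ e) ∧ C (proj₂ e) ≡ true)
  inside? C (u , v) = C u ∧ C v Bool.≟ true

  _∣ᵥ_ : List (Fin n) → VSet n → List (Fin n)
  U ∣ᵥ C = filter (member? C) U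

  _∣ₑ_ : List (Edge n) → VSet n → List (Edge n)
  es ∣ₑ C = filter (inside? C) es

  _∣ₛ_ : List (Stub n) → VSet n → List (Stub n)
  st ∣ₛ C = filter (member? C ∘ proj₁) st

  _∣ᵦ_ : List (Charge n) → VSet n → List (Charge n)
  β ∣ᵦ C = filter (member? C ∘ proj₁) β

  infixl 7 _∣ᵥ_ _∣ₑ_ _∣ₛ_ _∣ᵦ_

  module _ (C : VSet n) (a : Fin n) (Ca : C a ≡ true) where

    contract : Fin n → Fin n
    contract v = if C v then a else v

    contractₑ : Edge n → Edge n
    contractₑ (u , v) = contract u , contract v

    contractₛ : Stub n → Stub n
    contractₛ (v , s) = contract v , s

    contractᵦ : Charge n → Charge n
    contractᵦ (v , c) = contract v , c

    remaining : List (Fin n) → List (Fin n)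
    remaining = filter (λ v → contract v ≟ v)

    contract-∈ : ∀ {U v} → a ∈ U → v ∈ U → contract v ∈ remaining U
    contract-∈ {v = v} a∈ v∈ with C v in Cv
    ... | true  = ∈-filter⁺ _ a∈ (cong (if_then a else a) Ca)
    ... | false = ∈-filter⁺ _ v∈ (cong (if_then a else v) Cv)

    length-remaining : ∀ {U b} → b ∈ U → C b ≡ true → b ≢ a → length (remaining U) < length U
    length-remaining {U} {b} b∈ Cb b≢a = filter-notAll _ U
      (Any.map (λ { refl eq → b≢a (trans (sym eq) (cong (if_then a else b) Cb)) }) b∈)

    contract-Located : ∀ {U es st β} → a ∈ U → Located U es st β →
      Located (remaining U) (map contractₑ es) (map contractₛ st) (map contractᵦ β)
    contract-Located a∈ (e∈ , s∈ , b∈) =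
      All.map⁺ (All.map (λ (p , q) → contract-∈ a∈ p , contract-∈ a∈ q) e∈) ,
      All.map⁺ (All.map (contract-∈ a∈) s∈) ,
      All.map⁺ (All.map (contract-∈ a∈) b∈)

    remaining⁻ : ∀ {U v} → v ∈ remaining U → v ∈ U × contract v ≡ v
    remaining⁻ {U} = ∈-filter⁻ (λ v → contract v ≟ v) {xs = U}

    remaining-fixed : ∀ (A : VSet n) {U v b} → v ∈ remaining U → A v ≡ b → A (contract v) ≡ b
    remaining-fixed A {U} v∈ Av = trans (cong A (proj₂ (remaining⁻ {U} v∈))) Av

    uncontract : ∀ {ds′ es} → Pointwise _~_ ds′ (map contractₑ es) →
                 ∃ λ ds → Pointwise _~_ ds es × map contractₑ ds ≡ ds′
    uncontract {es = []}     []               = [] , [] , refl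
    uncontract {es = e ∷ es} (inj₁ refl ∷ pw) =
      let ds , pw′ , eq = uncontract pw in e ∷ ds , inj₁ refl ∷ pw′ , cong (_ ∷_) eq
    uncontract {es = e ∷ es} (inj₂ refl ∷ pw) =
      let ds , pw′ , eq = uncontract pw in flip e ∷ ds , inj₂ refl ∷ pw′ , cong (_ ∷_) eq

    -- Balances are pulled back along `contract`: the preimage of `a` is `C`, and that of any other
    -- remaining vertex is the vertex itself.
    quotientSol : ∀ {U es st β} → a ∈ U →
      Sol (remaining U) (map contractₑ es) (map contractₛ st) (map contractᵦ β) →
      QuotientSol C U es st β
    quotientSol {U} {es} {st} {β} a∈ (mkSol ds′ pw bal) with uncontract pw
    ... | ds , pw′ , refl = mkQuotientSol ds pw′
      (λ {v} v∈ Cv → pulled-back v (is v) (∈-filter⁺ _ v∈ (cong (if_then a else v) Cv)) (outer Cv))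
      (pulled-back a C (∈-filter⁺ _ a∈ (cong (if_then a else a) Ca)) inner)
      where
      pulled-back : ∀ v A → v ∈ remaining U → is v ∘ contract ≗ A →
                    net A ds ⊕ σ A st ≡ chg A β
      pulled-back v A v∈ eq = begin
        net A ds ⊕ σ A st
          ≡⟨ cong₂ _⊕_ (net-cong eq ds) (σ-cong eq st) ⟨
        net (is v ∘ contract) ds ⊕ σ (is v ∘ contract) st
          ≡⟨ cong₂ _⊕_ (ℤ₃∑.∑-map (fl (is v)) contractₑ ds) (ℤ₃∑.∑-map (sg (is v)) contractₛ st) ⟨
        net (is v) (map contractₑ ds) ⊕ σ (is v) (map contractₛ st)
          ≡⟨ bal v∈ ⟩
        chg (is v) (map contractᵦ β)
          ≡⟨ ℤ₃∑.∑-map (ch (is v)) contractᵦ β ⟩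
        chg (is v ∘ contract) β
          ≡⟨ chg-cong eq β ⟩
        chg A β ∎
        where open ≡-Reasoning
      outer : ∀ {v} → C v ≡ false → is v ∘ contract ≗ is v
      outer {v} Cv w with C w in Cw
      ... | true  = trans (is-≢ {x = v} {y = a} λ { refl → separated C Ca Cv refl })
                          (sym (is-≢ {x = v} {y = w} λ { refl → separated C Cw Cv refl }))
      ... | false = refl
      inner : is a ∘ contract ≗ C
      inner w with C w in Cw
      ... | true  = is-refl a
      ... | false = is-≢ {x = a} {y = w} λ { refl → separated C Ca Cw refl }

  -- The arcs leaving C, seen from C, are the stubs of the subgraph induced on C.
  stubsOf : VSet n → Edge n → List (Stub n)
  stubsOf C (u , v) with C u | C v
  ... | true  | false = (u , true) ∷ []
  ... | false | true  = (v , false) ∷ []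
  ... | _     | _     = []

  filter-split : ∀ {C : VSet n} es → es ≈ es ∣ₑ C ++ filter (¬? ∘ inside? C) es
  filter-split []       = ≈.refl
  filter-split {C} (e ∷ es) with does (inside? C e)
  ... | true  = prep ~.refl (filter-split {C} es)
  ... | false = prep ~.refl (filter-split {C} es) ⨟ ≈.sym (≈-Properties.↭-shift (es ∣ₑ C) _)

  restrict-ends : ∀ C {U es} → EndsIn U es →
                  EndsIn (U ∣ᵥ C) (es ∣ₑ C)
  restrict-ends C {es = es} e∈ =
    All.zipWith (λ { {u , v} ((u∈ , v∈) , ins) → ∈-filter⁺ (member? C) u∈ (∧-trueˡ ins) ,
                                                ∈-filter⁺ (member? C) v∈ (∧-trueʳ {C u} ins) })
      (All.filter⁺ (inside? C) e∈ , All.all-filter (inside? C) es)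
    where
    ∧-trueˡ : ∀ {a b} → a ∧ b ≡ true → a ≡ true
    ∧-trueˡ {true} _ = refl
    ∧-trueʳ : ∀ {a b} → a ∧ b ≡ true → b ≡ true
    ∧-trueʳ {true} eq = eq

  is-∩ : ∀ {C : VSet n} {v} → C v ≡ true → is v ∩ C ≗ is v
  is-∩ {v = v} Cv w with v ≟ w
  ... | yes refl = Cv
  ... | no  _    = refl

  masked : ∀ (s : ℤ₃) a c → (if does (c Bool.≟ true) then if a then s else 0₃ else 0₃) ≡
                            (if a ∧ c then s else 0₃)
  masked s a     false = sym (cong (if_then s else 0₃) (Bool.∧-zeroʳ a))
  masked s true  true  = refl
  masked s false true  = refl

  -- Once everything outside `C` is balanced and `C` is balanced as a whole, only the edges inside
  -- `C` are still to be directed. The arcs of `ds` across the boundary are frozen as stubs, those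
  -- inside are forgotten.
  module Restrict {C : VSet n} {U : List (Fin n)} {es : List (Edge n)}
                  {st : List (Stub n)} {β : List (Charge n)} (q : QuotientSol C U es st β) where
    open QuotientSol q

    st′ : List (Stub n)
    st′ = st ∣ₛ C ++ concatMap (stubsOf C) ds

    stubs-st′ : ∀ A → stubs A st′ ≡ stubs (A ∩ C) st + ℕ∑.∑ (stubs A ∘ stubsOf C) ds
    stubs-st′ A = trans (ℕ∑.∑-++ (cnt A) (st ∣ₛ C) _)
      (cong₂ _+_ (trans (ℕ∑.∑-filter (cnt A) _ st) (ℕ∑.∑-cong (λ (v , _) → counted (A v) (C v)) st))
                 (ℕ∑.∑-concatMap (cnt A) (stubsOf C) ds))
      where
      counted : ∀ a c → (if does (c Bool.≟ true) then ⟦ a ⟧ else 0) ≡ ⟦ a ∧ c ⟧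
      counted true  true  = refl
      counted true  false = refl
      counted false true  = refl
      counted false false = refl

    σ-st′ : ∀ A → σ A st′ ≡ σ (A ∩ C) st ⊕ ℤ₃∑.∑ (σ A ∘ stubsOf C) ds
    σ-st′ A = trans (ℤ₃∑.∑-++ (sg A) (st ∣ₛ C) _)
      (cong₂ _⊕_ (trans (ℤ₃∑.∑-filter (sg A) _ st)
                        (ℤ₃∑.∑-cong (λ (v , s) → masked (sgn s) (A v) (C v)) st))
                 (ℤ₃∑.∑-concatMap (sg A) (stubsOf C) ds))

    chg-restrict : ∀ A → chg A (β ∣ᵦ C) ≡ chg (A ∩ C) β
    chg-restrict A = trans (ℤ₃∑.∑-filter (ch A) _ β)
                           (ℤ₃∑.∑-cong (λ (v , c) → masked c (A v) (C v)) β)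

    -- Every boundary edge survives as one stub, so degree conditions on subsets of `C` are
    -- inherited without loss.
    deg-restrict : ∀ A → deg (es ∣ₑ C) st′ A ≡ deg es st (A ∩ C)
    deg-restrict A = begin
      cut A (es ∣ₑ C) + stubs A st′
        ≡⟨ cong₂ _+_ (ℕ∑.∑-filter (cr A) _ es) (stubs-st′ A) ⟩
      ℕ∑.∑ cr′ es + (stubs (A ∩ C) st + ℕ∑.∑ (stubs A ∘ stubsOf C) ds)
        ≡⟨ cong (_+ (stubs (A ∩ C) st + ℕ∑.∑ (stubs A ∘ stubsOf C) ds)) (ℕ∑.∑-↭ cr′-~ (refl ds~)) ⟨
      ℕ∑.∑ cr′ ds + (stubs (A ∩ C) st + ℕ∑.∑ (stubs A ∘ stubsOf C) ds)
        ≡⟨ cong (ℕ∑.∑ cr′ ds +_) (+-comm (stubs (A ∩ C) st) _) ⟩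
      ℕ∑.∑ cr′ ds + (ℕ∑.∑ (stubs A ∘ stubsOf C) ds + stubs (A ∩ C) st)
        ≡⟨ +-assoc (ℕ∑.∑ cr′ ds) _ _ ⟨
      ℕ∑.∑ cr′ ds + ℕ∑.∑ (stubs A ∘ stubsOf C) ds + stubs (A ∩ C) st
        ≡⟨ cong (_+ stubs (A ∩ C) st) (ℕ∑.∑-∙ cr′ (stubs A ∘ stubsOf C) ds) ⟨
      ℕ∑.∑ (λ d → cr′ d + stubs A (stubsOf C d)) ds + stubs (A ∩ C) st
        ≡⟨ cong (_+ stubs (A ∩ C) st) (ℕ∑.∑-cong edgewise ds) ⟩
      cut (A ∩ C) ds + stubs (A ∩ C) st
        ≡⟨ cong (_+ stubs (A ∩ C) st) (cut-≈ (A ∩ C) (refl ds~)) ⟩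
      cut (A ∩ C) es + stubs (A ∩ C) st ∎
      where
      open ≡-Reasoning
      cr′ : Edge n → ℕ
      cr′ e = if does (inside? C e) then cr A e else 0
      cr′-~ : ∀ {e d} → e ~ d → cr′ e ≡ cr′ d
      cr′-~ {d = u , v} (inj₁ refl) = refl
      cr′-~ {d = u , v} (inj₂ refl) =
        cong₂ (λ c k → if does (c Bool.≟ true) then k else 0)
              (Bool.∧-comm (C v) (C u)) (cr-~ A {v , u} {u , v} (inj₂ refl))
      edgewise : ∀ d → cr′ d + stubs A (stubsOf C d) ≡ cr (A ∩ C) d
      edgewise (u , v) with C u | C v
      ... | true  | true  with A u | A v
      ...   | true  | true  = refl
      ...   | true  | false = refl
      ...   | false | true  = refl
      ...   | false | false = refl
      edgewise (u , v) | true  | false with A u | A v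
      ...   | true  | true  = refl
      ...   | true  | false = refl
      ...   | false | true  = refl
      ...   | false | false = refl
      edgewise (u , v) | false | true  with A u | A v
      ...   | true  | true  = refl
      ...   | true  | false = refl
      ...   | false | true  = refl
      ...   | false | false = refl
      edgewise (u , v) | false | false with A u | A v
      ...   | true  | true  = refl
      ...   | true  | false = refl
      ...   | false | true  = refl
      ...   | false | false = refl

    -- The stubs record the net outflow of `C`, so the solvability condition of the part is the
    -- balance of `C` in the quotient.
    charge-zero : σ full st′ ≡ chg full (β ∣ᵦ C)
    charge-zero = begin
      σ full st′                                     ≡⟨ σ-st′ full ⟩
      σ C st ⊕ ℤ₃∑.∑ (σ full ∘ stubsOf C) ds         ≡⟨ cong (σ C st ⊕_) (ℤ₃∑.∑-cong edgewise ds) ⟩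
      σ C st ⊕ net C ds                              ≡⟨ ⊕-comm (σ C st) (net C ds) ⟩
      net C ds ⊕ σ C st                              ≡⟨ balC ⟩
      chg C β                                        ≡⟨ chg-restrict full ⟨
      chg full (β ∣ᵦ C)                              ∎
      where
      open ≡-Reasoning
      edgewise : ∀ d → σ full (stubsOf C d) ≡ fl C d
      edgewise (u , v) with C u | C v
      ... | true  | true  = refl
      ... | true  | false = refl
      ... | false | true  = refl
      ... | false | false = refl

    located : Located U es st β → Located (U ∣ᵥ C) (es ∣ₑ C) st′ (β ∣ᵦ C)
    located (e∈ , s∈ , b∈) =
      restrict-ends C e∈ ,
      All.++⁺ (All.zipWith (λ (s∈ , Cs) → inC s∈ Cs)
                (All.filter⁺ (member? C ∘ proj₁) s∈ , All.all-filter (member? C ∘ proj₁) st))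
              (ends∈ ds~ e∈) ,
      All.zipWith (λ (b∈ , Cb) → inC b∈ Cb)
        (All.filter⁺ (member? C ∘ proj₁) b∈ , All.all-filter (member? C ∘ proj₁) β)
      where
      inC : ∀ {v} → v ∈ U → C v ≡ true → v ∈ U ∣ᵥ C
      inC = ∈-filter⁺ (member? C)
      here∈ : ∀ d → proj₁ d ∈ U × proj₂ d ∈ U → All (λ s → proj₁ s ∈ U ∣ᵥ C) (stubsOf C d)
      here∈ (u , v) (u∈ , v∈) with C u in Cu | C v in Cv
      ... | true  | true  = []
      ... | true  | false = inC u∈ Cu ∷ []
      ... | false | true  = inC v∈ Cv ∷ []
      ... | false | false = []
      ends∈ : ∀ {ds es} → Pointwise _~_ ds es → EndsIn U es →
              All (λ s → proj₁ s ∈ U ∣ᵥ C) (concatMap (stubsOf C) ds)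
      ends∈ [] [] = []
      ends∈ (inj₁ refl ∷ pw) (e∈ ∷ es∈)        = All.++⁺ (here∈ _ e∈) (ends∈ pw es∈)
      ends∈ (inj₂ refl ∷ pw) ((u∈ , v∈) ∷ es∈) = All.++⁺ (here∈ _ (v∈ , u∈)) (ends∈ pw es∈)

    -- The new arcs inside `C` are invisible to vertices outside, and for a vertex of `C` the outer
    -- arcs act exactly as its stubs.
    extend : Sol (U ∣ᵥ C) (es ∣ₑ C) st′ (β ∣ᵦ C) → Sol U es st β
    extend (mkSol dsC pw balIn) =
      let ds″ , pw″ , eq = reorient (Pointwise.++⁺ pw outside~) (≈.sym (filter-split {C} es)) in
      mkSol ds″ pw″ λ {v} v∈ →
        trans (cong (_⊕ σ (is v) st) (trans (eq (is v)) (ℤ₃∑.∑-++ (fl (is v)) dsC outside)))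
              (balanced v v∈)
      where
      outside : List (Edge n)
      outside = filter (¬? ∘ inside? C) ds
      inside-~ : ∀ {e d} → e ~ d → C (proj₁ e) ∧ C (proj₂ e) ≡ true → C (proj₁ d) ∧ C (proj₂ d) ≡ true
      inside-~ (inj₁ refl) ins = ins
      inside-~ {d = u , v} (inj₂ refl) ins = trans (Bool.∧-comm (C u) (C v)) ins
      outside~ : Pointwise _~_ outside (filter (¬? ∘ inside? C) es)
      outside~ = Pointwise.filter⁺ _ _ (λ r ¬p p → ¬p (inside-~ (~.sym r) p))
                                       (λ r ¬p p → ¬p (inside-~ r p)) ds~
      balanced : ∀ v → v ∈ U → (net (is v) dsC ⊕ net (is v) outside) ⊕ σ (is v) st ≡ chg (is v) β
      balanced v v∈ with C v in Cv
      ... | false = begin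
        (net (is v) dsC ⊕ net (is v) outside) ⊕ σ (is v) st
          ≡⟨ cong₂ (λ a b → (a ⊕ b) ⊕ σ (is v) st) (avoids pw (All.all-filter (inside? C) es)) outer ⟩
        net (is v) ds ⊕ σ (is v) st
          ≡⟨ bal v∈ Cv ⟩
        chg (is v) β ∎
        where
        open ≡-Reasoning
        off : ∀ u w → C u ∧ C w ≡ true → fl (is v) (u , w) ≡ 0₃
        off u w ins with C u in Cu | C w in Cw
        ... | true | true = cong₂ (λ a b → ι a ⊕ ⊝ ι b)
          (is-≢ {x = v} {y = u} λ { refl → separated C Cu Cv refl }) (is-≢ {x = v} {y = w} λ { refl → separated C Cw Cv refl })
        avoids : ∀ {ds es} → Pointwise _~_ ds es → All (λ e → C (proj₁ e) ∧ C (proj₂ e) ≡ true) es →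
                 net (is v) ds ≡ 0₃
        avoids [] [] = refl
        avoids {(u , w) ∷ _} (r ∷ pw) (ins ∷ all) = cong₂ _⊕_ (off u w (inside-~ (~.sym r) ins)) (avoids pw all)
        outer : net (is v) outside ≡ net (is v) ds
        outer = trans (ℤ₃∑.∑-filter (fl (is v)) _ ds) (ℤ₃∑.∑-cong edgewise ds)
          where
          edgewise : ∀ d → (if not (does (inside? C d)) then fl (is v) d else 0₃) ≡ fl (is v) d
          edgewise (u , w) with C u ∧ C w in ins
          ... | true  = sym (off u w ins)
          ... | false = refl
      ... | true = begin
        (net (is v) dsC ⊕ net (is v) outside) ⊕ σ (is v) st
          ≡⟨ ⊕-assoc (net (is v) dsC) _ _ ⟩
        net (is v) dsC ⊕ (net (is v) outside ⊕ σ (is v) st)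
          ≡⟨ cong (net (is v) dsC ⊕_) (⊕-comm (net (is v) outside) _) ⟩
        net (is v) dsC ⊕ (σ (is v) st ⊕ net (is v) outside)
          ≡⟨ cong (λ a → net (is v) dsC ⊕ (σ (is v) st ⊕ a)) outer ⟩
        net (is v) dsC ⊕ (σ (is v) st ⊕ ℤ₃∑.∑ (σ (is v) ∘ stubsOf C) ds)
          ≡⟨ cong (λ a → net (is v) dsC ⊕ (a ⊕ ℤ₃∑.∑ (σ (is v) ∘ stubsOf C) ds)) (σ-cong (is-∩ {C = C} Cv) st) ⟨
        net (is v) dsC ⊕ (σ (is v ∩ C) st ⊕ ℤ₃∑.∑ (σ (is v) ∘ stubsOf C) ds)
          ≡⟨ cong (net (is v) dsC ⊕_) (σ-st′ (is v)) ⟨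
        net (is v) dsC ⊕ σ (is v) st′
          ≡⟨ balIn (∈-filter⁺ (member? C) v∈ Cv) ⟩
        chg (is v) (β ∣ᵦ C)
          ≡⟨ chg-restrict (is v) ⟩
        chg (is v ∩ C) β
          ≡⟨ chg-cong (is-∩ {C = C} Cv) β ⟩
        chg (is v) β ∎
        where
        open ≡-Reasoning
        outer : net (is v) outside ≡ ℤ₃∑.∑ (σ (is v) ∘ stubsOf C) ds
        outer = trans (ℤ₃∑.∑-filter (fl (is v)) _ ds) (ℤ₃∑.∑-cong edgewise ds)
          where
          edgewise : ∀ d → (if not (does (inside? C d)) then fl (is v) d else 0₃) ≡ σ (is v) (stubsOf C d)
          edgewise (u , w) with C u in Cu | C w in Cw
          ... | true  | true  = refl
          ... | true  | false rewrite is-≢ {x = v} {w} (separated C Cv Cw) with is v u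
          ...   | true  = refl
          ...   | false = refl
          edgewise (u , w) | false | true rewrite is-≢ {x = v} {u} (separated C Cv Cu) with is v w
          ...   | true  = refl
          ...   | false = refl
          edgewise (u , w) | false | false
            rewrite is-≢ {x = v} {u} (separated C Cv Cu) | is-≢ {x = v} {w} (separated C Cv Cw) = refl

-- Complements, removal of a vertex, and parallel pairs

module _ {n : ℕ} where

  infixr 6 _∪_

  _∪_ : VSet n → VSet n → VSet n
  (A ∪ B) v = A v ∨ B v

  ∁ : VSet n → VSet n
  ∁ A v = not (A v)

  Disjoint : VSet n → VSet n → Set
  Disjoint A B = ∀ v → A v ∧ B v ≡ false

  ∁-disjoint : ∀ A → Disjoint A (∁ A)
  ∁-disjoint A v = Bool.∧-inverseʳ (A v)

  A∪∁A≗full : ∀ A → A ∪ ∁ A ≗ full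
  A∪∁A≗full A v = Bool.∨-inverseʳ (A v)

  is-disjoint : ∀ {x y} → x ≢ y → Disjoint (is x) (is y)
  is-disjoint {x} {y} x≢y v with x ≟ v
  ... | yes refl = is-≢ (λ y≡x → x≢y (sym y≡x))
  ... | no  _    = refl

  net-∪ : ∀ A B → Disjoint A B → ∀ es → net (A ∪ B) es ≡ net A es ⊕ net B es
  net-∪ A B dis es = trans
    (ℤ₃∑.∑-cong (λ (u , v) → edgewise (A u) (B u) (A v) (B v) (dis u) (dis v)) es)
    (ℤ₃∑.∑-∙ (fl A) (fl B) es)
    where
    edgewise : ∀ a b c d → a ∧ b ≡ false → c ∧ d ≡ false →
      ι (a ∨ b) ⊕ ⊝ ι (c ∨ d) ≡ (ι a ⊕ ⊝ ι c) ⊕ (ι b ⊕ ⊝ ι d)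
    edgewise true  false true  false _ _ = refl
    edgewise true  false false true  _ _ = refl
    edgewise true  false false false _ _ = refl
    edgewise false true  true  false _ _ = refl
    edgewise false true  false true  _ _ = refl
    edgewise false true  false false _ _ = refl
    edgewise false false true  false _ _ = refl
    edgewise false false false true  _ _ = refl
    edgewise false false false false _ _ = refl

  masked-∪ : ∀ a b (z : ℤ₃) → a ∧ b ≡ false →
    (if a ∨ b then z else 0₃) ≡ (if a then z else 0₃) ⊕ (if b then z else 0₃)
  masked-∪ true  false z _ = sym (⊕-identityʳ z)
  masked-∪ false true  z _ = refl
  masked-∪ false false z _ = refl

  σ-∪ : ∀ A B → Disjoint A B → ∀ st → σ (A ∪ B) st ≡ σ A st ⊕ σ B st
  σ-∪ A B dis st = trans (ℤ₃∑.∑-cong (λ (v , s) → masked-∪ (A v) (B v) (sgn s) (dis v)) st)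
                             (ℤ₃∑.∑-∙ (sg A) (sg B) st)

  chg-∪ : ∀ A B → Disjoint A B → ∀ β → chg (A ∪ B) β ≡ chg A β ⊕ chg B β
  chg-∪ A B dis β = trans (ℤ₃∑.∑-cong (λ (v , c) → masked-∪ (A v) (B v) c (dis v)) β)
                              (ℤ₃∑.∑-∙ (ch A) (ch B) β)

  net-full : ∀ (es : List (Edge n)) → net full es ≡ 0₃
  net-full es = ℤ₃∑.∑-ε es

  cut-full : ∀ (es : List (Edge n)) → cut full es ≡ 0
  cut-full es = ℕ∑.∑-ε es

  cut-∁ : ∀ A es → cut (∁ A) es ≡ cut A es
  cut-∁ A = ℕ∑.∑-cong λ (u , v) → flipped (A u) (A v)
    where
    flipped : ∀ a b → ⟦ not a xor not b ⟧ ≡ ⟦ a xor b ⟧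
    flipped true  true  = refl
    flipped true  false = refl
    flipped false true  = refl
    flipped false false = refl

  stubs-∁ : ∀ A st → stubs A st + stubs (∁ A) st ≡ stubs full st
  stubs-∁ A st = trans (sym (ℕ∑.∑-∙ (cnt A) (cnt (∁ A)) st))
                       (ℕ∑.∑-cong (λ (v , _) → one (A v)) st)
    where
    one : ∀ a → ⟦ a ⟧ + ⟦ not a ⟧ ≡ 1
    one true  = refl
    one false = refl

  net-∁ : ∀ A es → net A es ⊕ net (∁ A) es ≡ 0₃
  net-∁ A es = trans (sym (net-∪ A (∁ A) (∁-disjoint A) es)) (trans (net-cong (A∪∁A≗full A) es) (net-full es))

  σ-∁ : ∀ A st → σ A st ⊕ σ (∁ A) st ≡ σ full st
  σ-∁ A st = trans (sym (σ-∪ A (∁ A) (∁-disjoint A) st)) (σ-cong (A∪∁A≗full A) st)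

  chg-∁ : ∀ A β → chg A β ⊕ chg (∁ A) β ≡ chg full β
  chg-∁ A β = trans (sym (chg-∪ A (∁ A) (∁-disjoint A) β)) (chg-cong (A∪∁A≗full A) β)

  balance-rest : ∀ {m m′ s s′ b b′} → m ⊕ s ≡ b → (m ⊕ m′) ⊕ (s ⊕ s′) ≡ b ⊕ b′ → m′ ⊕ s′ ≡ b′
  balance-rest {m} {m′} {s} {s′} {b} {b′} eq eqs = ⊕-cancelʳ (m′ ⊕ s′) b′ b (begin
    (m′ ⊕ s′) ⊕ b          ≡⟨ ⊕-comm (m′ ⊕ s′) b ⟩
    b ⊕ (m′ ⊕ s′)          ≡⟨ cong (_⊕ (m′ ⊕ s′)) eq ⟨
    (m ⊕ s) ⊕ (m′ ⊕ s′)    ≡⟨ ℤ₃∑.interchange m s m′ s′ ⟩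
    (m ⊕ m′) ⊕ (s ⊕ s′)    ≡⟨ eqs ⟩
    b ⊕ b′                 ≡⟨ ⊕-comm b b′ ⟩
    b′ ⊕ b                 ∎)
    where open ≡-Reasoning

  -- Removing `x` is the restriction to its complement: total neutrality turns balance at `x` into
  -- balance of all the rest.
  removalSol : ∀ {x U es st β} (ds : List (Edge n)) → Pointwise _~_ ds es →
    σ full st ≡ chg full β → net (is x) ds ⊕ σ (is x) st ≡ chg (is x) β →
    QuotientSol (∁ (is x)) U es st β
  removalSol {x} {U} {es} {st} {β} ds pw neutral balx = mkQuotientSol ds pw
    (λ {v} _ ∁v → subst (λ v → net (is v) ds ⊕ σ (is v) st ≡ chg (is v) β)
                        (is⇒≡ {x = x} {v} (Bool.not-injective ∁v)) balx)
    (balance-rest {net (is x) ds} {s = σ (is x) st} balx (begin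
      (net (is x) ds ⊕ net (∁ (is x)) ds) ⊕ (σ (is x) st ⊕ σ (∁ (is x)) st)
        ≡⟨ cong₂ _⊕_ (net-∁ (is x) ds) (σ-∁ (is x) st) ⟩
      σ full st
        ≡⟨ neutral ⟩
      chg full β
        ≡⟨ chg-∁ (is x) β ⟨
      chg (is x) β ⊕ chg (∁ (is x)) β ∎))
    where open ≡-Reasoning

  -- Two free edges at a vertex realise every residue: ±1 ±1 takes the values 2, 0, −2.
  two-free-edges : ∀ r → ∃₂ λ s t → sgn s ⊕ sgn t ≡ r
  two-free-edges 0₃ = true  , false , refl
  two-free-edges 1₃ = false , false , refl
  two-free-edges 2₃ = true  , true  , refl

  arcOf : Bool → Edge n → Edge n
  arcOf true  e = e
  arcOf false e = flip e

  arcOf-~ : ∀ s e → arcOf s e ~ e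
  arcOf-~ true  e = inj₁ refl
  arcOf-~ false e = inj₂ refl

  fl-arcOf : ∀ s {x y} → x ≢ y → fl (is x) (arcOf s (x , y)) ≡ sgn s
  fl-arcOf true  {x} x≢y rewrite is-refl x | is-≢ x≢y = refl
  fl-arcOf false {x} x≢y rewrite is-refl x | is-≢ x≢y = refl

  -- Two edges at `x` correct whatever net outflow the other edges happen to have in their listed
  -- direction.
  orient-at : ∀ {x y z es fs} → x ≢ y → x ≢ z → es ≈ (x , y) ∷ (x , z) ∷ fs →
    ∀ r → ∃ λ ds → Pointwise _~_ ds es × net (is x) ds ≡ r
  orient-at {x} {y} {z} {es} {fs} x≢y x≢z p r =
    let s , t , eq    = two-free-edges (r ⊕ ⊝ net (is x) fs)
        ds , pw , eq′ = reorient (arcOf-~ s (x , y) ∷ arcOf-~ t (x , z) ∷ Pointwise.refl ~.refl) (≈.sym p) in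
    ds , pw , trans (eq′ (is x)) (begin
      fl (is x) (arcOf s (x , y)) ⊕ (fl (is x) (arcOf t (x , z)) ⊕ net (is x) fs)
        ≡⟨ cong₂ (λ a b → a ⊕ (b ⊕ net (is x) fs)) (fl-arcOf s x≢y) (fl-arcOf t x≢z) ⟩
      sgn s ⊕ (sgn t ⊕ net (is x) fs)
        ≡⟨ ⊕-assoc (sgn s) (sgn t) _ ⟨
      (sgn s ⊕ sgn t) ⊕ net (is x) fs
        ≡⟨ cong (_⊕ net (is x) fs) eq ⟩
      (r ⊕ ⊝ net (is x) fs) ⊕ net (is x) fs
        ≡⟨ ⊕-⊝-cancel r _ ⟩
      r ∎)
    where
    open ≡-Reasoning

  pair : Fin n → Fin n → VSet n
  pair x y = is x ∪ is y

  pair-left : ∀ x y → pair x y x ≡ true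
  pair-left x y = cong (_∨ is y x) (is-refl x)

  pair-right : ∀ x y → pair x y y ≡ true
  pair-right x y = trans (cong (is x y ∨_) (is-refl y)) (Bool.∨-zeroʳ _)

  -- A doubled edge is itself solvable for every charge: its two arcs are chosen to balance `x`, and
  -- `y` follows from the balance of the contracted pair.
  pairSol : ∀ {x y U es st β} → x ≢ y → QuotientSol (pair x y) U es st β →
            Sol U ((x , y) ∷ (x , y) ∷ es) st β
  pairSol {x} {y} {U} {es} {st} {β} x≢y (mkQuotientSol ds pw bal balC) =
    let s , t , eq = two-free-edges ((chg (is x) β ⊕ ⊝ σ (is x) st) ⊕ ⊝ net (is x) ds)
        ds′ = arcOf s (x , y) ∷ arcOf t (x , y) ∷ ds in
    mkSol ds′ (arcOf-~ s _ ∷ arcOf-~ t _ ∷ pw) (balanced s t eq)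
    where
    open ≡-Reasoning
    module _ (s t : Bool) (eq : sgn s ⊕ sgn t ≡ (chg (is x) β ⊕ ⊝ σ (is x) st) ⊕ ⊝ net (is x) ds) where
      ds′ : List (Edge n)
      ds′ = arcOf s (x , y) ∷ arcOf t (x , y) ∷ ds
      at-x : net (is x) ds′ ⊕ σ (is x) st ≡ chg (is x) β
      at-x = begin
        (fl (is x) (arcOf s (x , y)) ⊕ (fl (is x) (arcOf t (x , y)) ⊕ net (is x) ds)) ⊕ σ (is x) st
          ≡⟨ cong₂ (λ a b → (a ⊕ (b ⊕ net (is x) ds)) ⊕ σ (is x) st) (fl-arcOf s x≢y) (fl-arcOf t x≢y) ⟩
        (sgn s ⊕ (sgn t ⊕ net (is x) ds)) ⊕ σ (is x) st
          ≡⟨ cong (_⊕ σ (is x) st) (⊕-assoc (sgn s) (sgn t) _) ⟨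
        ((sgn s ⊕ sgn t) ⊕ net (is x) ds) ⊕ σ (is x) st
          ≡⟨ cong (λ a → (a ⊕ net (is x) ds) ⊕ σ (is x) st) eq ⟩
        (((chg (is x) β ⊕ ⊝ σ (is x) st) ⊕ ⊝ net (is x) ds) ⊕ net (is x) ds) ⊕ σ (is x) st
          ≡⟨ cong (_⊕ σ (is x) st) (⊕-⊝-cancel _ (net (is x) ds)) ⟩
        (chg (is x) β ⊕ ⊝ σ (is x) st) ⊕ σ (is x) st
          ≡⟨ ⊕-⊝-cancel (chg (is x) β) _ ⟩
        chg (is x) β ∎
      on-pair : ∀ r → fl (pair x y) (arcOf r (x , y)) ≡ 0₃
      on-pair true  = cong₂ (λ a b → ι a ⊕ ⊝ ι b) (pair-left x y) (pair-right x y)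
      on-pair false = cong₂ (λ a b → ι a ⊕ ⊝ ι b) (pair-right x y) (pair-left x y)
      at-y : net (is y) ds′ ⊕ σ (is y) st ≡ chg (is y) β
      at-y = balance-rest {net (is x) ds′} {s = σ (is x) st} at-x (begin
        (net (is x) ds′ ⊕ net (is y) ds′) ⊕ (σ (is x) st ⊕ σ (is y) st)
          ≡⟨ cong₂ _⊕_ (net-∪ (is x) (is y) (is-disjoint x≢y) ds′) (σ-∪ (is x) (is y) (is-disjoint x≢y) st) ⟨
        net (pair x y) ds′ ⊕ σ (pair x y) st
          ≡⟨ cong (_⊕ σ (pair x y) st)
               (cong₂ (λ a b → a ⊕ (b ⊕ net (pair x y) ds)) (on-pair s) (on-pair t)) ⟩
        net (pair x y) ds ⊕ σ (pair x y) st
          ≡⟨ balC ⟩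
        chg (pair x y) β
          ≡⟨ chg-∪ (is x) (is y) (is-disjoint x≢y) β ⟩
        chg (is x) β ⊕ chg (is y) β ∎)
      elsewhere : ∀ {v} → v ≢ x → v ≢ y → ∀ r → fl (is v) (arcOf r (x , y)) ≡ 0₃
      elsewhere v≢x v≢y true  = cong₂ (λ a b → ι a ⊕ ⊝ ι b) (is-≢ v≢x) (is-≢ v≢y)
      elsewhere v≢x v≢y false = cong₂ (λ a b → ι a ⊕ ⊝ ι b) (is-≢ v≢y) (is-≢ v≢x)
      balanced : ∀ {v} → v ∈ U → net (is v) ds′ ⊕ σ (is v) st ≡ chg (is v) β
      balanced {v} v∈ with v ≟ x | v ≟ y
      ... | yes refl | _        = at-x
      ... | no _     | yes refl = at-y
      ... | no v≢x   | no v≢y   = trans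
        (cong₂ (λ a b → (a ⊕ (b ⊕ net (is v) ds)) ⊕ σ (is v) st)
               (elsewhere v≢x v≢y s) (elsewhere v≢x v≢y t))
        (bal v∈ (cong₂ _∨_ (is-≢ {x = x} {v} (λ eq → v≢x (sym eq))) (is-≢ {x = y} {v} (λ eq → v≢y (sym eq)))))

-- The theorem of Lovász, Thomassen, Wu and Zhang

pattern 6+_ n = suc (suc (suc (suc (suc (suc n)))))
pattern 8+_ n = suc (suc (6+ n))

-- For |τ| ≤ 3 with τ ≡ β mod 3 and τ ≡ d mod 2, these are d ≥ 4 + |τ| and
-- d ≤ 4 + |τ|.
Good Cap : ℕ → ℤ₃ → Set
Good 4 β = β ≡ 0₃
Good 5 β = β ≢ 0₃
Good (6+ _) β = ⊤
Good _ β = ⊥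
Cap 6 β = β ≢ 0₃
Cap 7 β = β ≡ 0₃
Cap (8+ _) β = ⊥
Cap _ β = ⊤

≢-stable : ∀ {a : ℤ₃} → ¬ a ≢ 0₃ → a ≡ 0₃
≢-stable {a} = decidable-stable (a ≟ 0₃)

-- Above the cap d ≥ 6 + |τ| by parity, while directing an edge lowers d by one and raises |τ| by at
-- most one.
good-push : ∀ d s {β} → ¬ Cap (suc d) β → Good d (sgn s ⊕ β)
good-push 0 s ¬cap = ¬cap tt
good-push 1 s ¬cap = ¬cap tt
good-push 2 s ¬cap = ¬cap tt
good-push 3 s ¬cap = ¬cap tt
good-push 4 s ¬cap = contradiction tt ¬cap
good-push 5 s ¬cap with refl ← ≢-stable ¬cap | s
... | true  = λ ()
... | false = λ ()
good-push (6+ d) s ¬cap = tt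

-- The slack of two above the cap pays for two lost edges, the charge being unchanged.
good-lift : ∀ d {β} → ¬ Cap (suc (suc d)) β → Good d β
good-lift 0 ¬cap = ¬cap tt
good-lift 1 ¬cap = ¬cap tt
good-lift 2 ¬cap = ¬cap tt
good-lift 3 ¬cap = ¬cap tt
good-lift 4 ¬cap = ≢-stable ¬cap
good-lift 5 ¬cap = ¬cap
good-lift (6+ d) ¬cap = tt

noncap⇒≥6 : ∀ d {b} → ¬ Cap d b → 6 ≤ d
noncap⇒≥6 0 ¬cap = contradiction tt ¬cap
noncap⇒≥6 1 ¬cap = contradiction tt ¬cap
noncap⇒≥6 2 ¬cap = contradiction tt ¬cap
noncap⇒≥6 3 ¬cap = contradiction tt ¬cap
noncap⇒≥6 4 ¬cap = contradiction tt ¬cap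
noncap⇒≥6 5 ¬cap = contradiction tt ¬cap
noncap⇒≥6 (6+ d) ¬cap = m≤m+n 6 d

≥6⇒good : ∀ {d b} → 6 ≤ d → Good d b
≥6⇒good (s≤s (s≤s (s≤s (s≤s (s≤s (s≤s _)))))) = tt

-- Dropping a stub lowers d by one, and |τ| falls by at most one.
cap-pred : ∀ d s {β} → Cap (suc d) β → Cap d (sgn s ⊕ β)
cap-pred 0 s cap = tt
cap-pred 1 s cap = tt
cap-pred 2 s cap = tt
cap-pred 3 s cap = tt
cap-pred 4 s cap = tt
cap-pred 5 s cap = tt
cap-pred 6 s refl with s
... | true  = λ ()
... | false = λ ()
cap-pred (suc (6+ d)) s ()

-- `Cap` depends on |τ| only, so it passes from one side of a cut to the other when the charges add
-- up to zero.
cap-neg : ∀ d {β γ} → β ⊕ γ ≡ 0₃ → Cap d β → Cap d γ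
cap-neg 0 eq cap = tt
cap-neg 1 eq cap = tt
cap-neg 2 eq cap = tt
cap-neg 3 eq cap = tt
cap-neg 4 eq cap = tt
cap-neg 5 eq cap = tt
cap-neg 6 {0₃} eq cap = contradiction refl cap
cap-neg 6 {1₃} {2₃} eq cap = λ ()
cap-neg 6 {2₃} {1₃} eq cap = λ ()
cap-neg 7 eq refl = eq
cap-neg (8+ d) eq ()

cap⇒<8 : ∀ d {β} → Cap d β → d < 8
cap⇒<8 0 cap = m≤m+n 1 7
cap⇒<8 1 cap = m≤m+n 2 6
cap⇒<8 2 cap = m≤m+n 3 5
cap⇒<8 3 cap = m≤m+n 4 4
cap⇒<8 4 cap = m≤m+n 5 3
cap⇒<8 5 cap = m≤m+n 6 2
cap⇒<8 6 cap = m≤m+n 7 1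
cap⇒<8 7 cap = ≤-refl
cap⇒<8 (8+ d) ()

good⇒≥4 : ∀ d {β} → Good d β → 4 ≤ d
good⇒≥4 4 good = ≤-refl
good⇒≥4 5 good = n≤1+n 4
good⇒≥4 (6+ d) good = m≤m+n 4 _

module _ {n : ℕ} where

  -- The sets `A` are the sides of cuts that avoid z₀. Each must miss some vertex of `U`, which
  -- exempts the cut around z₀; that cut obeys the opposite inequality `cap`. The field `neutral` is
  -- the balance at z₀.
  record Inv (U : List (Fin n)) (es : List (Edge n)) (st : List (Stub n))
             (β : List (Charge n)) : Set where
    field
      located : Located U es st β
      good    : ∀ A {u v} → u ∈ U → A u ≡ true → v ∈ U → A v ≡ false →
                Good (deg es st A) (chg A β)
      cap     : Cap (stubs full st) (chg full β)
      neutral : σ full st ≡ chg full β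

  cut-agree : ∀ {U es} {A B : VSet n} → EndsIn U es →
              (∀ {v} → v ∈ U → A v ≡ B v) → cut A es ≡ cut B es
  cut-agree e∈ agree =
    ℕ∑.∑-cong-All (All.map (λ (u∈ , v∈) → cong₂ (λ a b → ⟦ a xor b ⟧) (agree u∈) (agree v∈)) e∈)

  module _ {U : List (Fin n)} {es : List (Edge n)} {st : List (Stub n)} {β : List (Charge n)}
           (loc : Located U es st β)
           {A B : VSet n} (agree : ∀ {v : Fin n} → v ∈ U → A v ≡ B v) where

    deg-agree : deg es st A ≡ deg es st B
    deg-agree = let e∈ , s∈ , _ = loc in
      cong₂ _+_ (cut-agree e∈ agree) (ℕ∑.∑-cong-All (All.map (λ v∈ → cong ⟦_⟧ (agree v∈)) s∈))

    chg-agree : chg A β ≡ chg B β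
    chg-agree = let _ , _ , b∈ = loc in
      ℤ₃∑.∑-cong-All (All.map (λ {c} v∈ → cong (if_then proj₂ c else 0₃) (agree v∈)) b∈)

  deg-≈ : ∀ {es es′ : List (Edge n)} {st st′} → es ≈ es′ → st ↭ st′ → ∀ A → deg es st A ≡ deg es′ st′ A
  deg-≈ p q A = cong₂ _+_ (cut-≈ A p) (stubs-↭ A q)

  All-≈ : ∀ {U : List (Fin n)} {es es′} → es ≈ es′ →
          EndsIn U es → EndsIn U es′
  All-≈ = ≈-Properties.All-resp-↭ λ { (inj₁ refl) e∈ → e∈ ; (inj₂ refl) (u∈ , v∈) → v∈ , u∈ }

  All-↭ : ∀ {P : Stub n → Set} {st st′} → st ↭ st′ → All P st → All P st′
  All-↭ = PermSetoid.All-resp-↭ (setoid _) (λ { refl p → p })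

  Inv-≈ : ∀ {U es es′ st st′ β} → es ≈ es′ → st ↭ st′ → Inv U es st β → Inv U es′ st′ β
  Inv-≈ {β = β} p q inv = record
    { located = let e∈ , s∈ , b∈ = located in All-≈ p e∈ , All-↭ q s∈ , b∈
    ; good    = λ A u∈ Au v∈ Av → subst (λ d → Good d (chg A β)) (deg-≈ p q A) (good A u∈ Au v∈ Av)
    ; cap     = subst (λ d → Cap d _) (stubs-↭ full q) cap
    ; neutral = trans (sym (σ-↭ full q)) neutral
    } where open Inv inv

  -- An edge weighs two so that exchanging an edge for one extra stub, as in `reverseStub`, is still
  -- progress.
  measure : List (Fin n) → List (Edge n) → List (Stub n) → ℕ
  measure U es st = length U + ((length es + length es) + length st)

  Rec : ℕ → Set
  Rec m = ∀ {U es st β} → measure U es st < m → Inv U es st β → ¬ ¬ Sol U es st β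

  ∈-restrict⁻ : ∀ C {U} {v : Fin n} → v ∈ U ∣ᵥ C → v ∈ U × C v ≡ true
  ∈-restrict⁻ C {U} = ∈-filter⁻ (member? C) {xs = U}

  -- The complement of `C` is shrunk into the new z₀, so its degree is that of `C`: the criticality
  -- of `C` is precisely the cap demanded at z₀.
  restrict-Inv : ∀ {C U es st β} (q : QuotientSol C U es st β) → Located U es st β →
    (∀ A {u v} → u ∈ U → C u ≡ true → A u ≡ true → v ∈ U → C v ≡ true → A v ≡ false →
       Good (deg es st (A ∩ C)) (chg (A ∩ C) β)) →
    Cap (deg es st C) (chg C β) →
    Inv (U ∣ᵥ C) (es ∣ₑ C) (Restrict.st′ q) (β ∣ᵦ C)
  restrict-Inv {C} {U} {es} {st} {β} q loc good cap = record
    { located = R.located loc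
    ; good    = λ A u∈ Au v∈ Av →
        let u∈U , Cu = ∈-restrict⁻ C {U} u∈
            v∈U , Cv = ∈-restrict⁻ C {U} v∈ in
        subst₂ Good (sym (R.deg-restrict A)) (sym (R.chg-restrict A)) (good A u∈U Cu Au v∈U Cv Av)
    ; cap     = subst₂ Cap
        (trans (sym (R.deg-restrict full)) (cong (_+ stubs full R.st′) (cut-full (es ∣ₑ C))))
        (sym (R.chg-restrict full)) cap
    ; neutral = R.charge-zero
    } where module R = Restrict q

  length-stubsOf : ∀ C {ds es : List (Edge n)} → Pointwise _~_ ds es →
    length (es ∣ₑ C) + length (concatMap (stubsOf C) ds) ≤ length es
  length-stubsOf C [] = z≤n
  length-stubsOf C {(u , v) ∷ ds} {_ ∷ es} (inj₁ refl ∷ pw) with C u | C v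
  ... | true  | true  = s≤s (length-stubsOf C pw)
  ... | true  | false = ≤-trans (≤-reflexive (+-suc _ _)) (s≤s (length-stubsOf C pw))
  ... | false | true  = ≤-trans (≤-reflexive (+-suc _ _)) (s≤s (length-stubsOf C pw))
  ... | false | false = ≤-trans (length-stubsOf C pw) (n≤1+n _)
  length-stubsOf C {(u , v) ∷ ds} {_ ∷ es} (inj₂ refl ∷ pw) with C u | C v
  ... | true  | true  = s≤s (length-stubsOf C pw)
  ... | true  | false = ≤-trans (≤-reflexive (+-suc _ _)) (s≤s (length-stubsOf C pw))
  ... | false | true  = ≤-trans (≤-reflexive (+-suc _ _)) (s≤s (length-stubsOf C pw))
  ... | false | false = ≤-trans (length-stubsOf C pw) (n≤1+n _)

  length-∣ᵥ : ∀ C {U} {w : Fin n} → w ∈ U → C w ≡ false → length (U ∣ᵥ C) < length U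
  length-∣ᵥ C {U} w∈ Cw = filter-notAll (member? C) U
    (Any.map (λ { refl Cw′ → separated C Cw′ Cw refl }) w∈)

  measure-restrict : ∀ {C U es st β w} (q : QuotientSol C U es st β) → w ∈ U → C w ≡ false →
    measure (U ∣ᵥ C) (es ∣ₑ C) (Restrict.st′ q) < measure U es st
  measure-restrict {C} {U} {es} {st} q w∈ Cw = +-mono-≤ (length-∣ᵥ C w∈ Cw) (begin
    (l + l) + length (st ∣ₛ C ++ cm)         ≡⟨ cong ((l + l) +_) (length-++ (st ∣ₛ C)) ⟩
    (l + l) + (length (st ∣ₛ C) + length cm) ≡⟨ cong ((l + l) +_) (+-comm (length (st ∣ₛ C)) _) ⟩
    (l + l) + (length cm + length (st ∣ₛ C)) ≡⟨ +-assoc (l + l) (length cm) _ ⟨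
    ((l + l) + length cm) + length (st ∣ₛ C) ≡⟨ cong (_+ length (st ∣ₛ C)) (+-assoc l l (length cm)) ⟩
    (l + (l + length cm)) + length (st ∣ₛ C)
      ≤⟨ +-mono-≤ (+-mono-≤ (length-filter (inside? C) es) (length-stubsOf C (QuotientSol.ds~ q)))
                  (length-filter (member? C ∘ proj₁) st) ⟩
    (length es + length es) + length st ∎)
    where
    open ≤-Reasoning
    l = length (es ∣ₑ C)
    cm = concatMap (stubsOf C) (QuotientSol.ds q)

  module _ (C : VSet n) (a : Fin n) (Ca : C a ≡ true) where

    private ρ = contract C a Ca

    contract-deg : ∀ A es st →
      deg (map (contractₑ C a Ca) es) (map (contractₛ C a Ca) st) A ≡ deg es st (A ∘ ρ)
    contract-deg A es st = cong₂ _+_ (ℕ∑.∑-map (cr A) _ es) (ℕ∑.∑-map (cnt A) _ st)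

    contract-chg : ∀ A β → chg A (map (contractᵦ C a Ca) β) ≡ chg (A ∘ ρ) β
    contract-chg A = ℤ₃∑.∑-map (ch A) _

    -- The sets of the contracted graph correspond to original sets that do not split `C`, and z₀ is
    -- untouched.
    contract-Inv : ∀ {U es st β} → a ∈ U → Inv U es st β →
      Inv (remaining C a Ca U) (map (contractₑ C a Ca) es)
          (map (contractₛ C a Ca) st) (map (contractᵦ C a Ca) β)
    contract-Inv {U} {es} {st} {β} a∈ inv = record
      { located = contract-Located C a Ca a∈ located
      ; good    = λ A u∈ Au v∈ Av → subst₂ Good (sym (contract-deg A es st)) (sym (contract-chg A β))
          (good (A ∘ ρ) (proj₁ (remaining⁻ C a Ca {U} u∈)) (remaining-fixed C a Ca A {U} u∈ Au)
                        (proj₁ (remaining⁻ C a Ca {U} v∈)) (remaining-fixed C a Ca A {U} v∈ Av))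
      ; cap     = subst₂ Cap (sym (ℕ∑.∑-map (cnt full) _ st)) (sym (contract-chg full β)) cap
      ; neutral = trans (ℤ₃∑.∑-map (sg full) _ st) (trans neutral (sym (contract-chg full β)))
      } where open Inv inv

    measure-contract : ∀ {U es st b} → b ∈ U → C b ≡ true → b ≢ a →
      measure (remaining C a Ca U) (map (contractₑ C a Ca) es) (map (contractₛ C a Ca) st) <
      measure U es st
    measure-contract {U} {es} {st} b∈ Cb b≢a
      rewrite length-map (contractₑ C a Ca) es | length-map (contractₛ C a Ca) st =
      +-monoˡ-≤ _ (length-remaining C a Ca b∈ Cb b≢a)

-- Lifting edges, directing edges, and exchanging stubs

module _ {n : ℕ} where

  NonCritical : List (Fin n) → List (Edge n) → List (Stub n) → List (Charge n) → Set
  NonCritical U es st β = ∀ A {u v w} → u ∈ U → v ∈ U → u ≢ v → A u ≡ true → A v ≡ true →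
    w ∈ U → A w ≡ false → ¬ Cap (deg es st A) (chg A β)

  NonCritical-≈ : ∀ {U es es′ st st′ β} → es ≈ es′ → st ↭ st′ →
                  NonCritical U es st β → NonCritical U es′ st′ β
  NonCritical-≈ {β = β} p q nc A u∈ v∈ u≢v Au Av w∈ Aw =
    subst (λ d → ¬ Cap d (chg A β)) (deg-≈ p q A) (nc A u∈ v∈ u≢v Au Av w∈ Aw)

  -- Directing an edge at x out of x (s = true) or into x (s = false) keeps x good.
  Pushable : List (Edge n) → List (Stub n) → List (Charge n) → Bool → VSet n → Set
  Pushable es st β s A = ∀ d → deg es st A ≡ suc d → Good d (sgn (not s) ⊕ chg A β)

  Pushable-≈ : ∀ {es es′ st st′ β s A} → es ≈ es′ → st ↭ st′ → Pushable es st β s A →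
               Pushable es′ st′ β s A
  Pushable-≈ {A = A} p q pushable d eq = pushable d (trans (deg-≈ p q A) eq)

  second-or-single : ∀ (A : VSet n) (U : List (Fin n)) {x} → A x ≡ true →
    (∃ λ u → u ∈ U × x ≢ u × A u ≡ true) ⊎ (∀ {u} → u ∈ U → A u ≡ is x u)
  second-or-single A U {x} Ax with All.all? (λ u → A u Bool.≟ is x u) U
  ... | yes agree = inj₂ (All.lookup agree)
  ... | no ¬agree with find (All.¬All⇒Any¬ (λ u → A u Bool.≟ is x u) U ¬agree)
  ... | u , u∈ , Au≢ with x ≟ u
  ...   | yes refl = contradiction Ax Au≢
  ...   | no x≢u   = inj₁ (u , u∈ , x≢u , Bool.¬-not Au≢)

  module Step {U : List (Fin n)} {es : List (Edge n)} {st : List (Stub n)} {β : List (Charge n)}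
              (inv : Inv U es st β) (nc : NonCritical U es st β) where
    open Inv inv public

    -- This reduces conditions on all sets through `x` to the condition at `x`: a set with a second
    -- vertex has slack two, and any other agrees on `U` with the singleton.
    noncritical-or-single : ∀ A {x w} → x ∈ U → A x ≡ true → w ∈ U → A w ≡ false →
      ¬ Cap (deg es st A) (chg A β) ⊎
      (deg es st A ≡ deg es st (is x) × chg A β ≡ chg (is x) β)
    noncritical-or-single A x∈ Ax w∈ Aw with second-or-single A U Ax
    ... | inj₁ (u , u∈ , x≢u , Au) = inj₁ (nc A x∈ u∈ x≢u Ax Au w∈ Aw)
    ... | inj₂ agree               = inj₂ (deg-agree located agree , chg-agree located agree)

    push-set : ∀ s A {x w} → x ∈ U → A x ≡ true → w ∈ U → A w ≡ false →
      Pushable es st β s (is x) → Pushable es st β s A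
    push-set s A x∈ Ax w∈ Aw pushable d eq with noncritical-or-single A x∈ Ax w∈ Aw
    ... | inj₁ ¬cap        = good-push d (not s) (subst (λ d → ¬ Cap d (chg A β)) eq ¬cap)
    ... | inj₂ (eqd , eqb) =
      subst (λ b → Good d (sgn (not s) ⊕ b)) (sym eqb) (pushable d (trans (sym eqd) eq))

    noncap-set : ∀ A {x w} → x ∈ U → A x ≡ true → w ∈ U → A w ≡ false →
      ¬ Cap (deg es st (is x)) (chg (is x) β) → ¬ Cap (deg es st A) (chg A β)
    noncap-set A x∈ Ax w∈ Aw ¬cap with noncritical-or-single A x∈ Ax w∈ Aw
    ... | inj₁ ¬cap′       = ¬cap′
    ... | inj₂ (eqd , eqb) = subst₂ (λ d b → ¬ Cap d b) (sym eqd) (sym eqb) ¬cap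

  sgn-cancel : ∀ s {a b : ℤ₃} → sgn s ⊕ a ≡ b → a ≡ sgn (not s) ⊕ b
  sgn-cancel true  {a} refl = undo a
    where
    undo : ∀ a → a ≡ 2₃ ⊕ (1₃ ⊕ a)
    undo = from-yes (all? λ a → a ≟ (2₃ ⊕ (1₃ ⊕ a)))
  sgn-cancel false {a} refl = undo a
    where
    undo : ∀ a → a ≡ 1₃ ⊕ (2₃ ⊕ a)
    undo = from-yes (all? λ a → a ≟ (1₃ ⊕ (2₃ ⊕ a)))

  sgn-inverse : ∀ s b → sgn (not s) ⊕ (sgn s ⊕ b) ≡ b
  sgn-inverse s b = sym (sgn-cancel s refl)

  sgn-inverse′ : ∀ s b → sgn s ⊕ (sgn (not s) ⊕ b) ≡ b
  sgn-inverse′ true  b = sgn-inverse false b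
  sgn-inverse′ false b = sgn-inverse true b

  sgn-double : ∀ s b → sgn s ⊕ (sgn s ⊕ b) ≡ sgn (not s) ⊕ b
  sgn-double true  = from-yes (all? λ b → (1₃ ⊕ (1₃ ⊕ b)) ≟ (2₃ ⊕ b))
  sgn-double false = from-yes (all? λ b → (2₃ ⊕ (2₃ ⊕ b)) ≟ (1₃ ⊕ b))

  lift-edges-good : ∀ ax ay aw c s {β} → let d = (⟦ ax xor ay ⟧ + (⟦ ax xor aw ⟧ + c)) + s in
    Good d β → (ax ≡ true → ay ≡ false → aw ≡ false → ¬ Cap d β) →
    (ay ≡ true → aw ≡ true → ax ≡ false → ¬ Cap d β) → Good ((⟦ ay xor aw ⟧ + c) + s) β
  lift-edges-good true  true  true  c s good h₁ h₂ = good
  lift-edges-good true  true  false c s good h₁ h₂ = good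
  lift-edges-good true  false true  c s good h₁ h₂ = good
  lift-edges-good true  false false c s good h₁ h₂ = good-lift (c + s) (h₁ refl refl refl)
  lift-edges-good false true  true  c s good h₁ h₂ = good-lift (c + s) (h₂ refl refl refl)
  lift-edges-good false true  false c s good h₁ h₂ = good
  lift-edges-good false false true  c s good h₁ h₂ = good
  lift-edges-good false false false c s good h₁ h₂ = good

  lift-stub-good : ∀ ax ay c s {β} → let d = (⟦ ax xor ay ⟧ + c) + (⟦ ax ⟧ + s) in
    Good d β → (ax ≡ true → ay ≡ false → ¬ Cap d β) → Good (c + (⟦ ay ⟧ + s)) β
  lift-stub-good true  true  c s good h = good
  lift-stub-good false false c s good h = good
  lift-stub-good false true  c s good h rewrite +-suc c s = good
  lift-stub-good true  false c s {β} good h =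
    good-lift (c + s) (subst (λ d → ¬ Cap (suc d) β) (+-suc c s) (h refl refl))

  push-good : ∀ s ax ay c k {b} → let d = (⟦ ax xor ay ⟧ + c) + k in Good d b →
    (ax ≡ true → ay ≡ false → ∀ e → d ≡ suc e → Good e (sgn (not s) ⊕ b)) →
    (ay ≡ true → ax ≡ false → ∀ e → d ≡ suc e → Good e (sgn (not (not s)) ⊕ b)) →
    Good (c + k) ((if ax then sgn (not s) else 0₃) ⊕ ((if ay then sgn s else 0₃) ⊕ b))
  push-good s true  true  c k {b} good h₁ h₂ = subst (Good (c + k)) (sym (sgn-inverse s b)) good
  push-good s true  false c k good h₁ h₂ = h₁ refl refl _ refl
  push-good s false true  c k {b} good h₁ h₂ =
    subst (λ t → Good (c + k) (sgn t ⊕ b)) (Bool.not-involutive s) (h₂ refl refl _ refl)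
  push-good s false false c k good h₁ h₂ = good

  unstub-good : ∀ s ax c k {b} → let d = c + (⟦ ax ⟧ + k) in Good d b →
    (ax ≡ true → ∀ e → d ≡ suc e → Good e (sgn (not s) ⊕ b)) →
    Good (c + k) ((if ax then sgn (not s) else 0₃) ⊕ b)
  unstub-good s true  c k good h = h refl _ (+-suc c k)
  unstub-good s false c k good h = good

  reverse-good : ∀ s ax ay c k {b} → let d = (⟦ ax xor ay ⟧ + c) + (⟦ ax ⟧ + k) in Good d b →
    (ax ≡ true → ay ≡ true → ¬ Cap d b) →
    (ax ≡ true → ay ≡ false → Good d (sgn s ⊕ b)) →
    (ay ≡ true → ax ≡ false → ∀ e → d ≡ suc e → Good e (sgn (not s) ⊕ b)) →
    Good (c + (⟦ ax ⟧ + (⟦ ax ⟧ + k)))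
         ((if ay then sgn (not s) else 0₃) ⊕ ((if ax then sgn s else 0₃) ⊕ b))
  reverse-good s true  true  c k {b} good h₁ h₂ h₃ =
    subst (λ d → Good d (sgn (not s) ⊕ (sgn s ⊕ b))) (sym (+-suc c (suc k))) (≥6⇒good (≤-trans (noncap⇒≥6 (c + suc k) (h₁ refl refl)) (n≤1+n _)))
  reverse-good s true  false c k {b} good h₁ h₂ h₃ =
    subst (λ d → Good d (sgn s ⊕ b)) (sym (+-suc c (suc k))) (h₂ refl refl)
  reverse-good s false true  c k good h₁ h₂ h₃ = h₃ refl refl _ refl
  reverse-good s false false c k good h₁ h₂ h₃ = good

  Sol-σ : ∀ {U es β} {st st′ : List (Stub n)} → (∀ A → σ A st ≡ σ A st′) → Sol U es st β → Sol U es st′ β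
  Sol-σ eq (mkSol ds pw bal) =
    mkSol ds pw λ {v} v∈ → trans (cong (net (is v) ds ⊕_) (sym (eq (is v)))) (bal v∈)

  module _ {U : List (Fin n)} {x y w : Fin n} {es : List (Edge n)}
           {st : List (Stub n)} {β : List (Charge n)} where

    -- Two kinds of sets lose two edges: those with `x` but neither neighbour, and those with both
    -- neighbours but not `x`. The latter are covered by `NonCritical` only if they have two
    -- vertices, whence `y ≢ w`.
    liftEdges : Inv U ((x , y) ∷ (x , w) ∷ es) st β →
      NonCritical U ((x , y) ∷ (x , w) ∷ es) st β → y ≢ w →
      ¬ Cap (deg ((x , y) ∷ (x , w) ∷ es) st (is x)) (chg (is x) β) →
      Inv U ((y , w) ∷ es) st β
    liftEdges inv nc y≢w ¬cap = record
      { located = case located of λ { ((x∈ , y∈) ∷ (_ , w∈) ∷ e∈ , rest) → (y∈ , w∈) ∷ e∈ , rest }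
      ; good    = λ A {u} {v} u∈ Au v∈ Av →
          case located of λ { ((x∈ , y∈) ∷ (_ , w∈) ∷ _ , _) →
          lift-edges-good (A x) (A y) (A w) (cut A es) (stubs A st) (good A u∈ Au v∈ Av)
            (λ Ax Ay Aw → noncap-set A x∈ Ax y∈ Ay ¬cap)
            (λ Ay Aw Ax → nc A y∈ w∈ y≢w Ay Aw x∈ Ax) }
      ; cap     = cap
      ; neutral = neutral
      } where open Step inv nc

  module _ {U : List (Fin n)} {x y : Fin n} {es : List (Edge n)}
           {st : List (Stub n)} {β : List (Charge n)} where

    liftStub : ∀ {t} → Inv U ((x , y) ∷ es) ((x , t) ∷ st) β →
      NonCritical U ((x , y) ∷ es) ((x , t) ∷ st) β →
      ¬ Cap (deg ((x , y) ∷ es) ((x , t) ∷ st) (is x)) (chg (is x) β) →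
      Inv U es ((y , t) ∷ st) β
    liftStub inv nc ¬cap = record
      { located = case located of λ { ((x∈ , y∈) ∷ e∈ , _ ∷ s∈ , b∈) → e∈ , y∈ ∷ s∈ , b∈ }
      ; good    = λ A {u} {v} u∈ Au v∈ Av →
          case located of λ { ((x∈ , y∈) ∷ _ , _) →
          lift-stub-good (A x) (A y) (cut A es) (stubs A st) (good A u∈ Au v∈ Av)
            (λ Ax Ay → noncap-set A x∈ Ax y∈ Ay ¬cap) }
      ; cap     = cap
      ; neutral = neutral
      } where open Step inv nc

    pushEdge : ∀ s → Inv U ((x , y) ∷ es) st β → NonCritical U ((x , y) ∷ es) st β →
      Pushable ((x , y) ∷ es) st β s (is x) → Pushable ((x , y) ∷ es) st β (not s) (is y) →
      Inv U es st (push s x y β)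
    pushEdge s inv nc px py = record
      { located = case located of λ { ((x∈ , y∈) ∷ e∈ , s∈ , b∈) → e∈ , s∈ , x∈ ∷ y∈ ∷ b∈ }
      ; good    = λ A {u} {v} u∈ Au v∈ Av →
          case located of λ { ((x∈ , y∈) ∷ _ , _) →
          push-good s (A x) (A y) (cut A es) (stubs A st) (good A u∈ Au v∈ Av)
            (λ Ax Ay → push-set s A x∈ Ax y∈ Ay px)
            (λ Ay Ax → push-set (not s) A y∈ Ay x∈ Ax py) }
      ; cap     = subst (Cap _) (sym (sgn-inverse s _)) cap
      ; neutral = trans neutral (sym (sgn-inverse s _))
      } where open Step inv nc

    -- The degree of `x` is unchanged, one edge being lost and one stub gained. A set with both `x`
    -- and `y` gains a stub at constant charge, which changes its parity; being noncritical it has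
    -- degree at least 6, where every residue is good.
    reverseStub : ∀ s → Inv U ((x , y) ∷ es) ((x , not s) ∷ st) β →
      NonCritical U ((x , y) ∷ es) ((x , not s) ∷ st) β → x ≢ y →
      Good (deg ((x , y) ∷ es) ((x , not s) ∷ st) (is x)) (sgn s ⊕ chg (is x) β) →
      Pushable ((x , y) ∷ es) ((x , not s) ∷ st) β s (is y) →
      Cap (suc (suc (stubs full st))) (chg full β) →
      Inv U es ((x , s) ∷ (x , s) ∷ st) (push s y x β)
    reverseStub s inv nc x≢y gx py cap′ = record
      { located = case located of λ { ((x∈ , y∈) ∷ e∈ , _ ∷ s∈ , b∈) → e∈ , x∈ ∷ x∈ ∷ s∈ , y∈ ∷ x∈ ∷ b∈ }
      ; good    = λ A {u} {v} u∈ Au v∈ Av →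
          case located of λ { ((x∈ , y∈) ∷ _ , _) →
          reverse-good s (A x) (A y) (cut A es) (stubs A st) (good A u∈ Au v∈ Av)
            (λ Ax Ay → nc A x∈ y∈ x≢y Ax Ay v∈ Av)
            (λ Ax Ay → reversed A x∈ Ax y∈ Ay)
            (λ Ay Ax → push-set s A y∈ Ay x∈ Ax py) }
      ; cap     = subst (Cap _) (sym (sgn-inverse s _)) cap′
      ; neutral = trans (sgn-double s _) (trans neutral (sym (sgn-inverse s _)))
      }
      where
      open Step inv nc
      reversed : ∀ A → x ∈ U → A x ≡ true → y ∈ U → A y ≡ false →
        Good (deg ((x , y) ∷ es) ((x , not s) ∷ st) A) (sgn s ⊕ chg A β)
      reversed A x∈ Ax y∈ Ay with noncritical-or-single A x∈ Ax y∈ Ay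
      ... | inj₁ ¬cap        = ≥6⇒good (noncap⇒≥6 _ ¬cap)
      ... | inj₂ (eqd , eqb) = subst₂ (λ d b → Good d (sgn s ⊕ b)) (sym eqd) (sym eqb) gx

    unreverse : ∀ s → Sol U es ((x , s) ∷ (x , s) ∷ st) (push s y x β) →
                Sol U ((x , y) ∷ es) ((x , not s) ∷ st) β
    unreverse s sol =
      Sol-≈ (prep (inj₂ refl) ≈.refl) (unpush s (Sol-σ (λ A → doubled (A x) (σ A st)) sol))
      where
      doubled : ∀ a r → (if a then sgn s else 0₃) ⊕ ((if a then sgn s else 0₃) ⊕ r) ≡
                        (if a then sgn (not s) else 0₃) ⊕ r
      doubled true  r = sgn-double s r
      doubled false r = refl

  module _ {U : List (Fin n)} {x : Fin n} {es : List (Edge n)}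
           {st : List (Stub n)} {β : List (Charge n)} where

    dropStub : ∀ s → Inv U es ((x , s) ∷ st) β → NonCritical U es ((x , s) ∷ st) β →
      Pushable es ((x , s) ∷ st) β s (is x) → Inv U es st ((x , sgn (not s)) ∷ β)
    dropStub s inv nc px = record
      { located = case located of λ { (e∈ , x∈ ∷ s∈ , b∈) → e∈ , s∈ , x∈ ∷ b∈ }
      ; good    = λ A {u} {v} u∈ Au v∈ Av →
          case located of λ { (_ , x∈ ∷ _ , _) →
          unstub-good s (A x) (cut A es) (stubs A st) (good A u∈ Au v∈ Av)
            (λ Ax → push-set s A x∈ Ax v∈ Av px) }
      ; cap     = cap-pred _ (not s) cap
      ; neutral = sgn-cancel s neutral
      } where open Step inv nc

    undropStub : ∀ s → Sol U es st ((x , sgn (not s)) ∷ β) → Sol U es ((x , s) ∷ st) β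
    undropStub s (mkSol ds pw bal) = mkSol ds pw λ {v} v∈ →
      moved (is v x) (net (is v) ds) (σ (is v) st) (chg (is v) β) (bal v∈)
      where
      moved : ∀ a m r b → m ⊕ r ≡ (if a then sgn (not s) else 0₃) ⊕ b →
              m ⊕ ((if a then sgn s else 0₃) ⊕ r) ≡ b
      moved false m r b eq = eq
      moved true  m r b eq = trans (ℤ₃∑.exchange m (sgn s) r)
        (trans (cong (sgn s ⊕_) eq) (sgn-inverse′ s b))

-- Here `c` and `s` count the edges and stubs of a vertex with τ = 0, and `s′` the stubs elsewhere.
-- The rest of the graph and z₀ then share |τ|, so s + s′ ≤ 4 + |τ| ≤ c + s′ and therefore s ≤ c.
cap-few-stubs : ∀ c s s′ {β} → c + s ≡ 4 → Good (c + s′) β → Cap (s + s′) β → s ≤ 2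
cap-few-stubs 4 0 s′ eq good cap = z≤n
cap-few-stubs 3 1 s′ eq good cap = s≤s z≤n
cap-few-stubs 2 2 s′ eq good cap = s≤s (s≤s z≤n)
cap-few-stubs 1 3 3 eq good cap = contradiction good cap
cap-few-stubs 1 3 4 eq good cap = contradiction cap good
cap-few-stubs 0 4 0 eq () cap
cap-few-stubs 0 4 1 eq () cap
cap-few-stubs 0 4 2 eq () cap
cap-few-stubs 0 4 3 eq () cap

repeated : ℕ → ℤ₃ → ℤ₃
repeated zero    c = 0₃
repeated (suc k) c = c ⊕ repeated k c

-- Stubs that all point the same way have net ±k. The cap rules out k = 6, as 6 ≡ 0, and k = 7, as 7
-- is not divisible by 3; for k = 5 the net is nonzero modulo 3, as a sixth stub requires.
cap-suc : ∀ k s → Cap k (repeated k (sgn s)) → Cap (suc k) (repeated k (sgn s))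
cap-suc 0 s cap = tt
cap-suc 1 s cap = tt
cap-suc 2 s cap = tt
cap-suc 3 s cap = tt
cap-suc 4 s cap = tt
cap-suc 5 true  cap = λ ()
cap-suc 5 false cap = λ ()
cap-suc 6 true  cap = contradiction refl cap
cap-suc 6 false cap = contradiction refl cap
cap-suc 7 true  ()
cap-suc 7 false ()
cap-suc (8+ k) s ()

-- The sign of the residue τ of a vertex that is both good and capped.
kind : ℕ → ℤ₃ → Bool
kind 5 2₃ = false
kind 6 1₃ = false
kind _ _  = true

-- An edge directed along the sign of τ lowers d and |τ| together, so d ≥ 4 + |τ| survives. At d = 7
-- the residue can be read as 3 or as -3, and `kind` settles on one. Only τ = 0 offers no sign.
kind-pushable : ∀ d b → Good d b → Cap d b → ¬ (d ≡ 4 × b ≡ 0₃) →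
  ∀ e → d ≡ suc e → Good e (sgn (not (kind d b)) ⊕ b)
kind-pushable 4 b  good cap ¬4 e eq   = contradiction (refl , good) ¬4
kind-pushable 5 0₃ good cap ¬4 e refl = contradiction refl good
kind-pushable 5 1₃ good cap ¬4 e refl = refl
kind-pushable 5 2₃ good cap ¬4 e refl = refl
kind-pushable 6 0₃ good cap ¬4 e refl = contradiction refl cap
kind-pushable 6 1₃ good cap ¬4 e refl = λ ()
kind-pushable 6 2₃ good cap ¬4 e refl = λ ()
kind-pushable 7 b  good cap ¬4 e refl = tt
kind-pushable (8+ d) b good () ¬4

-- At degree 5 the residue τ = ±1 moves to ±2, which with odd parity reads as ∓1; from degree 6 on
-- every residue is good.
kind-reversible : ∀ d b → Good d b → Cap d b → ¬ (d ≡ 4 × b ≡ 0₃) → Good d (sgn (kind d b) ⊕ b)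
kind-reversible 4 b  good cap ¬4 = contradiction (refl , good) ¬4
kind-reversible 5 0₃ good cap ¬4 = contradiction refl good
kind-reversible 5 1₃ good cap ¬4 = λ ()
kind-reversible 5 2₃ good cap ¬4 = λ ()
kind-reversible (6+ d) b good cap ¬4 = tt

5≤good : ∀ d b → Good d b → ¬ (d ≡ 4 × b ≡ 0₃) → 5 ≤ d
5≤good 4 b good ¬4 = contradiction (refl , good) ¬4
5≤good 5 b good ¬4 = ≤-refl
5≤good (6+ d) b good ¬4 = m≤m+n 5 _

-- Since `x` is about to disappear and has charge 0, a set avoiding it may be compared with its old
-- version without `x` (the letters a) or with `x` (the letters b). One of the two has the new
-- degree, except when the neighbours inside are exactly one lifted pair; then two edges are lost,
-- but the set contains two vertices and is noncritical.
lift-four-good : ∀ {ax bx} a₁ a₂ a₃ a₄ {b₁ b₂ b₃ b₄} c {c′} s {s′ β} →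
  let d  = (⟦ ax xor a₁ ⟧ + (⟦ ax xor a₂ ⟧ + (⟦ ax xor a₃ ⟧ + (⟦ ax xor a₄ ⟧ + c)))) + s
      d′ = (⟦ bx xor b₁ ⟧ + (⟦ bx xor b₂ ⟧ + (⟦ bx xor b₃ ⟧ + (⟦ bx xor b₄ ⟧ + c′)))) + s′ in
  ax ≡ false → bx ≡ true → b₁ ≡ a₁ → b₂ ≡ a₂ → b₃ ≡ a₃ → b₄ ≡ a₄ → c′ ≡ c → s′ ≡ s →
  Good d β → Good d′ β →
  (a₁ ≡ true → a₂ ≡ true → ¬ Cap d β) → (a₃ ≡ true → a₄ ≡ true → ¬ Cap d β) →
  Good ((⟦ a₁ xor a₂ ⟧ + (⟦ a₃ xor a₄ ⟧ + c)) + s) β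
lift-four-good true  true  true  true  c s refl refl refl refl refl refl refl refl g g′ h h′ = g′
lift-four-good true  true  true  false c s refl refl refl refl refl refl refl refl g g′ h h′ = g′
lift-four-good true  true  false true  c s refl refl refl refl refl refl refl refl g g′ h h′ = g′
lift-four-good true  true  false false c s refl refl refl refl refl refl refl refl g g′ h h′ =
  good-lift (c + s) (h refl refl)
lift-four-good true  false true  true  c s refl refl refl refl refl refl refl refl g g′ h h′ = g′
lift-four-good true  false true  false c s refl refl refl refl refl refl refl refl g g′ h h′ = g
lift-four-good true  false false true  c s refl refl refl refl refl refl refl refl g g′ h h′ = g
lift-four-good true  false false false c s refl refl refl refl refl refl refl refl g g′ h h′ = g
lift-four-good false true  true  true  c s refl refl refl refl refl refl refl refl g g′ h h′ = g′
lift-four-good false true  true  false c s refl refl refl refl refl refl refl refl g g′ h h′ = g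
lift-four-good false true  false true  c s refl refl refl refl refl refl refl refl g g′ h h′ = g
lift-four-good false true  false false c s refl refl refl refl refl refl refl refl g g′ h h′ = g
lift-four-good false false true  true  c s refl refl refl refl refl refl refl refl g g′ h h′ =
  good-lift (c + s) (h′ refl refl)
lift-four-good false false true  false c s refl refl refl refl refl refl refl refl g g′ h h′ = g
lift-four-good false false false true  c s refl refl refl refl refl refl refl refl g g′ h h′ = g
lift-four-good false false false false c s refl refl refl refl refl refl refl refl g g′ h h′ = g

lift-three-good : ∀ {ax bx} a₁ a₂ a₃ {b₁ b₂ b₃} c {c′} s {s′ β} →
  let d  = (⟦ ax xor a₁ ⟧ + (⟦ ax xor a₂ ⟧ + (⟦ ax xor a₃ ⟧ + c))) + (⟦ ax ⟧ + s)
      d′ = (⟦ bx xor b₁ ⟧ + (⟦ bx xor b₂ ⟧ + (⟦ bx xor b₃ ⟧ + c′))) + (⟦ bx ⟧ + s′) in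
  ax ≡ false → bx ≡ true → b₁ ≡ a₁ → b₂ ≡ a₂ → b₃ ≡ a₃ → c′ ≡ c → s′ ≡ s →
  Good d β → Good d′ β → (a₁ ≡ true → a₂ ≡ true → ¬ Cap d β) →
  Good ((⟦ a₁ xor a₂ ⟧ + c) + (⟦ a₃ ⟧ + s)) β
lift-three-good true  true  true  c s refl refl refl refl refl refl refl g g′ h = g′
lift-three-good true  true  false c s refl refl refl refl refl refl refl g g′ h =
  good-lift (c + s) (h refl refl)
lift-three-good true  false true  c s {β = β} refl refl refl refl refl refl refl g g′ h =
  subst (λ d → Good (suc d) β) (sym (+-suc c s)) g
lift-three-good true  false false c s refl refl refl refl refl refl refl g g′ h = g
lift-three-good false true  true  c s {β = β} refl refl refl refl refl refl refl g g′ h =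
  subst (λ d → Good (suc d) β) (sym (+-suc c s)) g
lift-three-good false true  false c s refl refl refl refl refl refl refl g g′ h = g
lift-three-good false false true  c s {β = β} refl refl refl refl refl refl refl g g′ h =
  subst (λ d → Good d β) (sym (+-suc c s)) g
lift-three-good false false false c s refl refl refl refl refl refl refl g g′ h = g

lift-two-good : ∀ {ax} a₁ a₂ c s {β} → ax ≡ false →
  Good ((⟦ ax xor a₁ ⟧ + (⟦ ax xor a₂ ⟧ + c)) + (⟦ ax ⟧ + (⟦ ax ⟧ + s))) β →
  Good (c + (⟦ a₁ ⟧ + (⟦ a₂ ⟧ + s))) β
lift-two-good true  true  c s {β} refl g =
  subst (λ d → Good d β) (sym (trans (+-suc c (suc s)) (cong suc (+-suc c s)))) g
lift-two-good true  false c s {β} refl g = subst (λ d → Good d β) (sym (+-suc c s)) g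
lift-two-good false true  c s {β} refl g = subst (λ d → Good d β) (sym (+-suc c s)) g
lift-two-good false false c s refl g = g

fewer-edges : ∀ l a b → l + ((a + a) + b) < l + ((suc a + suc a) + b)
fewer-edges l a b = subst (_≤ l + ((suc a + suc a) + b)) (+-suc l ((a + a) + b))
  (+-monoʳ-≤ l (s≤s (+-monoˡ-≤ b (+-monoʳ-≤ a (n≤1+n a)))))

fewer-edges-one-stub : ∀ l a b → l + ((a + a) + suc b) < l + ((suc a + suc a) + b)
fewer-edges-one-stub l a b = subst (_≤ l + ((suc a + suc a) + b)) (+-suc l ((a + a) + suc b))
  (+-monoʳ-≤ l (s≤s (≤-reflexive (trans (+-suc (a + a) b) (cong (_+ b) (sym (+-suc a a)))))))

∧-left : ∀ {a b} → a ≡ false → a ∧ b ≡ false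
∧-left refl = refl

∧-right : ∀ {a b} → b ≡ false → a ∧ b ≡ false
∧-right {a} refl = Bool.∧-zeroʳ a

module _ {n : ℕ} where

  length-≈ : ∀ {es es′ : List (Edge n)} → es ≈ es′ → length es ≡ length es′
  length-≈ = ≈-Properties.xs↭ys⇒|xs|≡|ys|

  length-↭ : ∀ {st st′ : List (Stub n)} → st ↭ st′ → length st ≡ length st′
  length-↭ = PermSetoid.xs↭ys⇒|xs|≡|ys| (setoid _)

  measure-≈ : ∀ (U : List (Fin n)) {es es′ st st′} → es ≈ es′ → st ↭ st′ →
              measure U es st ≡ measure U es′ st′
  measure-≈ U p q = cong₂ (λ a b → length U + ((a + a) + b)) (length-≈ p) (length-↭ q)

  dropInside : ∀ {C : VSet n} {U e es st β} → C (proj₁ e) ≡ true → C (proj₂ e) ≡ true →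
    QuotientSol C U (e ∷ es) st β → QuotientSol C U es st β
  dropInside {C} {U} {x , y} {es} {st} {β} Cx Cy (mkQuotientSol (d ∷ ds) (r ∷ pw) bal balC) =
    mkQuotientSol ds pw
      (λ {v} v∈ Cv → trans (cong (λ a → (a ⊕ net (is v) ds) ⊕ σ (is v) st) (sym (off r v Cv))) (bal v∈ Cv))
      (trans (cong (λ a → (a ⊕ net C ds) ⊕ σ C st) (sym (on r))) balC)
    where
    on : ∀ {d} → d ~ (x , y) → fl C d ≡ 0₃
    on (inj₁ refl) = cong₂ (λ a b → ι a ⊕ ⊝ ι b) Cx Cy
    on (inj₂ refl) = cong₂ (λ a b → ι a ⊕ ⊝ ι b) Cy Cx
    missed : ∀ {v w} → C v ≡ false → C w ≡ true → is v w ≡ false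
    missed {v} {w} Cv Cw = is-≢ {x = v} {y = w} λ { refl → separated C Cw Cv refl }
    off : ∀ {d} → d ~ (x , y) → ∀ v → C v ≡ false → fl (is v) d ≡ 0₃
    off (inj₁ refl) v Cv = cong₂ (λ a b → ι a ⊕ ⊝ ι b) (missed Cv Cx) (missed Cv Cy)
    off (inj₂ refl) v Cv = cong₂ (λ a b → ι a ⊕ ⊝ ι b) (missed Cv Cy) (missed Cv Cx)

  contractCritical : ∀ {U es st β} → Rec (measure U es st) → Inv U es st β →
    ∀ (C : VSet n) {u v w} → u ∈ U → v ∈ U → u ≢ v → C u ≡ true → C v ≡ true →
    w ∈ U → C w ≡ false → Cap (deg es st C) (chg C β) → ¬ ¬ Sol U es st β
  contractCritical {U} {es} {st} {β} rec inv C {u} {v} {w} u∈ v∈ u≢v Cu Cv w∈ Cw cap =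
    rec (measure-contract C u Cu {es = es} {st} v∈ Cv (λ v≡u → u≢v (sym v≡u)))
        (contract-Inv C u Cu u∈ inv) >>= λ sol →
    let q = quotientSol C u Cu u∈ sol in
    rec (measure-restrict q w∈ Cw)
        (restrict-Inv q located
          (λ A u∈ Cu Au v∈ Cv Av → good (A ∩ C) u∈ (cong₂ _∧_ Au Cu) v∈ (∧-left Av)) cap) >>= λ solC →
    return (Restrict.extend q solC)
    where open Inv inv using (located; good)

  -- Disposing of doubled edges provides the distinct ends that `liftEdges` asks for; `pairSol`
  -- handles them whatever the degree of the pair.
  contractParallel : ∀ {U x y es st β} → Rec (measure U ((x , y) ∷ (x , y) ∷ es) st) →
    Inv U ((x , y) ∷ (x , y) ∷ es) st β → x ≢ y → ¬ ¬ Sol {n} U ((x , y) ∷ (x , y) ∷ es) st β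
  contractParallel {U} {x} {y} {es} {st} rec inv x≢y with Inv.located inv
  ... | (x∈ , y∈) ∷ _ , _ =
    rec (measure-contract C x (pair-left x y) {es = (x , y) ∷ (x , y) ∷ es} {st}
          y∈ (pair-right x y) (λ y≡x → x≢y (sym y≡x)))
        (contract-Inv C x (pair-left x y) x∈ inv) >>= λ sol →
    return (pairSol x≢y (drop (drop (quotientSol C x (pair-left x y) x∈ sol))))
    where
    C = pair x y
    drop : ∀ {es} → QuotientSol C U ((x , y) ∷ es) st _ → QuotientSol C U es st _
    drop = dropInside (pair-left x y) (pair-right x y)

  one-vertex : ∀ {U : List (Fin n)} {es st β} → Located U es st β → σ full st ≡ chg full β →
    (∀ {u v} → u ∈ U → v ∈ U → u ≡ v) → Sol U es st β
  one-vertex {U} {es} {st} {β} (e∈ , s∈ , b∈) neutral single =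
    mkSol es (Pointwise.refl ~.refl) λ {v} v∈ →
      let on : ∀ {u} → u ∈ U → is v u ≡ true
          on u∈ = subst (λ u → is v u ≡ true) (single v∈ u∈) (is-refl v) in
      trans (cong₂ _⊕_
               (trans (ℤ₃∑.∑-cong-All (All.map (λ (p , q) → cong₂ (λ a b → ι a ⊕ ⊝ ι b) (on p) (on q)) e∈))
                      (net-full es))
               (ℤ₃∑.∑-cong-All (All.map (λ {s} p → cong (if_then sgn (proj₂ s) else 0₃) (on p)) s∈)))
            (trans neutral
               (sym (ℤ₃∑.∑-cong-All (All.map (λ {c} p → cong (if_then proj₂ c else 0₃) (on p)) b∈))))

  two-or-one : ∀ (U : List (Fin n)) →
    (∀ {u v} → u ∈ U → v ∈ U → u ≡ v) ⊎ (∃₂ λ x w → x ∈ U × w ∈ U × w ≢ x)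
  two-or-one []      = inj₁ λ ()
  two-or-one (x ∷ U) with All.all? (_≟ x) (x ∷ U)
  ... | yes all = inj₁ λ u∈ v∈ → trans (All.lookup all u∈) (sym (All.lookup all v∈))
  ... | no ¬all =
    let w , w∈ , w≢x = find (All.¬All⇒Any¬ (_≟ x) (x ∷ U) ¬all) in inj₂ (x , w , here refl , w∈ , w≢x)

  another : ∀ {U} {x w : Fin n} → x ∈ U → w ∈ U → w ≢ x → ∀ y → ∃ λ z → z ∈ U × z ≢ y
  another {x = x} {w} x∈ w∈ w≢x y with x ≟ y
  ... | yes refl = w , w∈ , w≢x
  ... | no x≢y   = x , x∈ , x≢y

  net-isolated : ∀ A (es : List (Edge n)) → cut A es ≡ 0 → net A es ≡ 0₃
  net-isolated A []             eq = refl
  net-isolated A ((u , v) ∷ es) eq with A u | A v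
  ... | true  | true  = net-isolated A es eq
  ... | false | false = net-isolated A es eq

  σ-isolated : ∀ A (st : List (Stub n)) → stubs A st ≡ 0 → σ A st ≡ 0₃
  σ-isolated A []             eq = refl
  σ-isolated A ((u , s) ∷ st) eq with A u
  ... | false = σ-isolated A st eq

  cut-∪-isolated : ∀ A B (es : List (Edge n)) → cut B es ≡ 0 → (∀ {v} → B v ≡ true → A v ≡ false) →
                   cut (A ∪ B) es ≡ cut A es
  cut-∪-isolated A B []             eq out = refl
  cut-∪-isolated A B ((u , v) ∷ es) eq out with B u in Bu | B v in Bv
  ... | true  | true  rewrite out Bu | out Bv = cut-∪-isolated A B es eq out
  ... | false | false rewrite Bool.∨-identityʳ (A u) | Bool.∨-identityʳ (A v) =
    cong (⟦ A u xor A v ⟧ +_) (cut-∪-isolated A B es eq out)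

  stubs-∪-isolated : ∀ A B (st : List (Stub n)) → stubs B st ≡ 0 → stubs (A ∪ B) st ≡ stubs A st
  stubs-∪-isolated A B []             eq = refl
  stubs-∪-isolated A B ((u , s) ∷ st) eq with B u
  ... | false rewrite Bool.∨-identityʳ (A u) = cong (⟦ A u ⟧ +_) (stubs-∪-isolated A B st eq)

-- Reductions at a single vertex

module _ {n : ℕ} where

  NoParallel : List (Edge n) → Set
  NoParallel es = ∀ {x y es′} → x ≢ y → ¬ (es ≈ (x , y) ∷ (x , y) ∷ es′)

  measure-mono : ∀ (U : List (Fin n)) {es es′ st st′} →
    length es ≤ length es′ → length st ≤ length st′ → measure U es st ≤ measure U es′ st′
  measure-mono U p q = +-monoʳ-≤ (length U) (+-mono-≤ (+-mono-≤ p p) q)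

  pull-at : ∀ (x : Fin n) es {c} → cut (is x) es ≡ suc c →
    ∃₂ λ y es′ → es ≈ (x , y) ∷ es′ × is x y ≡ false × cut (is x) es′ ≡ c
  pull-at x es eq with pull-edge (is x) es eq
  ... | x′ , y , es′ , p , isx , isy , eq′ with is⇒≡ {x = x} {x′} isx
  ...   | refl = y , es′ , p , isy , eq′

  pull-stub-at : ∀ (x : Fin n) st {c} → stubs (is x) st ≡ suc c →
    ∃₂ λ s st′ → st ↭ (x , s) ∷ st′ × stubs (is x) st′ ≡ c
  pull-stub-at x st eq with pull-stub (is x) st eq
  ... | x′ , s , st′ , p , isx , eq′ with is⇒≡ {x = x} {x′} isx
  ...   | refl = s , st′ , p , eq′

  ≢-from : ∀ {x y : Fin n} → is x y ≡ false → x ≢ y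
  ≢-from {x} isy refl with () ← trans (sym (is-refl x)) isy

  module AtVertex {U : List (Fin n)} {es : List (Edge n)} {st : List (Stub n)} {β : List (Charge n)}
                  (rec : Rec {n} (measure U es st)) (inv : Inv U es st β)
                  {x w : Fin n} (x∈ : x ∈ U) (w∈ : w ∈ U) (w≢x : w ≢ x) where
    open Inv inv

    private
      id-st : st ↭ st
      id-st = ↭-refl

    rest-good : Good (cut (is x) es + stubs (∁ (is x)) st) (chg (∁ (is x)) β)
    rest-good = subst (λ c → Good (c + stubs (∁ (is x)) st) (chg (∁ (is x)) β)) (cut-∁ (is x) es)
      (good (∁ (is x)) w∈ (cong not (is-≢ {x = x} {w} (λ x≡w → w≢x (sym x≡w))))
                       x∈ (cong not (is-refl x)))

    rest-cap : Cap (stubs (is x) st + stubs (∁ (is x)) st) (chg full β)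
    rest-cap = subst (λ d → Cap d (chg full β)) (sym (stubs-∁ (is x) st)) cap

    -- If `x` had no edge, it would have five stubs and the rest, also joined to z₀ by stubs alone,
    -- at least four; nine stubs exceed the cap.
    has-edge : 5 ≤ deg es st (is x) → ∃ λ c → cut (is x) es ≡ suc c
    has-edge 5≤d with cut (is x) es | rest-good
    ... | suc c | _ = c , refl
    ... | zero  | g =
      contradiction (+-mono-≤ 5≤d (good⇒≥4 _ g)) (<⇒≱ (≤-trans (cap⇒<8 _ rest-cap) (n≤1+n 8)))

    -- A stub at `x` is lifted with an edge if there is one. Otherwise the degree, at least 6,
    -- consists of edges, and two of them have distinct other ends because no edge is doubled.
    liftNonCap : NonCritical U es st β → NoParallel es →
      ¬ Cap (deg es st (is x)) (chg (is x) β) → ¬ ¬ Sol U es st β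
    liftNonCap nc np ¬cap
      with has-edge (≤-trans (n≤1+n 5) (noncap⇒≥6 _ ¬cap))
    ... | c , eqc with pull-at x es eqc
    ... | y , es′ , p , isy , eqc′ with stubs (is x) st in eqs
    ... | suc k =
      let s , st′ , q , _ = pull-stub-at x st eqs in
      rec (subst (measure U es′ ((y , s) ∷ st′) <_) (sym (measure-≈ U p q))
             (fewer-edges (length U) (length es′) (length ((y , s) ∷ st′))))
          (liftStub (Inv-≈ p q inv) (NonCritical-≈ {β = β} p q nc)
             (subst (λ d → ¬ Cap d (chg (is x) β))
                    (trans (cong (cut (is x) es +_) (sym eqs)) (deg-≈ p q (is x))) ¬cap)) >>= λ sol →
      return (Sol-↭ (Perm.sym sym q) (Sol-≈ (≈.sym p) (unlift-stub sol)))
    ... | zero with c | noncap⇒≥6 _ ¬cap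
    ...   | zero  | 6≤d with s≤s () ← subst (6 ≤_) (trans (+-identityʳ _) eqc) 6≤d
    ...   | suc _ | _ with pull-at x es′ eqc′
    ...     | z , es″ , p′ , isz , _ =
      let p″ = p ⨟ prep ~.refl p′ in
      rec (subst (measure U ((y , z) ∷ es″) st <_) (sym (measure-≈ U p″ id-st))
             (fewer-edges (length U) (length ((y , z) ∷ es″)) (length st)))
          (liftEdges (Inv-≈ p″ id-st inv) (NonCritical-≈ {β = β} p″ id-st nc)
             (λ { refl → np (≢-from {x} {y} isy) p″ })
             (subst (λ d → ¬ Cap d (chg (is x) β))
                    (trans (cong (cut (is x) es +_) (sym eqs)) (deg-≈ p″ id-st (is x))) ¬cap)) >>= λ sol →
      return (Sol-≈ (≈.sym p″) (unlift-edges sol))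

    module _ (chg0 : chg (is x) β ≡ 0₃) where

      chg-rest : chg (∁ (is x)) β ≡ chg full β
      chg-rest = trans (cong (_⊕ chg (∁ (is x)) β) (sym chg0)) (chg-∁ (is x) β)

      -- After the lifting `x` has no edge, no stub and no charge, so deleting it balances
      -- trivially; the number of stubs is kept and with it the cap at z₀.
      dropIsolated : ∀ {es₁ st₁} → measure U es₁ st₁ ≤ measure U es st → Located U es₁ st₁ β →
        σ full st₁ ≡ σ full st → stubs full st₁ ≡ stubs full st →
        cut (is x) es₁ ≡ 0 → stubs (is x) st₁ ≡ 0 →
        (∀ A {u v} → A x ≡ false → u ∈ U → A u ≡ true → v ∈ U → is x v ≡ false → A v ≡ false →
           Good (deg es₁ st₁ A) (chg A β)) →
        ¬ ¬ Sol U es₁ st₁ β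
      dropIsolated {es₁} {st₁} le loc eqσ eqst cut0 stubs0 good₁ =
        rec (≤-trans (measure-restrict q x∈ (cong not (is-refl x))) le)
            (restrict-Inv q loc
              (λ A {u} {v} u∈ Cu Au v∈ Cv Av →
                good₁ (A ∩ ∁ (is x)) (∧-right {A x} (cong not (is-refl x)))
                      u∈ (cong₂ _∧_ Au Cu) v∈ (Bool.not-injective Cv) (∧-left Av))
              (subst₂ Cap eqd (sym chg-rest) cap)) >>= λ sol →
        return (Restrict.extend q sol)
        where
        q : QuotientSol (∁ (is x)) U es₁ st₁ β
        q = removalSol {x = x} {st = st₁} {β} es₁ (Pointwise.refl ~.refl) (trans eqσ neutral)
              (trans (cong₂ _⊕_ (net-isolated (is x) es₁ cut0) (σ-isolated (is x) st₁ stubs0)) (sym chg0))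
        eqd : stubs full st ≡ deg es₁ st₁ (∁ (is x))
        eqd = trans (sym eqst) (trans (sym (stubs-∁ (is x) st₁))
          (cong₂ _+_ (trans stubs0 (sym (trans (cut-∁ (is x) es₁) cut0))) refl))

      with-x : ∀ {es′ st′} → Inv U es′ st′ β → ∀ A {u v} → A x ≡ false → u ∈ U → A u ≡ true →
        v ∈ U → is x v ≡ false → A v ≡ false → Good (deg es′ st′ (A ∪ is x)) (chg A β)
      with-x {es′} {st′} inv′ A {u} {v} Ax u∈ Au v∈ xv Av =
        subst (Good (deg es′ st′ (A ∪ is x)))
          (trans (chg-∪ A (is x) disjoint β) (trans (cong (chg A β ⊕_) chg0) (⊕-identityʳ _)))
          (Inv.good inv′ (A ∪ is x) u∈ (cong (_∨ is x u) Au) v∈ (cong₂ _∨_ Av xv))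
        where
        disjoint : Disjoint A (is x)
        disjoint v with x ≟ v
        ... | yes refl = trans (Bool.∧-identityʳ _) Ax
        ... | no  _    = Bool.∧-zeroʳ _

      ∪-at : ∀ (A : VSet n) y → is x y ≡ false → (A ∪ is x) y ≡ A y
      ∪-at A y isy = trans (cong (A y ∨_) isy) (Bool.∨-identityʳ _)

      ∪-x : ∀ (A : VSet n) → (A ∪ is x) x ≡ true
      ∪-x A = trans (cong (A x ∨_) (is-refl x)) (Bool.∨-zeroʳ _)

      excludes : ∀ (A : VSet n) → A x ≡ false → ∀ {v} → is x v ≡ true → A v ≡ false
      excludes A Ax {v} isv = subst (λ v → A v ≡ false) (is⇒≡ {x = x} {v} isv) Ax

      -- By `cap-few-stubs` each stub at `x` finds an edge as partner, and the remaining edges are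
      -- paired among themselves.
      liftFour : NonCritical U es st β → NoParallel es → deg es st (is x) ≡ 4 → ¬ ¬ Sol U es st β
      liftFour nc np eq4
        with cut (is x) es in eqc | stubs (is x) st in eqs | eq4
           | cap-few-stubs (cut (is x) es) (stubs (is x) st) _ eq4
               (subst (Good _) chg-rest rest-good) rest-cap
      ... | 4 | 0 | refl | _
        with y₁ , es₁ , p₁ , i₁ , eq₁ ← pull-at x es eqc
        with y₂ , es₂ , p₂ , i₂ , eq₂ ← pull-at x es₁ eq₁
        with y₃ , es₃ , p₃ , i₃ , eq₃ ← pull-at x es₂ eq₂
        with y₄ , es₄ , p₄ , i₄ , eq₄ ← pull-at x es₃ eq₃
        with p ← p₁ ⨟ prep ~.refl (p₂ ⨟ prep ~.refl (p₃ ⨟ prep ~.refl p₄))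
        with inv′ ← Inv-≈ p id-st inv | nc′ ← NonCritical-≈ {β = β} p id-st nc
        with (_ , y₁∈) ∷ (_ , y₂∈) ∷ (_ , y₃∈) ∷ (_ , y₄∈) ∷ e∈ , s∈ , b∈ ← Inv.located inv′ =
        dropIsolated
          (measure-mono U {es = new} {es} {st} {st} (subst (length new ≤_) (sym (length-≈ p)) (m≤n+m _ 2)) ≤-refl)
          ((y₁∈ , y₂∈) ∷ (y₃∈ , y₄∈) ∷ e∈ , s∈ , b∈) refl refl
          (cong₂ _+_ (cong₂ (λ a b → ⟦ a xor b ⟧) i₁ i₂)
                     (cong₂ _+_ (cong₂ (λ a b → ⟦ a xor b ⟧) i₃ i₄) eq₄))
          eqs
          (λ A Ax u∈ Au v∈ xv Av →
            lift-four-good (A y₁) (A y₂) (A y₃) (A y₄) (cut A es₄) (stubs A st)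
              Ax (∪-x A) (∪-at A y₁ i₁) (∪-at A y₂ i₂) (∪-at A y₃ i₃) (∪-at A y₄ i₄)
              (cut-∪-isolated A (is x) es₄ eq₄ (excludes A Ax)) (stubs-∪-isolated A (is x) st eqs)
              (Inv.good inv′ A u∈ Au v∈ Av) (with-x inv′ A Ax u∈ Au v∈ xv Av)
              (λ A₁ A₂ → nc′ A y₁∈ y₂∈ (λ { refl → np (≢-from {x} {y₁} i₁) p }) A₁ A₂ x∈ Ax)
              (λ A₃ A₄ → nc′ A y₃∈ y₄∈ (λ { refl → np (≢-from {x} {y₃} i₃) (p ⨟ swapped) }) A₃ A₄ x∈ Ax))
          >>= λ sol →
        return (Sol-≈ (≈.sym (p ⨟ swapped)) (unlift-edges
                  (Sol-≈ (≈-Properties.shifts ((x , y₁) ∷ (x , y₂) ∷ []) ((y₃ , y₄) ∷ []))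
                         (unlift-edges sol))))
        where
        new = (y₁ , y₂) ∷ (y₃ , y₄) ∷ es₄
        swapped = ≈-Properties.shifts ((x , y₁) ∷ (x , y₂) ∷ []) ((x , y₃) ∷ (x , y₄) ∷ [])
      liftFour nc np eq4 | 3 | 1 | refl | _
        with y₁ , es₁ , p₁ , i₁ , eq₁ ← pull-at x es eqc
        with y₂ , es₂ , p₂ , i₂ , eq₂ ← pull-at x es₁ eq₁
        with y₃ , es₃ , p₃ , i₃ , eq₃ ← pull-at x es₂ eq₂
        with s , st′ , q , eqs′ ← pull-stub-at x st eqs
        with p ← p₁ ⨟ prep ~.refl (p₂ ⨟ prep ~.refl p₃)
        with inv′ ← Inv-≈ p q inv | nc′ ← NonCritical-≈ {β = β} p q nc
        with (_ , y₁∈) ∷ (_ , y₂∈) ∷ (_ , y₃∈) ∷ e∈ , _ ∷ s∈ , b∈ ← Inv.located inv′ =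
        dropIsolated
          (measure-mono U {es = (y₁ , y₂) ∷ es₃} {es} {(y₃ , s) ∷ st′} {st} (subst (length ((y₁ , y₂) ∷ es₃) ≤_) (sym (length-≈ p)) (m≤n+m _ 2))
                          (≤-reflexive (sym (length-↭ q))))
          ((y₁∈ , y₂∈) ∷ e∈ , y₃∈ ∷ s∈ , b∈) (sym (σ-↭ full q)) (sym (stubs-↭ full q))
          (cong₂ _+_ (cong₂ (λ a b → ⟦ a xor b ⟧) i₁ i₂) eq₃)
          (cong₂ _+_ (cong ⟦_⟧ i₃) eqs′)
          (λ A Ax u∈ Au v∈ xv Av →
            lift-three-good (A y₁) (A y₂) (A y₃) (cut A es₃) (stubs A st′)
              Ax (∪-x A) (∪-at A y₁ i₁) (∪-at A y₂ i₂) (∪-at A y₃ i₃)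
              (cut-∪-isolated A (is x) es₃ eq₃ (excludes A Ax)) (stubs-∪-isolated A (is x) st′ eqs′)
              (Inv.good inv′ A u∈ Au v∈ Av) (with-x inv′ A Ax u∈ Au v∈ xv Av)
              (λ A₁ A₂ → nc′ A y₁∈ y₂∈ (λ { refl → np (≢-from {x} {y₁} i₁) p }) A₁ A₂ x∈ Ax))
          >>= λ sol →
        return (Sol-↭ (Perm.sym sym q) (Sol-≈ (≈.sym (p ⨟ swapped)) (unlift-stub (unlift-edges sol))))
        where
        swapped = ≈-Properties.shifts ((x , y₁) ∷ (x , y₂) ∷ []) ((x , y₃) ∷ [])
      liftFour nc np eq4 | 2 | 2 | refl | _
        with y₁ , es₁ , p₁ , i₁ , eq₁ ← pull-at x es eqc
        with y₂ , es₂ , p₂ , i₂ , eq₂ ← pull-at x es₁ eq₁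
        with s₁ , st₁ , q₁ , eqs₁ ← pull-stub-at x st eqs
        with s₂ , st₂ , q₂ , eqs₂ ← pull-stub-at x st₁ eqs₁
        with p ← p₁ ⨟ prep ~.refl p₂ | q ← q₁ ⨟ prep refl q₂
        with inv′ ← Inv-≈ p q inv
        with (_ , y₁∈) ∷ (_ , y₂∈) ∷ e∈ , _ ∷ _ ∷ s∈ , b∈ ← Inv.located inv′ =
        dropIsolated
          (measure-mono U {es = es₂} {es} {(y₁ , s₁) ∷ (y₂ , s₂) ∷ st₂} {st} (subst (length es₂ ≤_) (sym (length-≈ p)) (m≤n+m _ 2))
                          (≤-reflexive (sym (length-↭ q))))
          (e∈ , y₁∈ ∷ y₂∈ ∷ s∈ , b∈) (sym (σ-↭ full q)) (sym (stubs-↭ full q))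
          eq₂
          (cong₂ _+_ (cong ⟦_⟧ i₁) (cong₂ _+_ (cong ⟦_⟧ i₂) eqs₂))
          (λ A Ax u∈ Au v∈ xv Av →
            lift-two-good (A y₁) (A y₂) (cut A es₂) (stubs A st₂) Ax (Inv.good inv′ A u∈ Au v∈ Av))
          >>= λ sol →
        return (Sol-↭ (Perm.sym sym (q ⨟ swapped)) (Sol-≈ (≈.sym (p ⨟ swap ~.refl ~.refl ≈.refl))
                  (unlift-stub (Sol-↭ (swap refl refl ↭-refl) (unlift-stub sol)))))
        where
        swapped = swap refl refl ↭-refl
      liftFour nc np eq4 | 1 | 3 | refl | s≤s (s≤s ())
      liftFour nc np eq4 | 0 | 4 | refl | s≤s (s≤s ())

-- The tight case and the induction

module _ {n : ℕ} where

  module _ {U : List (Fin n)} {es : List (Edge n)} {β : List (Charge n)}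
           (rec : Rec {n} (measure U es [])) (inv : Inv U es [] β)
           {x w : Fin n} (x∈ : x ∈ U) (w∈ : w ∈ U) (w≢x : w ≢ x) where
    open Inv inv

    -- With no stubs left, the edges at a vertex x of small degree are directed
    -- so as to balance x and become the new stubs.
    expose : Cap (deg es [] (is x)) (chg (is x) β) → ¬ ¬ Sol U es [] β
    expose cap-x with cut (is x) es in eqc
      | good⇒≥4 _ (good (is x) x∈ (is-refl x) w∈ (is-≢ {x = x} {w} (λ x≡w → w≢x (sym x≡w))))
    ... | suc (suc c) | _
      with y₁ , es₁ , p₁ , i₁ , eq₁ ← pull-at x es eqc
      with y₂ , es₂ , p₂ , i₂ , eq₂ ← pull-at x es₁ eq₁
      with ds , pw , eq ← orient-at (≢-from {x = x} {y₁} i₁) (≢-from {x = x} {y₂} i₂)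
                            (p₁ ⨟ prep ~.refl p₂) (chg (is x) β)
      with q ← removalSol {x = x} {U} {st = []} {β} ds pw neutral (trans (⊕-identityʳ _) eq) =
      rec (measure-restrict q x∈ (cong not (is-refl x)))
          (restrict-Inv q located
            (λ A u∈ Cu Au v∈ Cv Av →
              good (A ∩ ∁ (is x)) u∈ (cong₂ _∧_ Au Cu) x∈ (∧-right {A x} (cong not (is-refl x))))
            (subst (λ d → Cap d (chg (∁ (is x)) β))
                   (cong₂ _+_ (sym (trans (cut-∁ (is x) es) eqc)) (refl {x = 0}))
                   (cap-neg _ (trans (chg-∁ (is x) β) (sym neutral)) cap-x))) >>= λ sol →
      return (Restrict.extend q sol)
    ... | suc zero | s≤s ()

  σ-repeated : ∀ s (st : List (Stub n)) → All (λ t → proj₂ t ≡ s) st →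
               σ full st ≡ repeated (stubs full st) (sgn s)
  σ-repeated s []             []           = refl
  σ-repeated s ((x , _) ∷ st) (refl ∷ all) = cong (sgn s ⊕_) (σ-repeated s st all)

  module _ {U : List (Fin n)} {es : List (Edge n)} {x : Fin n} {t : Bool}
           {st : List (Stub n)} {β : List (Charge n)}
           (rec : Rec {n} (measure U es ((x , t) ∷ st))) (inv : Inv U es ((x , t) ∷ st) β) (nc : NonCritical U es ((x , t) ∷ st) β)
           {x₀ w₀ : Fin n} (x₀∈ : x₀ ∈ U) (w₀∈ : w₀ ∈ U) (w₀≢x₀ : w₀ ≢ x₀)
           (capped : ∀ {v : Fin n} → v ∈ U → Cap (deg es ((x , t) ∷ st) (is v)) (chg (is v) β))
           (not-four : ∀ {v : Fin n} → v ∈ U → ¬ (deg es ((x , t) ∷ st) (is v) ≡ 4 × chg (is v) β ≡ 0₃)) where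
    open Inv inv

    private
      st⁺ : List (Stub n)
      st⁺ = (x , t) ∷ st

      T : VSet n
      T v = kind (deg es st⁺ (is v)) (chg (is v) β)

      id-st : st⁺ ↭ st⁺
      id-st = ↭-refl

      id-es : es ≈ es
      id-es = ≈.refl

      vertex-good : ∀ {v} → v ∈ U → Good (deg es st⁺ (is v)) (chg (is v) β)
      vertex-good {v} v∈ with another x₀∈ w₀∈ w₀≢x₀ v
      ... | z , z∈ , z≢v = good (is v) v∈ (is-refl v) z∈ (is-≢ {x = v} {z} (λ v≡z → z≢v (sym v≡z)))

      pushable : ∀ {v} → v ∈ U → Pushable es st⁺ β (T v) (is v)
      pushable v∈ = kind-pushable _ _ (vertex-good v∈) (capped v∈) (not-four v∈)

      pushable-at : ∀ {v s} → v ∈ U → T v ≡ s → Pushable es st⁺ β s (is v)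
      pushable-at {v} v∈ eq = subst (λ s → Pushable es st⁺ β s (is v)) eq (pushable v∈)

    -- An edge between vertices of different kinds, or a stub pointing the way
    -- its vertex wants, can be directed at no cost.
    pushCrossing : ∀ {c} → cut T es ≡ suc c → ¬ ¬ Sol U es st⁺ β
    pushCrossing eq with pull-edge T es eq
    ... | u , v , es′ , p , Tu , Tv , _ with Inv.located (Inv-≈ p id-st inv)
    ... | (u∈ , v∈) ∷ _ , _ =
      rec (subst (measure U es′ st⁺ <_) (sym (measure-≈ U p id-st))
            (fewer-edges (length U) (length es′) (length st⁺)))
          (pushEdge true (Inv-≈ p id-st inv) (NonCritical-≈ {β = β} p id-st nc)
            (Pushable-≈ {β = β} {true} {is u} p id-st (pushable-at u∈ Tu))
            (Pushable-≈ {β = β} {false} {is v} p id-st (pushable-at v∈ Tv))) >>= λ sol →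
      return (Sol-≈ (≈.sym p) (unpush true sol))

    dropMatching : Any (λ s → ¬ proj₂ s ≡ not (T (proj₁ s))) st⁺ → ¬ ¬ Sol U es st⁺ β
    dropMatching any with find any
    ... | (v , s) , s∈ , s≢ with pull s∈
      where
      pull : ∀ {s : Stub n} {st} → s ∈ st → ∃ λ st′ → st ↭ s ∷ st′
      pull (here refl) = _ , ↭-refl
      pull (there s∈)  = let st′ , p = pull s∈ in
        _ , (prep refl p ⨟ swap refl refl ↭-refl)
    ... | st′ , p with Inv.located (Inv-≈ id-es p inv)
    ... | _ , v∈ ∷ _ , _ =
      rec (subst (measure U es st′ <_) (sym (measure-≈ U id-es p))
            (+-monoʳ-< (length U) (+-monoʳ-< (length es + length es) (n<1+n _))))
          (dropStub s (Inv-≈ id-es p inv) (NonCritical-≈ {β = β} id-es p nc)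
            (Pushable-≈ {β = β} {s} {is v} id-es p
              (pushable-at v∈ (sym (trans (Bool.¬-not s≢) (Bool.not-involutive (T v))))))) >>= λ sol →
      return (Sol-↭ (Perm.sym sym p) (undropStub s sol))

    -- −1 ≡ 2 (mod 3): an unwanted stub is traded for two wanted ones.
    reverse : cut T es ≡ 0 → All (λ s → proj₂ s ≡ not (T (proj₁ s))) st⁺ → ¬ ¬ Sol U es st⁺ β
    reverse eqT all with All.all? (λ u → T u Bool.≟ T x) U | located
    -- If both kinds occur and no edge joins them, each side is attached by stubs alone and needs
    -- four; eight stubs exceed the cap.
    ... | no ¬agree | _ , x∈ ∷ _ , _ with find (All.¬All⇒Any¬ (λ u → T u Bool.≟ T x) U ¬agree)
    ... | u , u∈ , Tu≢ = contradiction
      (subst (8 ≤_) (stubs-∁ T st⁺) (+-mono-≤ (side T eqT x∈ u∈ (λ Tx → Tu≢ (sym Tx)))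
                                              (side (∁ T) (trans (cut-∁ T es) eqT) x∈ u∈
                                                 (λ Tx → Tu≢ (sym (Bool.not-injective Tx))))))
      (<⇒≱ (cap⇒<8 _ cap))
      where
      side : ∀ A → cut A es ≡ 0 → ∀ {x u} → x ∈ U → u ∈ U → A x ≢ A u → 4 ≤ stubs A st⁺
      side A eqA {x} {u} x∈ u∈ A≢ with A x in Ax | A u in Au
      ... | true  | true  = contradiction refl A≢
      ... | false | false = contradiction refl A≢
      ... | true  | false = good⇒≥4 _ (subst (λ c → Good (c + stubs A st⁺) (chg A β)) eqA (good A x∈ Ax u∈ Au))
      ... | false | true  = good⇒≥4 _ (subst (λ c → Good (c + stubs A st⁺) (chg A β)) eqA (good A u∈ Au x∈ Ax))
    reverse eqT (t≡ ∷ all) | yes agree | _ , x∈ ∷ s∈ , _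
      with z , z∈ , z≢x ← another x₀∈ w₀∈ w₀≢x₀ x
      with c , eqc ← AtVertex.has-edge rec inv x∈ z∈ z≢x (5≤good _ _ (vertex-good x∈) (not-four x∈))
      with y , es′ , p , isy , _ ← pull-at x es eqc
      with (_ , y∈) ∷ _ , _ ← Inv.located (Inv-≈ p id-st inv)
      with refl ← t≡ =
      rec (subst (measure U es′ ((x , T x) ∷ (x , T x) ∷ st) <_) (sym (measure-≈ U p id-st))
            (fewer-edges-one-stub (length U) (length es′) (length st⁺)))
          (reverseStub (T x) (Inv-≈ p id-st inv) (NonCritical-≈ {β = β} p id-st nc)
            (≢-from {x = x} {y} isy)
            (subst (λ d → Good d (sgn (T x) ⊕ chg (is x) β)) (deg-≈ p id-st (is x))
              (kind-reversible _ _ (vertex-good x∈) (capped x∈) (not-four x∈)))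
            -- The edge is directed as the kind of `y` asks, which is also the kind of `x`.
            (Pushable-≈ {β = β} {T x} {is y} p id-st (pushable-at y∈ (All.lookup agree y∈)))
            (subst (Cap _) (trans (sym eqσ) neutral)
              (cap-suc _ (not (T x)) (subst (Cap _) (trans (sym neutral) eqσ) cap)))) >>= λ sol →
      return (Sol-≈ (≈.sym p) (unreverse (T x) sol))
      where
      eqσ : σ full st⁺ ≡ repeated (stubs full st⁺) (sgn (not (T x)))
      eqσ = σ-repeated (not (T x)) st⁺ (refl ∷ All.zipWith (λ (eq , v∈) →
              trans eq (cong not (All.lookup agree v∈))) (all , s∈))

    finish : ¬ ¬ Sol U es st⁺ β
    finish with cut T es in eqT | All.all? (λ s → proj₂ s Bool.≟ not (T (proj₁ s))) st⁺
    ... | suc c | _       = pushCrossing eqT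
    ... | zero  | no ¬all = dropMatching (All.¬All⇒Any¬ (λ s → proj₂ s Bool.≟ not (T (proj₁ s))) st⁺ ¬all)
    ... | zero  | yes all = reverse eqT all

  private
    Parallel : List (Edge n) → Set
    Parallel es = ∃₂ λ x y → ∃ λ es′ → x ≢ y × es ≈ (x , y) ∷ (x , y) ∷ es′

    Critical : List (Fin n) → List (Edge n) → List (Stub n) → List (Charge n) → Set
    Critical U es st β = ∃ λ C → ∃₂ λ u v → ∃ λ w → u ∈ U × v ∈ U × u ≢ v × C u ≡ true ×
      C v ≡ true × w ∈ U × C w ≡ false × Cap (deg es st C) (chg C β)

  solve-step : ∀ {U : List (Fin n)} {es st β} → Rec (measure U es st) → Inv U es st β → ¬ ¬ Sol U es st β
  solve-step {U} {es} {st} {β} rec inv with two-or-one U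
  ... | inj₁ single = return (one-vertex located neutral single) where open Inv inv
  ... | inj₂ (x , w , x∈ , w∈ , w≢x) = lem {P = Parallel es} >>= λ where
      (yes (x , y , es′ , x≢y , p)) →
        contractParallel (λ {U′ es′ st′} lt → rec (subst (measure U′ es′ st′ <_) (sym (measure-≈ U p id-st)) lt))
          (Inv-≈ p id-st inv) x≢y >>= λ sol → return (Sol-≈ (≈.sym p) sol)
      (no np) → lem {P = Critical U es st β} >>= λ where
        (yes (C , u , v , w , u∈ , v∈ , u≢v , Cu , Cv , w∈ , Cw , cap)) →
          contractCritical rec inv C u∈ v∈ u≢v Cu Cv w∈ Cw cap
        (no ¬critical) → noncritical (λ x≢y p → np (_ , _ , _ , x≢y , p))
          (λ C u∈ v∈ u≢v Cu Cv w∈ Cw cap → ¬critical (C , _ , _ , _ , u∈ , v∈ , u≢v , Cu , Cv , w∈ , Cw , cap))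
    where
    id-st : st ↭ st
    id-st = ↭-refl
    noncritical : NoParallel es → NonCritical U es st β → ¬ ¬ Sol U es st β
    noncritical np nc =
      lem {P = ∃ λ v → v ∈ U × ¬ Cap (deg es st (is v)) (chg (is v) β)} >>= λ where
        (yes (v , v∈ , ¬cap)) → let z , z∈ , z≢v = another x∈ w∈ w≢x v in
          AtVertex.liftNonCap rec inv v∈ z∈ z≢v nc np ¬cap
        (no ¬noncap) →
          lem {P = ∃ λ v → v ∈ U × deg es st (is v) ≡ 4 × chg (is v) β ≡ 0₃} >>= λ where
          (yes (v , v∈ , eq4 , chg0)) → let z , z∈ , z≢v = another x∈ w∈ w≢x v in
            AtVertex.liftFour rec inv v∈ z∈ z≢v chg0 nc np eq4
          (no ¬four) → tight st rec inv nc
            (λ {v} v∈ → decidable-stable (Cap? _ _) (λ ¬cap → ¬noncap (v , v∈ , ¬cap)))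
            (λ {v} v∈ (eq4 , chg0) → ¬four (v , v∈ , eq4 , chg0))
      where
      Cap? : ∀ d b → Dec (Cap d b)
      Cap? 0 b = yes tt
      Cap? 1 b = yes tt
      Cap? 2 b = yes tt
      Cap? 3 b = yes tt
      Cap? 4 b = yes tt
      Cap? 5 b = yes tt
      Cap? 6 b = ¬? (b ≟ 0₃)
      Cap? 7 b = b ≟ 0₃
      Cap? (8+ d) b = no λ ()
      tight : ∀ st → Rec (measure U es st) → Inv U es st β → NonCritical U es st β →
        (∀ {v} → v ∈ U → Cap (deg es st (is v)) (chg (is v) β)) →
        (∀ {v} → v ∈ U → ¬ (deg es st (is v) ≡ 4 × chg (is v) β ≡ 0₃)) → ¬ ¬ Sol U es st β
      tight []       rec inv nc capped ¬four = expose rec inv x∈ w∈ w≢x (capped x∈)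
      tight (_ ∷ st) rec inv nc capped ¬four = finish rec inv nc x∈ w∈ w≢x capped ¬four

  Inv⇒Sol : ∀ {U : List (Fin n)} {es st β} → Inv U es st β → ¬ ¬ Sol U es st β
  Inv⇒Sol {U} {es} {st} = go (suc (measure U es st)) (n<1+n _)
    where
    go : ∀ fuel {U : List (Fin n)} {es st β} → measure U es st < fuel → Inv U es st β → ¬ ¬ Sol U es st β
    go (suc fuel) lt inv = solve-step (λ lt′ → go fuel (≤-trans lt′ (≤-pred lt))) inv

-- Dense graphs

module _ {n : ℕ} where

  ecr : ∀ {k} → (Fin n → Fin k) → Edge n → ℕ
  ecr ℓ (u , v) = if does (ℓ u ≟ ℓ v) then 0 else 1

  ecut : ∀ {k} → (Fin n → Fin k) → List (Edge n) → ℕ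
  ecut ℓ = ℕ∑.∑ (ecr ℓ)

  Surjective : ∀ {k} → List (Fin n) → (Fin n → Fin k) → Set
  Surjective U ℓ = ∀ i → ∃ λ u → u ∈ U × ℓ u ≡ i

  -- The partition condition of Nash-Williams and Tutte for F(G,4) ≤ c; the fibres
  -- of ℓ are the parts.
  Dense : ℕ → List (Fin n) → List (Edge n) → Set
  Dense c U es = ∀ k (ℓ : Fin n → Fin (suc k)) → Surjective U ℓ → 4 * k ≤ ecut ℓ es + c

  Cut≥2 : List (Fin n) → List (Edge n) → Set
  Cut≥2 U es = ∀ A {u v} → u ∈ U → A u ≡ true → v ∈ U → A v ≡ false → 2 ≤ cut A es

  ecr-~ : ∀ {k} (ℓ : Fin n → Fin k) {e d} → e ~ d → ecr ℓ e ≡ ecr ℓ d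
  ecr-~ ℓ (inj₁ refl) = refl
  ecr-~ ℓ {d = u , v} (inj₂ refl) with ℓ v ≟ ℓ u | ℓ u ≟ ℓ v
  ... | yes _  | yes _ = refl
  ... | no _   | no _  = refl
  ... | yes eq | no ≢  = contradiction (sym eq) ≢
  ... | no ≢   | yes eq = contradiction (sym eq) ≢

  ecut-≈ : ∀ {k} (ℓ : Fin n → Fin k) {es fs} → es ≈ fs → ecut ℓ es ≡ ecut ℓ fs
  ecut-≈ ℓ = ℕ∑.∑-↭ (ecr-~ ℓ)

  Dense-≈ : ∀ {c U es fs} → es ≈ fs → Dense c U es → Dense c U fs
  Dense-≈ {c} p dense k ℓ sur = subst (λ e → 4 * k ≤ e + c) (ecut-≈ ℓ p) (dense k ℓ sur)

  Dense-mono : ∀ {c d U es} → c ≤ d → Dense c U es → Dense d U es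
  Dense-mono c≤d dense k ℓ sur = ≤-trans (dense k ℓ sur) (+-monoʳ-≤ _ c≤d)

  does-injective : ∀ {k l} {f : Fin k → Fin l} → (∀ {a b} → f a ≡ f b → a ≡ b) →
                   ∀ a b → does (f a ≟ f b) ≡ does (a ≟ b)
  does-injective {f = f} inj a b with a ≟ b
  ... | yes refl = dec-true (f a ≟ f a) refl
  ... | no a≢b   = dec-false (f a ≟ f b) (λ eq → a≢b (inj eq))

  side : VSet n → Fin n → Fin 2
  side A v = if A v then zero else suc zero

  ecr-side : ∀ A e → ecr (side A) e ≡ cr A e
  ecr-side A (u , v) with A u | A v
  ... | true  | true  = refl
  ... | true  | false = refl
  ... | false | true  = refl
  ... | false | false = refl

  Dense⇒cut : ∀ {c U es} → Dense c U es → ∀ A {u v} → u ∈ U → A u ≡ true → v ∈ U → A v ≡ false →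
              4 ≤ cut A es + c
  Dense⇒cut {c} {U} {es} dense A {u} {v} u∈ Au v∈ Av =
    subst (λ e → 4 ≤ e + c) (ℕ∑.∑-cong (ecr-side A) es) (dense 1 (side A) λ where
      zero       → u , u∈ , cong (if_then zero else suc zero) Au
      (suc zero) → v , v∈ , cong (if_then zero else suc zero) Av)

  -- The reason for asking deficit 2 of a part: bipartitions then have 4 - 2 crossing edges, so no
  -- separate argument against bridges is called for.
  Dense⇒Cut≥2 : ∀ {U es} → Dense 2 U es → Cut≥2 U es
  Dense⇒Cut≥2 {es = es} dense A u∈ Au v∈ Av = +-cancelʳ-≤ 2 2 _ (Dense⇒cut {es = es} dense A u∈ Au v∈ Av)

  module _ (A : VSet n) {i j : ℕ} (ℓ : Fin n → Fin (suc i)) (ℓ′ : Fin n → Fin (suc j)) where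

    private
      pick : Bool → Fin n → Fin (suc i) ⊎ Fin (suc j)
      pick a v = if a then inj₁ (ℓ v) else inj₂ (ℓ′ v)

      join-injective : ∀ {x y} → join (suc i) (suc j) x ≡ join (suc i) (suc j) y → x ≡ y
      join-injective {x} {y} eq = trans (sym (splitAt-join (suc i) (suc j) x))
        (trans (cong (splitAt (suc i)) eq) (splitAt-join (suc i) (suc j) y))

    refine : Fin n → Fin (suc i + suc j)
    refine v = join (suc i) (suc j) (pick (A v) v)

    ecut-refine : ∀ es → ecut refine es ≡ (ecut ℓ (es ∣ₑ A) + ecut ℓ′ (es ∣ₑ ∁ A)) + cut A es
    ecut-refine es = begin
      ecut refine es
        ≡⟨ ℕ∑.∑-cong edgewise es ⟩
      ℕ∑.∑ (λ e → (in₁ e + in₂ e) + cr A e) es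
        ≡⟨ ℕ∑.∑-∙ (λ e → in₁ e + in₂ e) (cr A) es ⟩
      ℕ∑.∑ (λ e → in₁ e + in₂ e) es + cut A es
        ≡⟨ cong (_+ cut A es) (ℕ∑.∑-∙ in₁ in₂ es) ⟩
      (ℕ∑.∑ in₁ es + ℕ∑.∑ in₂ es) + cut A es
        ≡⟨ cong (_+ cut A es) (cong₂ _+_ (ℕ∑.∑-filter (ecr ℓ) _ es) (ℕ∑.∑-filter (ecr ℓ′) _ es)) ⟨
      (ecut ℓ (es ∣ₑ A) + ecut ℓ′ (es ∣ₑ ∁ A)) + cut A es ∎
      where
      open ≡-Reasoning
      in₁ in₂ : Edge n → ℕ
      in₁ e = if does (inside? A e) then ecr ℓ e else 0
      in₂ e = if does (inside? (∁ A) e) then ecr ℓ′ e else 0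
      edgewise : ∀ e → ecr refine e ≡ (in₁ e + in₂ e) + cr A e
      edgewise (u , v) with A u | A v
      ... | true | true = trans
        (cong (if_then 0 else 1) (does-injective (λ eq → inj₁-injective (join-injective eq)) (ℓ u) (ℓ v)))
        (sym (trans (+-identityʳ _) (+-identityʳ _)))
      ... | true | false = cong (if_then 0 else 1)
        (dec-false (join (suc i) (suc j) (inj₁ (ℓ u)) ≟ join (suc i) (suc j) (inj₂ (ℓ′ v))) (λ eq → inj₁≢inj₂ (join-injective eq)))
        where
        inj₁≢inj₂ : ∀ {x : Fin (suc i)} {y : Fin (suc j)} → inj₁ x ≢ inj₂ y
        inj₁≢inj₂ ()
      ... | false | true = cong (if_then 0 else 1)
        (dec-false (join (suc i) (suc j) (inj₂ (ℓ′ u)) ≟ join (suc i) (suc j) (inj₁ (ℓ v))) (λ eq → inj₂≢inj₁ (join-injective eq)))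
        where
        inj₂≢inj₁ : ∀ {x : Fin (suc i)} {y : Fin (suc j)} → inj₂ y ≢ inj₁ x
        inj₂≢inj₁ ()
      ... | false | false = trans
        (cong (if_then 0 else 1) (does-injective (λ eq → inj₂-injective (join-injective eq)) (ℓ′ u) (ℓ′ v)))
        (sym (+-identityʳ _))

    refine-bound : ∀ {c U es} → Dense c U es → Surjective (U ∣ᵥ A) ℓ → Surjective (U ∣ᵥ ∁ A) ℓ′ →
      4 * (i + suc j) ≤ ((ecut ℓ (es ∣ₑ A) + ecut ℓ′ (es ∣ₑ ∁ A)) + cut A es) + c
    refine-bound {c} {U} {es} dense sur sur′ =
      subst (λ e → 4 * (i + suc j) ≤ e + c) (ecut-refine es) (dense (i + suc j) refine surjective)
      where
      surjective : Surjective U refine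
      surjective f with splitAt (suc i) f in eq
      ... | inj₁ x = let u , u∈ , ℓu = sur x ; u∈U , Au = ∈-restrict⁻ A {U} u∈ in
        u , u∈U , trans (cong (λ a → join (suc i) (suc j) (pick a u)) Au)
          (trans (cong (join (suc i) (suc j)) (trans (cong inj₁ ℓu) (sym eq))) (join-splitAt (suc i) (suc j) f))
      ... | inj₂ y = let u , u∈ , ℓu = sur′ y ; u∈U , Au = ∈-restrict⁻ (∁ A) {U} u∈ in
        u , u∈U , trans (cong (λ a → join (suc i) (suc j) (pick a u)) (Bool.not-injective Au))
          (trans (cong (join (suc i) (suc j)) (trans (cong inj₂ ℓu) (sym eq))) (join-splitAt (suc i) (suc j) f))

  ecut-trivial : ∀ (ℓ : Fin n → Fin 1) es → ecut ℓ es ≡ 0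
  ecut-trivial ℓ es = trans (ℕ∑.∑-cong edgewise es) (ℕ∑.∑-ε es)
    where
    edgewise : ∀ e → ecr ℓ e ≡ 0
    edgewise (u , v) with ℓ u | ℓ v
    ... | zero | zero = refl

  -- The vertex `x` is appended as one more part, which raises the required number by 4 and
  -- contributes the degree of `x`.
  without-bound : ∀ {c U es x} → Dense c U es → x ∈ U →
    ∀ k (ℓ : Fin n → Fin (suc k)) → Surjective (U ∣ᵥ ∁ (is x)) ℓ →
    4 * k + 4 ≤ (ecut ℓ (es ∣ₑ ∁ (is x)) + cut (is x) es) + c
  without-bound {c} {U} {es} {x} dense x∈ k ℓ sur = subst₂ _≤_
    (trans (cong (4 *_) (+-comm k 1)) (trans (*-suc 4 k) (+-comm 4 (4 * k))))
    (cong₂ (λ a b → (a + b) + c)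
      (trans (cong (ecut ℓ (es ∣ₑ ∁ (is x)) +_) (ecut-trivial (λ _ → zero) (es ∣ₑ ∁ (∁ (is x))))) (+-identityʳ _))
      (cut-∁ (is x) es))
    (refine-bound (∁ (is x)) ℓ (λ _ → zero) {c} {U} {es} dense sur λ where
      zero → x , ∈-filter⁺ (member? _) x∈ (cong (not ∘ not) (is-refl x)) , refl)

  -- A partition of `A` into i + 1 parts with at most 4i - 3 crossing edges combines with any
  -- partition of the other side into j + 1 parts. The whole needs 4(i + j + 1) - 3 crossing edges,
  -- and with at most 5 of them in the cut, at least 4j - 1 are left for the other side.
  Dense-split : ∀ {U es} A → Dense 3 U es → cut A es ≤ 5 →
    ¬ ¬ (Dense 2 (U ∣ᵥ A) (es ∣ₑ A) ⊎ Dense 2 (U ∣ᵥ ∁ A) (es ∣ₑ ∁ A))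
  Dense-split {U} {es} A dense d≤5 =
    lem {P = ∃₂ λ i (ℓ : Fin n → Fin (suc i)) → Surjective (U ∣ᵥ A) ℓ × ecut ℓ (es ∣ₑ A) + 2 < 4 * i} >>= λ where
      (no dense-in) → return (inj₁ λ i ℓ sur →
        decidable-stable (4 * i ≤? ecut ℓ (es ∣ₑ A) + 2) (λ ≰ → dense-in (i , ℓ , sur , ≰⇒> ≰)))
      (yes (i , ℓ , sur , lt)) → return (inj₂ λ j ℓ′ sur′ →
        +-cancelˡ-≤ (4 * i + 4) _ _ (begin
          (4 * i + 4) + 4 * j
            ≡⟨ solve 2 (λ i j → (con 4 :* i :+ con 4) :+ con 4 :* j := con 4 :* (i :+ (con 1 :+ j))) refl i j ⟩
          4 * (i + suc j)
            ≤⟨ refine-bound A ℓ ℓ′ {3} {U} {es} dense sur sur′ ⟩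
          ((ecut ℓ (es ∣ₑ A) + ecut ℓ′ (es ∣ₑ ∁ A)) + cut A es) + 3
            ≤⟨ +-monoˡ-≤ 3 (+-monoʳ-≤ (ecut ℓ (es ∣ₑ A) + ecut ℓ′ (es ∣ₑ ∁ A)) d≤5) ⟩
          ((ecut ℓ (es ∣ₑ A) + ecut ℓ′ (es ∣ₑ ∁ A)) + 5) + 3
            ≡⟨ solve 2 (λ a b → ((a :+ b) :+ con 5) :+ con 3 := (con 1 :+ (a :+ con 2)) :+ (b :+ con 5)) refl
                 (ecut ℓ (es ∣ₑ A)) _ ⟩
          suc (ecut ℓ (es ∣ₑ A) + 2) + (ecut ℓ′ (es ∣ₑ ∁ A) + 5)
            ≤⟨ +-monoˡ-≤ _ lt ⟩
          4 * i + (ecut ℓ′ (es ∣ₑ ∁ A) + 5)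
            -- The deficit reached is 1; one unit is given up to arrive at `Dense 2`.
            ≤⟨ +-monoʳ-≤ (4 * i) (+-monoʳ-≤ (ecut ℓ′ (es ∣ₑ ∁ A)) (n≤1+n 5)) ⟩
          4 * i + (ecut ℓ′ (es ∣ₑ ∁ A) + 6)
            ≡⟨ solve 2 (λ a b → a :+ (b :+ con 6) := (a :+ con 4) :+ (b :+ con 2)) refl (4 * i) _ ⟩
          (4 * i + 4) + (ecut ℓ′ (es ∣ₑ ∁ A) + 2) ∎))
    where
    open ≤-Reasoning
    open +-*-Solver

  -- Any further split of the part of y refines ℓ to a partition of the whole
  -- graph, where the density must make up for the deficit of ℓ.
  sparse-part : ∀ {U es x y k} (ℓ : Fin n → Fin (suc k)) → Dense 3 U es → x ∈ U →
    Surjective (U ∣ᵥ ∁ (is x)) ℓ → cut (is x) es ≤ 5 →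
    ecut ℓ (es ∣ₑ ∁ (is x)) + 4 ≤ 4 * k →
    let C = ∁ (is x) ∩ (λ v → does (ℓ y ≟ ℓ v)) in Dense 0 (U ∣ᵥ C) (es ∣ₑ C)
  sparse-part {U} {es} {x} {y} {k} ℓ dense x∈ sur d≤5 sparse i ℓC surC =
    +-cancelˡ-≤ (4 * k + 4) _ _ (begin
      (4 * k + 4) + 4 * i
        ≡⟨ solve 2 (λ k i → (con 4 :* k :+ con 4) :+ con 4 :* i := con 4 :* (i :+ (con 1 :+ k))) refl k i ⟩
      4 * (i + suc k)
        ≤⟨ refine-bound C ℓC others {3} {U} {es} dense surC surOthers ⟩
      ((ecut ℓC (es ∣ₑ C) + ecut others (es ∣ₑ ∁ C)) + cut C es) + 3
        ≡⟨ cong (_+ 3) (+-assoc (ecut ℓC (es ∣ₑ C)) _ _) ⟩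
      (ecut ℓC (es ∣ₑ C) + (ecut others (es ∣ₑ ∁ C) + cut C es)) + 3
        ≡⟨ cong (λ a → (ecut ℓC (es ∣ₑ C) + a) + 3) counted ⟩
      (ecut ℓC (es ∣ₑ C) + (ecut ℓ (es ∣ₑ ∁ (is x)) + cut (is x) es)) + 3
        ≤⟨ +-monoˡ-≤ 3 (+-monoʳ-≤ (ecut ℓC (es ∣ₑ C)) (+-monoʳ-≤ (ecut ℓ (es ∣ₑ ∁ (is x))) d≤5)) ⟩
      (ecut ℓC (es ∣ₑ C) + (ecut ℓ (es ∣ₑ ∁ (is x)) + 5)) + 3
        ≡⟨ solve 2 (λ a b → (a :+ (b :+ con 5)) :+ con 3 := ((b :+ con 4) :+ con 4) :+ a) refl
             (ecut ℓC (es ∣ₑ C)) _ ⟩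
      ((ecut ℓ (es ∣ₑ ∁ (is x)) + 4) + 4) + ecut ℓC (es ∣ₑ C)
        ≤⟨ +-monoˡ-≤ (ecut ℓC (es ∣ₑ C)) (+-monoˡ-≤ 4 sparse) ⟩
      (4 * k + 4) + ecut ℓC (es ∣ₑ C)
        ≡⟨ cong ((4 * k + 4) +_) (+-identityʳ _) ⟨
      (4 * k + 4) + (ecut ℓC (es ∣ₑ C) + 0) ∎)
    where
    open ≤-Reasoning
    open +-*-Solver
    C : VSet n
    C = ∁ (is x) ∩ (λ v → does (ℓ y ≟ ℓ v))
    -- Outside `C` the class zero is `x` alone, which takes over the index freed by the part of `y`;
    -- on `C` itself the value zero is only a default.
    others : Fin n → Fin (suc k)
    others v with x ≟ v | ℓ y ≟ ℓ v
    ... | yes _ | _      = zero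
    ... | no _  | yes _  = zero
    ... | no _  | no y≢v = suc (punchOut y≢v)
    surOthers : Surjective (U ∣ᵥ ∁ C) others
    surOthers zero = x , ∈-filter⁺ (member? _) x∈ x∉C , at-x
      where
      x∉C : ∁ C x ≡ true
      x∉C rewrite is-refl x = refl
      at-x : others x ≡ zero
      at-x with x ≟ x
      ... | yes _  = refl
      ... | no x≢x = contradiction refl x≢x
    surOthers (suc f) with u , u∈ , ℓu ← sur (punchIn (ℓ y) f) =
      u , ∈-filter⁺ (member? _) u∈U u∉C , at-u
      where
      u∈U = proj₁ (∈-restrict⁻ (∁ (is x)) {U} u∈)
      ∁u = proj₂ (∈-restrict⁻ (∁ (is x)) {U} u∈)
      u∉C : ∁ C u ≡ true
      u∉C rewrite ℓu | dec-false (ℓ y ≟ punchIn (ℓ y) f) (λ eq → punchInᵢ≢i (ℓ y) f (sym eq)) =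
        cong not (Bool.∧-zeroʳ (not (is x u)))
      at-u : others u ≡ suc f
      at-u with x ≟ u | ℓ y ≟ ℓ u
      ... | yes x≡u | _      = contradiction x≡u (≢-from {x = x} {u} (Bool.not-injective ∁u))
      ... | no _  | yes eq   = contradiction (trans (sym ℓu) (sym eq)) (punchInᵢ≢i (ℓ y) f)
      ... | no _  | no y≢u   = cong suc (unpunch y≢u ℓu)
        where
        unpunch : ∀ {a} (≢ : ℓ y ≢ a) → a ≡ punchIn (ℓ y) f → punchOut ≢ ≡ f
        unpunch ≢ refl = trans (punchOut-cong (ℓ y) refl) (punchOut-punchIn (ℓ y))
    counted : ecut others (es ∣ₑ ∁ C) + cut C es ≡ ecut ℓ (es ∣ₑ ∁ (is x)) + cut (is x) es
    counted = begin-equality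
      ecut others (es ∣ₑ ∁ C) + cut C es
        ≡⟨ cong (_+ cut C es) (ℕ∑.∑-filter (ecr others) _ es) ⟩
      ℕ∑.∑ (λ e → if does (inside? (∁ C) e) then ecr others e else 0) es + cut C es
        ≡⟨ ℕ∑.∑-∙ _ (cr C) es ⟨
      ℕ∑.∑ (λ e → (if does (inside? (∁ C) e) then ecr others e else 0) + cr C e) es
        ≡⟨ ℕ∑.∑-cong edgewise es ⟩
      ℕ∑.∑ (λ e → (if does (inside? (∁ (is x)) e) then ecr ℓ e else 0) + cr (is x) e) es
        ≡⟨ ℕ∑.∑-∙ _ (cr (is x)) es ⟩
      ℕ∑.∑ (λ e → if does (inside? (∁ (is x)) e) then ecr ℓ e else 0) es + cut (is x) es
        ≡⟨ cong (_+ cut (is x) es) (ℕ∑.∑-filter (ecr ℓ) _ es) ⟨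
      ecut ℓ (es ∣ₑ ∁ (is x)) + cut (is x) es ∎
      where
      edgewise : ∀ e → (if does (inside? (∁ C) e) then ecr others e else 0) + cr C e ≡
                       (if does (inside? (∁ (is x)) e) then ecr ℓ e else 0) + cr (is x) e
      edgewise (u , v) with x ≟ u | x ≟ v | ℓ y ≟ ℓ u | ℓ y ≟ ℓ v
      ... | yes _ | yes _ | _ | _ = refl
      ... | yes _ | no _  | _ | yes _ = refl
      ... | yes _ | no _  | _ | no _  = refl
      ... | no _  | yes _ | yes _ | _ = refl
      ... | no _  | yes _ | no _  | _ = refl
      ... | no _  | no _  | yes yu | yes yv rewrite dec-true (ℓ u ≟ ℓ v) (trans (sym yu) yv) = refl
      ... | no _  | no _  | yes yu | no yv
        rewrite dec-false (ℓ u ≟ ℓ v) (λ eq → yv (trans yu eq)) = refl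
      ... | no _  | no _  | no yu | yes yv
        rewrite dec-false (ℓ u ≟ ℓ v) (λ eq → yu (trans yv (sym eq))) = refl
      ... | no _  | no _  | no yu | no yv with ℓ u ≟ ℓ v
      ...   | no ≢ rewrite dec-false (punchOut yu ≟ punchOut yv) (λ eq → ≢ (punchOut-injective yu yv eq)) = refl
      ...   | yes eq rewrite dec-true (punchOut yu ≟ punchOut yv) (punchOut-cong (ℓ y) eq) = refl

-- Dense graphs without bridges are ℤ₃-connected

module _ {n : ℕ} where

  -- Stubs are included so that the statement applies directly to a part whose boundary has already
  -- been directed.
  ℤ₃Conn : List (Fin n) → List (Edge n) → Set
  ℤ₃Conn U es = ∀ {st β} → Located U es st β → σ full st ≡ chg full β → ¬ ¬ Sol U es st β

  record PInv (U : List (Fin n)) (es : List (Edge n)) : Set where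
    field
      ends∈ : EndsIn U es
      dense : Dense 3 U es
      cut≥2 : Cut≥2 U es

  PRec : ℕ → Set
  PRec m = ∀ {U es} → length U < m → PInv U es → ℤ₃Conn U es

  restrict-PInv : ∀ C {U es} → EndsIn U es →
                  Dense 2 (U ∣ᵥ C) (es ∣ₑ C) → PInv (U ∣ᵥ C) (es ∣ₑ C)
  restrict-PInv C {U} {es} e∈ dense = record
    { ends∈ = restrict-ends C e∈
    ; dense = Dense-mono {U = U ∣ᵥ C} {es ∣ₑ C} (n≤1+n 2) dense
    ; cut≥2 = Dense⇒Cut≥2 {U = U ∣ᵥ C} {es ∣ₑ C} dense }

  module _ (C : VSet n) (a : Fin n) (Ca : C a ≡ true) where

    private ρ = contract C a Ca

    contract-PInv : ∀ {U es} → a ∈ U → PInv U es → PInv (remaining C a Ca U) (map (contractₑ C a Ca) es)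
    contract-PInv {U} {es} a∈ pinv = record
      { ends∈ = All.map⁺ (All.map (λ (p , q) → contract-∈ C a Ca a∈ p , contract-∈ C a Ca a∈ q) ends∈)
      ; dense = λ k ℓ sur → subst (λ e → 4 * k ≤ e + 3) (sym (ℕ∑.∑-map (ecr ℓ) _ es))
          (dense k (ℓ ∘ ρ) λ i → let u , u∈ , ℓu = sur i ; u∈U , fixed = remaining⁻ C a Ca {U} u∈ in
             u , u∈U , trans (cong ℓ fixed) ℓu)
      ; cut≥2 = λ A u∈ Au v∈ Av → subst (2 ≤_) (sym (ℕ∑.∑-map (cr A) _ es))
          (cut≥2 (A ∘ ρ) (proj₁ (remaining⁻ C a Ca {U} u∈)) (remaining-fixed C a Ca A {U} u∈ Au)
                         (proj₁ (remaining⁻ C a Ca {U} v∈)) (remaining-fixed C a Ca A {U} v∈ Av))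
      } where open PInv pinv

    contract-conn : ∀ {U es b} → PRec (length U) → PInv U es → a ∈ U → b ∈ U → C b ≡ true → b ≢ a →
      ∀ {st β} → Located U es st β → σ full st ≡ chg full β → ¬ ¬ QuotientSol C U es st β
    contract-conn {U} {es} rec pinv a∈ b∈ Cb b≢a {st} {β} loc neutral =
      rec (length-remaining C a Ca b∈ Cb b≢a) (contract-PInv a∈ pinv)
          (contract-Located C a Ca a∈ loc)
          (trans (ℤ₃∑.∑-map (sg full) _ st) (trans neutral (sym (ℤ₃∑.∑-map (ch full) _ β)))) >>= λ sol →
      return (quotientSol C a Ca a∈ sol)

  restrict-conn : ∀ {C U es st β} → ℤ₃Conn (U ∣ᵥ C) (es ∣ₑ C) → Located U es st β →
                  QuotientSol C U es st β → ¬ ¬ Sol U es st β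
  restrict-conn conn loc q =
    conn (Restrict.located q loc) (Restrict.charge-zero q) >>= λ sol → return (Restrict.extend q sol)

  -- Two edges at `x` suffice to balance it, all its edges become stubs of the rest, and `ℤ₃Conn`
  -- accepts any stubs.
  removeVertex : ∀ {x U es} → 2 ≤ cut (is x) es →
    ℤ₃Conn (U ∣ᵥ ∁ (is x)) (es ∣ₑ ∁ (is x)) → ℤ₃Conn U es
  removeVertex {x} {U} {es} 2≤d conn {st} {β} loc neutral with cut (is x) es in eqc | 2≤d
  ... | suc zero    | s≤s ()
  ... | suc (suc c) | _
    with y₁ , es₁ , p₁ , i₁ , eq₁ ← pull-at x es eqc
    with y₂ , es₂ , p₂ , i₂ , eq₂ ← pull-at x es₁ eq₁
    with ds , pw , eq ← orient-at (≢-from {x = x} {y₁} i₁) (≢-from {x = x} {y₂} i₂)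
                          (p₁ ⨟ prep ~.refl p₂) (chg (is x) β ⊕ ⊝ σ (is x) st) =
    restrict-conn conn loc (removalSol {x = x} {U} {st = st} {β} ds pw neutral
      (trans (cong (_⊕ σ (is x) st) eq) (⊕-⊝-cancel (chg (is x) β) (σ (is x) st))))

  -- Each edge is counted twice by the two sets unless it is incident with x.
  cut-without : ∀ A x (es : List (Edge n)) → cut (A ∩ ∁ (is x)) es + cut (A ∪ is x) es ≡
    (cut A (es ∣ₑ ∁ (is x)) + cut A (es ∣ₑ ∁ (is x))) + cut (is x) es
  cut-without A x es = begin
    cut (A ∩ ∁ (is x)) es + cut (A ∪ is x) es
      ≡⟨ ℕ∑.∑-∙ _ _ es ⟨
    ℕ∑.∑ (λ e → cr (A ∩ ∁ (is x)) e + cr (A ∪ is x) e) es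
      ≡⟨ ℕ∑.∑-cong edgewise es ⟩
    ℕ∑.∑ (λ e → (m e + m e) + cr (is x) e) es
      ≡⟨ trans (ℕ∑.∑-∙ _ _ es) (cong (_+ cut (is x) es) (ℕ∑.∑-∙ m m es)) ⟩
    (ℕ∑.∑ m es + ℕ∑.∑ m es) + cut (is x) es
      ≡⟨ cong (λ a → (a + a) + cut (is x) es) (ℕ∑.∑-filter (cr A) _ es) ⟨
    (cut A (es ∣ₑ ∁ (is x)) + cut A (es ∣ₑ ∁ (is x))) + cut (is x) es ∎
    where
    open ≡-Reasoning
    m : Edge n → ℕ
    m e = if does (inside? (∁ (is x)) e) then cr A e else 0
    edgewise : ∀ e → cr (A ∩ ∁ (is x)) e + cr (A ∪ is x) e ≡ (m e + m e) + cr (is x) e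
    edgewise (u , v) with x ≟ u | x ≟ v | A u | A v
    ... | yes _ | yes _ | true  | true  = refl
    ... | yes _ | yes _ | true  | false = refl
    ... | yes _ | yes _ | false | true  = refl
    ... | yes _ | yes _ | false | false = refl
    ... | yes _ | no _  | true  | true  = refl
    ... | yes _ | no _  | true  | false = refl
    ... | yes _ | no _  | false | true  = refl
    ... | yes _ | no _  | false | false = refl
    ... | no _  | yes _ | true  | true  = refl
    ... | no _  | yes _ | true  | false = refl
    ... | no _  | yes _ | false | true  = refl
    ... | no _  | yes _ | false | false = refl
    ... | no _  | no _  | true  | true  = refl
    ... | no _  | no _  | true  | false = refl
    ... | no _  | no _  | false | true  = refl
    ... | no _  | no _  | false | false = refl

  residual : List (Stub n) → List (Charge n)
  residual = map λ (v , s) → v , sgn (not s)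

  chg-residual : ∀ A st → chg A (residual st) ⊕ σ A st ≡ 0₃
  chg-residual A []             = refl
  chg-residual A ((v , s) ∷ st) = trans (ℤ₃∑.interchange (ch A (v , sgn (not s))) (chg A (residual st)) (sg A (v , s)) (σ A st))
    (cong₂ _⊕_ (opposite (A v) s) (chg-residual A st))
    where
    opposite : ∀ a s → (if a then sgn (not s) else 0₃) ⊕ (if a then sgn s else 0₃) ≡ 0₃
    opposite true  true  = refl
    opposite true  false = refl
    opposite false s     = refl

  chg-with-residual : ∀ A st β → chg A (β ++ residual st) ⊕ σ A st ≡ chg A β
  chg-with-residual A st β = trans (cong (_⊕ σ A st) (ℤ₃∑.∑-++ (ch A) β (residual st)))
    (trans (⊕-assoc (chg A β) _ _) (trans (cong (chg A β ⊕_) (chg-residual A st)) (⊕-identityʳ _)))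

  -- The stubs are absorbed into the charges. This leaves z₀ with degree 0, where the cap holds, and
  -- six edges across a cut make every residue good.
  highly-connected : ∀ {U : List (Fin n)} {es} →
    (∀ A {u v} → u ∈ U → A u ≡ true → v ∈ U → A v ≡ false → 6 ≤ cut A es) → ℤ₃Conn U es
  highly-connected {U} {es} cuts {st} {β} (e∈ , s∈ , b∈) neutral =
    Inv⇒Sol inv >>= λ (mkSol ds pw bal) → return (mkSol ds pw λ {v} v∈ →
      trans (cong (_⊕ σ (is v) st) (trans (sym (⊕-identityʳ _)) (bal v∈))) (chg-with-residual (is v) st β))
    where
    inv : Inv U es [] (β ++ residual st)
    inv = record
      { located = e∈ , [] , All.++⁺ b∈ (All.map⁺ s∈)
      ; good    = λ A u∈ Au v∈ Av → ≥6⇒good (≤-trans (cuts A u∈ Au v∈ Av) (m≤m+n _ 0))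
      ; cap     = tt
      ; neutral = ⊕-cancelʳ 0₃ _ (σ full st) (trans neutral (sym (chg-with-residual full st β)))
      }

  private
    DensePart : List (Fin n) → List (Edge n) → Set
    DensePart U es = ∃ λ C → ∃₂ λ u v → ∃ λ w → u ∈ U × v ∈ U × v ≢ u × C u ≡ true × C v ≡ true ×
      w ∈ U × C w ≡ false × Dense 2 (U ∣ᵥ C) (es ∣ₑ C)

    ParallelPair : List (Edge n) → Set
    ParallelPair es = ∃₂ λ x y → ∃ λ es′ → x ≢ y × es ≈ (x , y) ∷ (x , y) ∷ es′

  contractDense : ∀ {U es} → PRec (length U) → PInv U es → DensePart U es → ℤ₃Conn U es
  contractDense {U} {es} rec pinv (C , u , v , w , u∈ , v∈ , v≢u , Cu , Cv , w∈ , Cw , dense) loc neutral =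
    contract-conn C u Cu rec pinv u∈ v∈ Cv v≢u loc neutral >>=
    restrict-conn (rec (length-∣ᵥ C w∈ Cw) (restrict-PInv C (PInv.ends∈ pinv) dense)) loc

  contractPair : ∀ {U es} → PRec (length U) → PInv U es → ParallelPair es → ℤ₃Conn U es
  contractPair {U} {es} rec pinv (x , y , es′ , x≢y , p) {st} {β} (e∈ , rest) neutral
    with All-≈ p e∈
  ... | e∈′@((x∈ , y∈) ∷ _) =
    contract-conn (pair x y) x (pair-left x y) rec pinv′ x∈ y∈ (pair-right x y) (λ y≡x → x≢y (sym y≡x))
      (e∈′ , rest) neutral >>= λ q →
    return (Sol-≈ (≈.sym p) (pairSol x≢y (drop (drop q))))
    where
    open PInv pinv
    drop : ∀ {es} → QuotientSol (pair x y) U ((x , y) ∷ es) st β → QuotientSol (pair x y) U es st β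
    drop = dropInside (pair-left x y) (pair-right x y)
    pinv′ : PInv U ((x , y) ∷ (x , y) ∷ es′)
    pinv′ = record
      { ends∈ = All-≈ p ends∈
      ; dense = Dense-≈ {c = 3} {U} p dense
      ; cut≥2 = λ A u∈ Au v∈ Av → subst (2 ≤_) (cut-≈ A p) (cut≥2 A u∈ Au v∈ Av) }

  module _ {U : List (Fin n)} {es : List (Edge n)} (rec : PRec (length U)) (pinv : PInv U es)
           (¬dense : ¬ DensePart U es) where
    open PInv pinv

    -- If both sides of a small cut had two vertices, `Dense-split` would exhibit a dense part. The
    -- bound is applied with 4 before vertices of degree 4 and 5 are treated, and with 6 after them.
    large-cuts : ∀ {m} → m ≤ 6 → (∀ {x} → x ∈ U → m ≤ cut (is x) es) →
      ∀ A {u v} → u ∈ U → A u ≡ true → v ∈ U → A v ≡ false → m ≤ cut A es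
    large-cuts {m} m≤6 singles A {u} {v} u∈ Au v∈ Av
      with second-or-single A U Au | second-or-single (∁ A) U (cong not Av)
    ... | inj₂ agree | _ = subst (m ≤_) (sym (cut-agree ends∈ agree)) (singles u∈)
    ... | inj₁ _ | inj₂ agree =
      subst (m ≤_) (trans (sym (cut-agree ends∈ agree)) (cut-∁ A es)) (singles v∈)
    ... | inj₁ (u′ , u′∈ , u≢u′ , Au′) | inj₁ (v′ , v′∈ , v≢v′ , Av′) =
      ≤-trans m≤6 (≰⇒> λ d≤5 → Dense-split {es = es} A dense d≤5 λ where
        (inj₁ dA) → ¬dense (A , u , u′ , v , u∈ , u′∈ , (λ eq → u≢u′ (sym eq)) , Au , Au′ , v∈ , Av , dA)
        (inj₂ dB) → ¬dense (∁ A , v , v′ , u , v∈ , v′∈ , (λ eq → v≢v′ (sym eq)) , cong not Av , Av′ ,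
                            u∈ , cong not Au , dB))

    -- The deficit drops to 3 + 3 - 4 = 2, from which `restrict-PInv` draws the cut condition as
    -- well.
    removeSmall : ∀ {x z} → x ∈ U → z ∈ U → z ≢ x → cut (is x) es ≤ 3 → ℤ₃Conn U es
    removeSmall {x} {z} x∈ z∈ z≢x d≤3 =
      removeVertex {x} (cut≥2 (is x) x∈ (is-refl x) z∈ (is-≢ {x = x} {z} λ eq → z≢x (sym eq)))
        (rec (length-∣ᵥ (∁ (is x)) x∈ (cong not (is-refl x))) (restrict-PInv (∁ (is x)) ends∈ dense-rest))
      where
      dense-rest : Dense 2 (U ∣ᵥ ∁ (is x)) (es ∣ₑ ∁ (is x))
      dense-rest k ℓ sur = +-cancelʳ-≤ 4 (4 * k) _ (≤-trans (without-bound {c = 3} {U} {es} dense x∈ k ℓ sur) (begin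
        (ecut ℓ (es ∣ₑ ∁ (is x)) + cut (is x) es) + 3
          ≤⟨ +-monoˡ-≤ 3 (+-monoʳ-≤ (ecut ℓ (es ∣ₑ ∁ (is x))) d≤3) ⟩
        (ecut ℓ (es ∣ₑ ∁ (is x)) + 3) + 3
          ≡⟨ solve 1 (λ a → (a :+ con 3) :+ con 3 := (a :+ con 2) :+ con 4) refl (ecut ℓ (es ∣ₑ ∁ (is x))) ⟩
        (ecut ℓ (es ∣ₑ ∁ (is x)) + 2) + 4 ∎))
        where
        open ≤-Reasoning
        open +-*-Solver

    module _ (cuts : ∀ (A : VSet n) {u v : Fin n} → u ∈ U → A u ≡ true → v ∈ U → A v ≡ false → 4 ≤ cut A es)
             {x : Fin n} (x∈ : x ∈ U) where

      -- Adding `x` to `A` or to the other side gives two cuts of the graph, each with at least 4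
      -- edges. Together they count the cut of the rest twice and the at most 5 edges at `x` once,
      -- so 8 ≤ 2c + 5.
      cut≥2-without : cut (is x) es ≤ 5 → Cut≥2 (U ∣ᵥ ∁ (is x)) (es ∣ₑ ∁ (is x))
      cut≥2-without d≤5 A {u} {v} u∈ Au v∈ Av =
        let u∈U , ∁u = ∈-restrict⁻ (∁ (is x)) {U} u∈
            v∈U , ∁v = ∈-restrict⁻ (∁ (is x)) {U} v∈ in
        half _ (≤-trans (+-mono-≤ (cuts (A ∩ ∁ (is x)) u∈U (cong₂ _∧_ Au ∁u) v∈U (∧-left Av))
                                (cuts (A ∪ is x) u∈U (cong (_∨ is x u) Au) v∈U
                                      (cong₂ _∨_ Av (Bool.not-injective ∁v))))
               (≤-trans (≤-reflexive (cut-without A x es)) (+-monoʳ-≤ _ d≤5)))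
        where
        half : ∀ c → 8 ≤ (c + c) + 5 → 2 ≤ c
        half 0 (s≤s (s≤s (s≤s (s≤s (s≤s ())))))
        half 1 (s≤s (s≤s (s≤s (s≤s (s≤s (s≤s (s≤s ())))))))
        half (suc (suc c)) _ = s≤s (s≤s z≤n)

      removeFour : cut (is x) es ≡ 4 → ℤ₃Conn U es
      removeFour d≡4 = removeVertex {x} (subst (2 ≤_) (sym d≡4) (m≤m+n 2 2))
        (rec (length-∣ᵥ (∁ (is x)) x∈ (cong not (is-refl x))) record
          { ends∈ = restrict-ends (∁ (is x)) ends∈
          ; dense = λ k ℓ sur → +-cancelʳ-≤ 4 (4 * k) _
              (≤-trans (without-bound {c = 3} {U} {es} dense x∈ k ℓ sur) (≤-reflexive
                (trans (cong (λ d → (ecut ℓ (es ∣ₑ ∁ (is x)) + d) + 3) d≡4)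
                       (solve 1 (λ a → (a :+ con 4) :+ con 3 := (a :+ con 3) :+ con 4) refl
                                (ecut ℓ (es ∣ₑ ∁ (is x)))))))
          ; cut≥2 = cut≥2-without (≤-trans (≤-reflexive d≡4) (n≤1+n 4)) })
        where open +-*-Solver

      -- The lifted edge lowers the deficit 4 to 3 unless both its ends lie in one part of a
      -- partition that is short by 4. By `sparse-part` such a part is dense, and it has two
      -- vertices because no edge is doubled. The three edges left at `x` are enough to balance it.
      liftFive : ¬ ParallelPair es → cut (is x) es ≡ 5 → ℤ₃Conn U es
      liftFive ¬parallel d≡5 {st} {β} (e∈ , rest) neutral
        with y₁ , es₁ , p₁ , i₁ , eq₁ ← pull-at x es d≡5
        with y₂ , es₂ , p₂ , i₂ , eq₂ ← pull-at x es₁ eq₁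
        with p ← p₁ ⨟ prep ~.refl p₂
        with (_ , y₁∈) ∷ (_ , y₂∈) ∷ e∈₂ ← All-≈ p e∈ =
        removeVertex {x} (subst (2 ≤_) (sym at-x) (n≤1+n 2))
          (rec (length-∣ᵥ (∁ (is x)) x∈ (cong not (is-refl x))) lifted)
          ((y₁∈ , y₂∈) ∷ e∈₂ , rest) neutral >>= λ sol →
        return (Sol-≈ (≈.sym p) (unlift-edges sol))
        where
        new : List (Edge n)
        new = (y₁ , y₂) ∷ es₂
        C : VSet n
        C = ∁ (is x)
        at-x : cut (is x) new ≡ 3
        at-x = cong₂ _+_ (cong₂ (λ a b → ⟦ a xor b ⟧) i₁ i₂) eq₂
        new∣C : new ∣ₑ C ≡ (y₁ , y₂) ∷ es₂ ∣ₑ C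
        new∣C = filter-accept (inside? C) (cong₂ (λ a b → not a ∧ not b) i₁ i₂)
        outside : ∀ y → ¬ C x ∧ C y ≡ true
        outside y ins with () ← trans (sym ins) (∧-left (cong not (is-refl x)))
        es∣C : es ∣ₑ C ≈ es₂ ∣ₑ C
        es∣C = subst (es ∣ₑ C ≈_)
          (trans (filter-reject (inside? C) (outside y₁)) (filter-reject (inside? C) (outside y₂)))
          (≈-Properties.filter⁺ (inside? C) (λ { (inj₁ refl) ins → ins
                                                ; {_} {u , v} (inj₂ refl) ins →
                                                    trans (Bool.∧-comm (C u) (C v)) ins }) p)
        y₁≢y₂ : y₂ ≢ y₁
        y₁≢y₂ refl = ¬parallel (x , y₁ , es₂ , ≢-from {x = x} {y₁} i₁ , p)
        lifted : PInv (U ∣ᵥ C) (new ∣ₑ C)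
        lifted = record
          { ends∈ = restrict-ends C ((y₁∈ , y₂∈) ∷ e∈₂)
          ; dense = dense-new
          ; cut≥2 = λ A u∈ Au v∈ Av → ≤-trans (cut≥2-without (≤-reflexive d≡5) A u∈ Au v∈ Av)
              (≤-trans (≤-reflexive (cut-≈ A es∣C))
                (≤-trans (m≤n+m _ (cr A (y₁ , y₂))) (≤-reflexive (cong (cut A) (sym new∣C)))))
          }
          where
          dense-new : Dense 3 (U ∣ᵥ C) (new ∣ₑ C)
          dense-new k ℓ sur = subst (λ es → 4 * k ≤ ecut ℓ es + 3) (sym new∣C) bound
            where
            open +-*-Solver
            E = ecut ℓ (es₂ ∣ₑ C)
            part : VSet n
            part = C ∩ (λ v → does (ℓ y₁ ≟ ℓ v))
            bound : 4 * k ≤ (ecr ℓ (y₁ , y₂) + E) + 3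
            bound with ℓ y₁ ≟ ℓ y₂
            ... | no _ = +-cancelʳ-≤ 4 (4 * k) _ (≤-trans (without-bound {c = 3} {U} {es} dense x∈ k ℓ sur)
                (≤-reflexive (trans (cong₂ (λ a d → (a + d) + 3) (ecut-≈ ℓ es∣C) d≡5)
                  (solve 1 (λ a → (a :+ con 5) :+ con 3 := ((con 1 :+ a) :+ con 3) :+ con 4) refl E))))
            ... | yes ℓ≡ = decidable-stable (4 * k ≤? E + 3) λ ≰ → ¬dense
                (part , y₁ , y₂ , x , y₁∈ , y₂∈ , y₁≢y₂ ,
                 cong₂ _∧_ (cong not i₁) (dec-true (ℓ y₁ ≟ ℓ y₁) refl) ,
                 cong₂ _∧_ (cong not i₂) (dec-true (ℓ y₁ ≟ ℓ y₂) ℓ≡) ,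
                 x∈ , ∧-left (cong not (is-refl x)) ,
                 Dense-mono {U = U ∣ᵥ part} {es ∣ₑ part} z≤n
                   (sparse-part {U = U} {es} {x} {y₁} ℓ dense x∈ sur (≤-reflexive d≡5)
                     (≤-trans (≤-reflexive (trans (cong (_+ 4) (ecut-≈ ℓ es∣C)) (+-suc E 3))) (≰⇒> ≰))))

  conn-step : ∀ {U es} → PRec (length U) → PInv U es → ℤ₃Conn U es
  conn-step {U} {es} rec pinv loc neutral with two-or-one U
  ... | inj₁ single = return (one-vertex loc neutral single)
  ... | inj₂ (x , w , x∈ , w∈ , w≢x) =
    lem {P = ParallelPair es} >>= λ where
      (yes parallel) → contractPair rec pinv parallel loc neutral
      (no ¬parallel) → lem {P = DensePart U es} >>= λ where
        (yes dense) → contractDense rec pinv dense loc neutral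
        (no ¬dense) → lem {P = ∃ λ v → v ∈ U × cut (is v) es ≤ 3} >>= λ where
          (yes (v , v∈ , d≤3)) → let z , z∈ , z≢v = another x∈ w∈ w≢x v in
            removeSmall rec pinv ¬dense v∈ z∈ z≢v d≤3 loc neutral
          (no ¬small) →
            let cuts = large-cuts rec pinv ¬dense (m≤m+n 4 2)
                         (λ {v} v∈ → ≰⇒> (λ d≤3 → ¬small (v , v∈ , d≤3))) in
            lem {P = ∃ λ v → v ∈ U × cut (is v) es ≡ 4} >>= λ where
              (yes (v , v∈ , d≡4)) → removeFour rec pinv ¬dense cuts v∈ d≡4 loc neutral
              (no ¬four) → lem {P = ∃ λ v → v ∈ U × cut (is v) es ≡ 5} >>= λ where
                (yes (v , v∈ , d≡5)) → liftFive rec pinv ¬dense cuts v∈ ¬parallel d≡5 loc neutral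
                (no ¬five) → highly-connected
                  (large-cuts rec pinv ¬dense ≤-refl (λ {v} v∈ → ≰⇒> (λ d≤5 →
                    small (cut (is v) es) d≤5 (λ d≤3 → ¬small (v , v∈ , d≤3))
                          (λ d≡4 → ¬four (v , v∈ , d≡4)) (λ d≡5 → ¬five (v , v∈ , d≡5)))))
                  loc neutral
    where
    small : ∀ d → d ≤ 5 → ¬ d ≤ 3 → d ≢ 4 → d ≢ 5 → ⊥
    small 0 _ ≰ _ _ = ≰ z≤n
    small 1 _ ≰ _ _ = ≰ (m≤m+n 1 2)
    small 2 _ ≰ _ _ = ≰ (m≤m+n 2 1)
    small 3 _ ≰ _ _ = ≰ ≤-refl
    small 4 _ _ ≢ _ = ≢ refl
    small 5 _ _ _ ≢ = ≢ refl
    small (6+ d) (s≤s (s≤s (s≤s (s≤s (s≤s ())))))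

  PInv⇒ℤ₃Conn : ∀ {U es} → PInv U es → ℤ₃Conn U es
  PInv⇒ℤ₃Conn {U} = go (suc (length U)) (n<1+n _)
    where
    go : ∀ fuel {U es} → length U < fuel → PInv U es → ℤ₃Conn U es
    go (suc fuel) lt pinv = conn-step (λ lt′ → go fuel (≤-trans lt′ (≤-pred lt))) pinv

-- Counting modulo 3

[_]₃ : ℕ → ℤ₃
[ zero ]₃  = 0₃
[ suc n ]₃ = 1₃ ⊕ [ n ]₃

[]₃-+ : ∀ m n → [ m + n ]₃ ≡ [ m ]₃ ⊕ [ n ]₃
[]₃-+ zero    n = refl
[]₃-+ (suc m) n = trans (cong (1₃ ⊕_) ([]₃-+ m n)) (sym (⊕-assoc 1₃ [ m ]₃ [ n ]₃))

[toℕ]₃ : ∀ (b : ℤ₃) → [ toℕ b ]₃ ≡ b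
[toℕ]₃ 0₃ = refl
[toℕ]₃ 1₃ = refl
[toℕ]₃ 2₃ = refl

thrice : ∀ a → 1₃ ⊕ (1₃ ⊕ (1₃ ⊕ a)) ≡ a
thrice = from-yes (all? λ a → (1₃ ⊕ (1₃ ⊕ (1₃ ⊕ a))) ≟ a)

3∣⇒[]₃ : ∀ {n} → 3 ℕ.∣ n → [ n ]₃ ≡ 0₃
3∣⇒[]₃ (ℕ.divides zero    refl) = refl
3∣⇒[]₃ (ℕ.divides (suc k) refl) = trans (thrice [ k * 3 ]₃) (3∣⇒[]₃ (ℕ.divides k refl))

[]₃⇒3∣ : ∀ n → [ n ]₃ ≡ 0₃ → 3 ℕ.∣ n
[]₃⇒3∣ 0 eq = ℕ.divides 0 refl
[]₃⇒3∣ (suc (suc (suc n))) eq with ℕ.divides k refl ← []₃⇒3∣ n (trans (sym (thrice [ n ]₃)) eq) =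
  ℕ.divides (suc k) refl

1⊕-injective : ∀ {a b} → 1₃ ⊕ a ≡ 1₃ ⊕ b → a ≡ b
1⊕-injective {a} {b} eq = ⊕-cancelʳ a b 1₃ (trans (⊕-comm a 1₃) (trans eq (⊕-comm 1₃ b)))

⊖⇒[]₃ : ∀ p q → 3 ℕ.∣ ℤ.∣ p ℤ.⊖ q ∣ → [ p ]₃ ≡ [ q ]₃
⊖⇒[]₃ zero    zero    d = refl
⊖⇒[]₃ (suc p) zero    d = 3∣⇒[]₃ d
⊖⇒[]₃ zero    (suc q) d = sym (3∣⇒[]₃ d)
⊖⇒[]₃ (suc p) (suc q) d =
  cong (1₃ ⊕_) (⊖⇒[]₃ p q (subst (λ i → 3 ℕ.∣ ℤ.∣ i ∣) (ℤ.[1+m]⊖[1+n]≡m⊖n p q) d))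

[]₃⇒⊖ : ∀ p q → [ p ]₃ ≡ [ q ]₃ → 3 ℕ.∣ ℤ.∣ p ℤ.⊖ q ∣
[]₃⇒⊖ zero    zero    eq = ℕ.divides 0 refl
[]₃⇒⊖ (suc p) zero    eq = []₃⇒3∣ (suc p) eq
[]₃⇒⊖ zero    (suc q) eq = []₃⇒3∣ (suc q) (sym eq)
[]₃⇒⊖ (suc p) (suc q) eq =
  subst (λ i → 3 ℕ.∣ ℤ.∣ i ∣) (sym (ℤ.[1+m]⊖[1+n]≡m⊖n p q)) ([]₃⇒⊖ p q (1⊕-injective eq))

⊖-minus : ∀ p q r → p ℤ.⊖ q ℤ.- ℤ.+ r ≡ p ℤ.⊖ (q + r)
⊖-minus p q r = trans (cong (λ i → i ℤ.- ℤ.+ r) (sym (ℤ.m-n≡m⊖n p q)))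
  (trans (ℤ.+-assoc (ℤ.+ p) (ℤ.- (ℤ.+ q)) (ℤ.- (ℤ.+ r)))
  (trans (cong (λ i → ℤ.+ p ℤ.+ i) (sym (ℤ.neg-distrib-+ (ℤ.+ q) (ℤ.+ r)))) (ℤ.m-n≡m⊖n p (q + r))))

≈₃⇒≡ : ∀ p q b → p ℤ.⊖ q ≈₃ b → [ p ]₃ ≡ [ q ]₃ ⊕ b
≈₃⇒≡ p q b d = trans (⊖⇒[]₃ p (q + toℕ b) (subst (λ i → 3 ℕ.∣ ℤ.∣ i ∣) (⊖-minus p q (toℕ b)) d))
  (trans ([]₃-+ q (toℕ b)) (cong ([ q ]₃ ⊕_) ([toℕ]₃ b)))

≡⇒≈₃ : ∀ p q b → [ p ]₃ ≡ [ q ]₃ ⊕ b → p ℤ.⊖ q ≈₃ b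
≡⇒≈₃ p q b eq = subst (λ i → 3 ℕ.∣ ℤ.∣ i ∣) (sym (⊖-minus p q (toℕ b)))
  ([]₃⇒⊖ p (q + toℕ b) (trans eq (sym (trans ([]₃-+ q (toℕ b)) (cong ([ q ]₃ ⊕_) ([toℕ]₃ b))))))

module ℕᶠ = VectorSum +-0-commutativeMonoid

sum≡∑ᶠ : ∀ {m} (f : Fin m → ℕ) → ℕᶠ.sum f ≡ ℕ∑.∑ᶠ f
sum≡∑ᶠ {zero}  f = refl
sum≡∑ᶠ {suc m} f = cong (f zero +_) (sum≡∑ᶠ (f ∘ suc))

[∑ᶠ]₃ : ∀ {m} (f : Fin m → ℕ) → [ ℕ∑.∑ᶠ f ]₃ ≡ ℤ₃∑.∑ᶠ ([_]₃ ∘ f)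
[∑ᶠ]₃ {zero}  f = refl
[∑ᶠ]₃ {suc m} f = trans ([]₃-+ (f zero) _) (cong ([ f zero ]₃ ⊕_) ([∑ᶠ]₃ (f ∘ suc)))

[⟦_⟧]₃ : ∀ b → [ ⟦ b ⟧ ]₃ ≡ ι b
[⟦ true ⟧]₃  = refl
[⟦ false ⟧]₃ = refl

card : ∀ {m} (f : Fin m → Bool) → Subset.∣ Vec.tabulate f ∣ ≡ ℕ∑.∑ᶠ (⟦_⟧ ∘ f)
card {zero}  f = refl
card {suc m} f with f zero
... | true  = cong suc (card (f ∘ suc))
... | false = card (f ∘ suc)

[card]₃ : ∀ {m} (f : Fin m → Bool) → [ Subset.∣ Vec.tabulate f ∣ ]₃ ≡ ℤ₃∑.∑ᶠ (ι ∘ f)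
[card]₃ f = trans (cong [_]₃ (card f)) (trans ([∑ᶠ]₃ (⟦_⟧ ∘ f)) (ℤ₃∑.∑ᶠ-cong λ i → [⟦ f i ⟧]₃))

∑ᶠ-≤ : ∀ {m} {f g : Fin m → ℕ} → (∀ i → f i ≤ g i) → ℕ∑.∑ᶠ f ≤ ℕ∑.∑ᶠ g
∑ᶠ-≤ {zero}  f≤g = z≤n
∑ᶠ-≤ {suc m} f≤g = +-mono-≤ (f≤g zero) (∑ᶠ-≤ (f≤g ∘ suc))

∑ᶠ-const : ∀ m c → ℕ∑.∑ᶠ {m} (λ _ → c) ≡ m * c
∑ᶠ-const zero    c = refl
∑ᶠ-const (suc m) c = cong (c +_) (∑ᶠ-const m c)

≤-∑ᶠ : ∀ {m} (f : Fin m → ℕ) i → f i ≤ ℕ∑.∑ᶠ f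
≤-∑ᶠ f zero    = m≤m+n (f zero) _
≤-∑ᶠ f (suc i) = ≤-trans (≤-∑ᶠ (f ∘ suc) i) (m≤n+m _ (f zero))

∑ᶠ-↑ : ∀ m {k} (f : Fin (m + k) → ℕ) → ℕ∑.∑ᶠ f ≡ ℕ∑.∑ᶠ (f ∘ (_↑ˡ k)) + ℕ∑.∑ᶠ (f ∘ (m ↑ʳ_))
∑ᶠ-↑ zero    f = refl
∑ᶠ-↑ (suc m) f = trans (cong (f zero +_) (∑ᶠ-↑ m (f ∘ suc))) (sym (+-assoc (f zero) _ _))

∑ᶠ≡0 : ∀ {m} {f : Fin m → ℕ} → ℕ∑.∑ᶠ f ≡ 0 → ∀ i → f i ≡ 0
∑ᶠ≡0 {f = f} eq zero    = m+n≡0⇒m≡0 (f zero) eq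
∑ᶠ≡0 {f = f} eq (suc i) = ∑ᶠ≡0 (m+n≡0⇒n≡0 (f zero) eq) i

∑ᶠ≡1 : ∀ {m} {f : Fin m → ℕ} → ℕ∑.∑ᶠ f ≡ 1 → ∃ λ i → f i ≡ 1 × (∀ j → j ≢ i → f j ≡ 0)
∑ᶠ≡1 {suc m} {f} eq with f zero in eq₀
... | 0 = let i , fi , rest = ∑ᶠ≡1 {m} eq in suc i , fi , λ where
  zero    _   → eq₀
  (suc j) j≢i → rest j λ { refl → j≢i refl }
... | 1 = zero , eq₀ , λ where
  zero    0≢0 → contradiction refl 0≢0
  (suc j) _   → ∑ᶠ≡0 (suc-injective eq) j

-- Counts an edge at most once over disjoint trees.
∑ᶠ-unique : ∀ {k} (b : Fin k → Bool) c → (∀ {i j} → i ≢ j → b i ≡ true → b j ≡ true → ⊥) →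
  ℕ∑.∑ᶠ (λ i → if b i then c else 0) ≤ c
∑ᶠ-unique {zero}  b c unique = z≤n
∑ᶠ-unique {suc k} b c unique with b zero in b₀
... | true  = ≤-reflexive (trans (cong (c +_) (ℕ∑.∑ᶠ-ε {k} λ i → cong (if_then c else 0) (excluded i)))
                                 (+-identityʳ c))
  where
  excluded : ∀ i → b (suc i) ≡ false
  excluded i with b (suc i) in bᵢ
  ... | true  = contradiction bᵢ (λ bᵢ → unique (λ ()) b₀ bᵢ)
  ... | false = refl
... | false = ∑ᶠ-unique (b ∘ suc) c (λ i≢j → unique λ { refl → i≢j refl })

∑ᶠ-δ : ∀ {n} (v : Fin n) (β : Fin n → ℤ₃) → ℤ₃∑.∑ᶠ (λ u → if does (v ≟ u) then β u else 0₃) ≡ β v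
∑ᶠ-δ v β = trans (ℤ₃∑.∑ᶠ-single _ v λ u u≢v → cong (if_then β u else 0₃) (dec-false (v ≟ u) (u≢v ∘ sym)))
                 (cong (if_then β v else 0₃) (dec-true (v ≟ v) refl))

finite-lem : ∀ {n} (P : Fin n → Set) → ¬ ¬ (∀ i → Dec (P i))
finite-lem {zero}  P = return λ ()
finite-lem {suc n} P = lem {P = P zero} >>= λ d → finite-lem (P ∘ suc) >>= λ ds → return λ where
  zero    → d
  (suc i) → ds i

∉-del : ∀ {n} (p : Subset.Subset n) y → y Subset.∉ (p Subset.- y)
∉-del (_ Vec.∷ p) zero    ()
∉-del (_ Vec.∷ p) (suc y) (Vec.there y∈) = ∉-del p y y∈

-- Graphs as edge lists

⊝-⊕ : ∀ a b → ⊝ (a ⊕ b) ≡ ⊝ a ⊕ ⊝ b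
⊝-⊕ = from-yes (all? λ a → all? λ b → (⊝ (a ⊕ b)) ≟ (⊝ a ⊕ ⊝ b))

∑ᶠ-⊝ : ∀ {m} (f : Fin m → ℤ₃) → ℤ₃∑.∑ᶠ (λ i → ⊝ f i) ≡ ⊝ ℤ₃∑.∑ᶠ f
∑ᶠ-⊝ {zero}  f = refl
∑ᶠ-⊝ {suc m} f = trans (cong (⊝ f zero ⊕_) (∑ᶠ-⊝ (f ∘ suc))) (sym (⊝-⊕ (f zero) _))

move-⊝ : ∀ a c b → a ≡ c ⊕ b → a ⊕ ⊝ c ≡ b
move-⊝ a c b refl = cancel c b
  where
  cancel : ∀ c b → (c ⊕ b) ⊕ ⊝ c ≡ b
  cancel = from-yes (all? λ c → all? λ b → ((c ⊕ b) ⊕ ⊝ c) ≟ b)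

unmove-⊝ : ∀ a c b → a ⊕ ⊝ c ≡ b → a ≡ c ⊕ b
unmove-⊝ a c b refl = cancel a c
  where
  cancel : ∀ a c → a ≡ c ⊕ (a ⊕ ⊝ c)
  cancel = from-yes (all? λ a → all? λ c → a ≟ (c ⊕ (a ⊕ ⊝ c)))

charges : ∀ {n} → (Fin n → ℤ₃) → List (Charge n)
charges β = tabulate λ v → v , β v

chg-is : ∀ {n} v (β : Fin n → ℤ₃) → chg (is v) (charges β) ≡ β v
chg-is v β = trans (ℤ₃∑.∑-tabulate (ch (is v)) (λ v → v , β v)) (∑ᶠ-δ v β)

chg-full : ∀ {n} (β : Fin n → ℤ₃) → ZeroSum β → chg full (charges β) ≡ 0₃
chg-full β 3∣ = begin
  chg full (charges β)             ≡⟨ ℤ₃∑.∑-tabulate (ch full) (λ v → v , β v) ⟩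
  ℤ₃∑.∑ᶠ β                         ≡⟨ ℤ₃∑.∑ᶠ-cong (λ v → [toℕ]₃ (β v)) ⟨
  ℤ₃∑.∑ᶠ ([_]₃ ∘ toℕ ∘ β)          ≡⟨ [∑ᶠ]₃ (toℕ ∘ β) ⟨
  [ ℕ∑.∑ᶠ (toℕ ∘ β) ]₃             ≡⟨ cong [_]₃ (sum≡∑ᶠ (toℕ ∘ β)) ⟨
  [ ℕᶠ.sum (toℕ ∘ β) ]₃            ≡⟨ 3∣⇒[]₃ 3∣ ⟩
  0₃                               ∎
  where open ≡-Reasoning

does-sym : ∀ {n} (u v : Fin n) → does (u ≟ v) ≡ does (v ≟ u)
does-sym u v with u ≟ v
... | yes refl = sym (dec-true (u ≟ u) refl)
... | no u≢v   = sym (dec-false (v ≟ u) (u≢v ∘ sym))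

same-side : ∀ {n} (A : VSet n) {u v} → cr A (u , v) ≡ 0 → A u ≡ true → A v ≡ true
same-side A {u} {v} eq Au with A u | A v
... | true | true = refl

same-side′ : ∀ {n} (A : VSet n) {u v} → cr A (u , v) ≡ 0 → A v ≡ true → A u ≡ true
same-side′ A {u} {v} eq Av with A u | A v
... | true | true = refl

chosen : ∀ {n m} {ds} (g : Fin m → Edge n) → Pointwise _~_ ds (tabulate g) →
         ∃ λ (s : Vec.Vec Bool m) → ds ≡ tabulate (λ e → arcOf (Vec.lookup s e) (g e))
chosen {m = zero}  g []               = Vec.[] , refl
chosen {m = suc m} g (inj₁ refl ∷ pw) =
  let s , eq = chosen (g ∘ suc) pw in true Vec.∷ s , cong (_ ∷_) eq
chosen {m = suc m} g (inj₂ refl ∷ pw) =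
  let s , eq = chosen (g ∘ suc) pw in false Vec.∷ s , cong (_ ∷_) eq

-- Flows, cuts and bridges of a graph

module _ {n m : ℕ} (G : Graph n m) where

  arc≡arcOf : ∀ e b → arc G e b ≡ arcOf b (ends G e)
  arc≡arcOf e true  = refl
  arc≡arcOf e false = refl

  flow : PartialOrientation m → Fin n → Fin m → ℤ₃
  flow P v e = ι (does (≡-dec _≟_ (tail G P e) (just v))) ⊕ ⊝ ι (does (≡-dec _≟_ (head G P e) (just v)))

  flow-just : ∀ P v e {b} → P e ≡ just b → flow P v e ≡ fl (is v) (arc G e b)
  flow-just P v e eq rewrite eq = cong₂ (λ a b → ι a ⊕ ⊝ ι b) (does-sym _ v) (does-sym _ v)

  flow-nothing : ∀ P v e → P e ≡ nothing → flow P v e ≡ 0₃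
  flow-nothing P v e eq rewrite eq = refl

  ∑-flow : ∀ P v → ℤ₃∑.∑ᶠ (flow P v) ≡ [ d⁺ G P v ]₃ ⊕ ⊝ [ d⁻ G P v ]₃
  ∑-flow P v = trans (ℤ₃∑.∑ᶠ-∙ (ι ∘ out) (λ e → ⊝ ι (into e)))
    (cong₂ _⊕_ (sym ([card]₃ out)) (trans (∑ᶠ-⊝ (ι ∘ into)) (cong ⊝_ (sym ([card]₃ into)))))
    where
    out into : Fin m → Bool
    out e  = does (≡-dec _≟_ (tail G P e) (just v))
    into e = does (≡-dec _≟_ (head G P e) (just v))

  balanced⇒flow : ∀ β P v → BalancedAt G β P v → ℤ₃∑.∑ᶠ (flow P v) ≡ β v
  balanced⇒flow β P v bal = trans (∑-flow P v)
    (move-⊝ _ [ d⁻ G P v ]₃ (β v) (≈₃⇒≡ (d⁺ G P v) (d⁻ G P v) (β v) bal))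

  flow⇒balanced : ∀ β P v → ℤ₃∑.∑ᶠ (flow P v) ≡ β v → BalancedAt G β P v
  flow⇒balanced β P v eq = ≡⇒≈₃ (d⁺ G P v) (d⁻ G P v) (β v)
    (unmove-⊝ _ [ d⁻ G P v ]₃ (β v) (trans (sym (∑-flow P v)) eq))

  balancedAt? : ∀ β P v → Dec (BalancedAt G β P v)
  balancedAt? β P v = 3 ℕ.∣? ℤ.∣ d⁺ G P v ℤ.⊖ d⁻ G P v ℤ.- ℤ.+ toℕ (β v) ∣

  edgeList : List (Edge n)
  edgeList = tabulate (ends G)

  module _ (w : Fin n) where

    -- Missing edges are replaced by loops at w, which are harmless.
    part : Subset.Subset m → Fin m → Edge n
    part S e = if does (e Subset.∈? S) then ends G e else (w , w)

    cr-loop : ∀ (A : VSet n) → cr A (w , w) ≡ 0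
    cr-loop A = cong ⟦_⟧ (Bool.xor-same (A w))

    ecr-loop : ∀ {k} (ℓ : Fin n → Fin k) → ecr ℓ (w , w) ≡ 0
    ecr-loop ℓ = cong (if_then 0 else 1) (dec-true (ℓ w ≟ ℓ w) refl)

    cr-part : ∀ A S e → cr A (part S e) ≡ (if does (e Subset.∈? S) then cr A (ends G e) else 0)
    cr-part A S e with does (e Subset.∈? S)
    ... | true  = refl
    ... | false = cr-loop A

    ecr-part : ∀ {k} (ℓ : Fin n → Fin k) S e →
               ecr ℓ (part S e) ≡ (if does (e Subset.∈? S) then ecr ℓ (ends G e) else 0)
    ecr-part ℓ S e with does (e Subset.∈? S)
    ... | true  = refl
    ... | false = ecr-loop ℓ

    part-∈ : ∀ {S e} → e Subset.∈ S → part S e ≡ ends G e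
    part-∈ {S} {e} e∈ = cong (if_then ends G e else (w , w)) (dec-true (e Subset.∈? S) e∈)

    part-⊤ : tabulate (part Subset.⊤) ≡ edgeList
    part-⊤ = tabulate-cong λ e → part-∈ {Subset.⊤} {e} Subset.∈⊤

    walk-crosses : ∀ (H : Subgraph G) A {u v} → Walk H u v → A u ≡ true → A v ≡ false →
                   ∃ λ e → e Subset.∈ edges H × cr A (ends G e) ≡ 1
    walk-crosses H A ε Au Av with () ← trans (sym Au) Av
    walk-crosses H A {u} (_◅_ {j = x} (e , e∈ , joins) walk) Au Av with A x in Ax
    ... | true  = walk-crosses H A walk Ax Av
    ... | false = e , e∈ , crossing joins
      where
      crossing : Joins G e u x → cr A (ends G e) ≡ 1
      crossing (inj₁ eq) rewrite eq | Au | Ax = refl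
      crossing (inj₂ eq) rewrite eq | Au | Ax = refl

    -- A lone crossing edge is a bridge, since no walk avoiding it leaves `A`; it belongs to `H`
    -- because the loops standing for missing edges never cross.
    noBridge⇒cut≢1 : ∀ (H : Subgraph G) → ¬ HasBridge H → ∀ A → cut A (tabulate (part (edges H))) ≢ 1
    noBridge⇒cut≢1 H ¬bridge A eq
      with e , cr≡1 , others ← ∑ᶠ≡1 {f = cr A ∘ part (edges H)} (trans (sym (ℕ∑.∑-tabulate (cr A) (part (edges H)))) eq) =
      bridge (e Subset.∈? edges H)
      where
      uncrossed : ∀ {e′} → e′ Subset.∈ (edges H Subset.- e) → cr A (ends G e′) ≡ 0
      uncrossed {e′} e′∈ = trans (sym (cong (cr A) (part-∈ (Subset.p─q⊆p (edges H) _ e′∈))))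
        (others e′ λ { refl → ∉-del (edges H) e′ e′∈ })
      step : ∀ {u v} → A u ≡ true → Step (deleteEdge H e) u v → A v ≡ true
      step Au (e′ , e′∈ , inj₁ ends≡) = same-side A (trans (cong (cr A) (sym ends≡)) (uncrossed e′∈)) Au
      step Au (e′ , e′∈ , inj₂ ends≡) = same-side′ A (trans (cong (cr A) (sym ends≡)) (uncrossed e′∈)) Au
      stays : ∀ {u v} → Walk (deleteEdge H e) u v → A u ≡ true → A v ≡ true
      stays ε             Au = Au
      stays (s ◅ walk) Au = stays walk (step Au s)
      bridge : Dec (e Subset.∈ edges H) → ⊥
      bridge (no e∉) with () ← trans (sym cr≡1) (trans (cr-part A (edges H) e)
        (cong (if_then cr A (ends G e) else 0) (dec-false (e Subset.∈? edges H) e∉)))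
      bridge (yes e∈) with trans (sym (cong (cr A) (part-∈ e∈))) cr≡1
      ... | crossing with A (proj₁ (ends G e)) in Au | A (proj₂ (ends G e)) in Av
      ...   | true | false = ¬bridge (e , e∈ , proj₁ (ends G e) , proj₂ (ends G e) ,
        (e , e∈ , inj₁ refl) ◅ ε , λ walk → separated A (stays walk Au) Av refl)
      ...   | false | true = ¬bridge (e , e∈ , proj₂ (ends G e) , proj₁ (ends G e) ,
        (e , e∈ , inj₂ refl) ◅ ε , λ walk → separated A (stays walk Av) Au refl)

    -- Density with deficit 3 excludes empty cuts, and the absence of bridges excludes cuts with one
    -- edge.
    noBridge⇒Cut≥2 : ∀ {U} (H : Subgraph G) → ¬ HasBridge H →
      Dense 3 U (tabulate (part (edges H))) → Cut≥2 U (tabulate (part (edges H)))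
    noBridge⇒Cut≥2 {U} H ¬bridge dense A u∈ Au v∈ Av =
      large _ (Dense⇒cut {U = U} {tabulate (part (edges H))} dense A u∈ Au v∈ Av) (noBridge⇒cut≢1 H ¬bridge A)
      where
      large : ∀ c → 4 ≤ c + 3 → c ≢ 1 → 2 ≤ c
      large 0 (s≤s (s≤s (s≤s ()))) c≢1
      large 1 _ c≢1 = contradiction refl c≢1
      large (suc (suc c)) _ _ = s≤s (s≤s z≤n)

-- From spanning trees to density

module _ {n : ℕ} where

  -- Merging the parts at the two ends of a crossing edge.
  crossings : ∀ (es : List (Edge n)) →
    (∀ A {u v} → A u ≡ true → A v ≡ false → 1 ≤ cut A es) →
    ∀ k (ℓ : Fin n → Fin (suc k)) → (∀ i → ∃ λ u → ℓ u ≡ i) → k ≤ ecut ℓ es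
  crossings es conn zero    ℓ sur = z≤n
  crossings es conn (suc k) ℓ sur
    with u , ℓu ← sur zero | v , ℓv ← sur (suc zero)
    with cut (λ x → does (zero ≟ ℓ x)) es in eq
       | conn (λ x → does (zero ≟ ℓ x)) {u} {v} (cong (λ i → does (zero ≟ i)) ℓu) (cong (λ i → does (zero ≟ i)) ℓv)
  ... | suc _ | _
    with x , y , es′ , p , Ax , Ay , _ ← pull-edge (λ x → does (zero ≟ ℓ x)) es eq =
    subst (suc k ≤_) (sym (ecut-≈ ℓ p)) (merge (ℓ x) (ℓ y) refl refl Ax Ay)
    where
    merge : ∀ a b → ℓ x ≡ a → ℓ y ≡ b → does (zero ≟ a) ≡ true → does (zero ≟ b) ≡ false →
            suc k ≤ ecr ℓ (x , y) + ecut ℓ es′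
    merge zero (suc c) ℓx ℓy _ _ = ≤-trans (s≤s (subst (k ≤_) (ecut-≈ ℓ′ p) (crossings es conn k ℓ′ sur′)))
      (≤-trans (s≤s (≤-reflexive (cong (_+ ecut ℓ′ es′) merged)))
        (≤-trans (s≤s coarser) (≤-reflexive (cong (_+ ecut ℓ es′) (sym distinct)))))
      where
      -- The crossing edge was taken at part zero, so merging that part into the other one just
      -- shifts the remaining indices down.
      μ : Fin (suc (suc k)) → Fin (suc k)
      μ zero    = c
      μ (suc i) = i
      ℓ′ : Fin n → Fin (suc k)
      ℓ′ = μ ∘ ℓ
      sur′ : ∀ i → ∃ λ u → ℓ′ u ≡ i
      sur′ i = let u , ℓu = sur (suc i) in u , cong μ ℓu
      merged : ecr ℓ′ (x , y) ≡ 0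
      merged = cong (if_then 0 else 1) (dec-true (ℓ′ x ≟ ℓ′ y) (trans (cong μ ℓx) (sym (cong μ ℓy))))
      distinct : ecr ℓ (x , y) ≡ 1
      distinct rewrite ℓx | ℓy = refl
      coarser-edge : ∀ e → ecr ℓ′ e ≤ ecr ℓ e
      coarser-edge (a , b) with ℓ a ≟ ℓ b
      ... | yes ℓ≡ rewrite dec-true (ℓ′ a ≟ ℓ′ b) (cong μ ℓ≡) = z≤n
      ... | no _ with does (ℓ′ a ≟ ℓ′ b)
      ...   | true  = z≤n
      ...   | false = ≤-refl
      coarser : ecut ℓ′ es′ ≤ ecut ℓ es′
      coarser = go es′
        where
        go : ∀ es → ecut ℓ′ es ≤ ecut ℓ es
        go []       = z≤n
        go (e ∷ es) = +-mono-≤ (coarser-edge e) (go es)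

module _ {n m : ℕ} (G : Graph n m) {f : ℕ} (A : Graph n f) (w : Fin n) where

  private G⁺ = addEdges G A

  ends-old : ∀ e → ends G⁺ (e ↑ˡ f) ≡ ends G e
  ends-old e = cong [ ends G , ends A ]′ (splitAt-↑ˡ m e f)

  tree-crossings : ∀ S → IsTree (spanning G⁺ S) → ∀ k (ℓ : Fin n → Fin (suc k)) →
    (∀ i → ∃ λ u → ℓ u ≡ i) → k ≤ ecut ℓ (tabulate (part G⁺ w S))
  tree-crossings S ((_ , walk) , _) = crossings (tabulate (part G⁺ w S)) λ B {u} {v} Bu Bv →
    let e , e∈ , crossing = walk-crosses G⁺ w (spanning G⁺ S) B (walk Subset.∈⊤ Subset.∈⊤) Bu Bv in
    ≤-trans (≤-reflexive (sym (trans (cong (cr B) (part-∈ G⁺ w e∈)) crossing)))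
      (≤-trans (≤-∑ᶠ (cr B ∘ part G⁺ w S) e) (≤-reflexive (sym (ℕ∑.∑-tabulate (cr B) (part G⁺ w S)))))

  -- Each of the four disjoint trees has at least `k` edges between the parts, and at most `f` of
  -- all these are added edges.
  trees⇒Dense : DisjointSpanningTrees G⁺ 4 → Dense f (allFin n) (edgeList G)
  trees⇒Dense (T , trees , disjoint) k ℓ sur = begin
    4 * k
      ≡⟨ ∑ᶠ-const 4 k ⟨
    ℕ∑.∑ᶠ {4} (λ _ → k)
      ≤⟨ ∑ᶠ-≤ (λ i → tree-crossings (T i) (trees i) k ℓ (λ j → let u , _ , ℓu = sur j in u , ℓu)) ⟩
    ℕ∑.∑ᶠ (λ i → ecut ℓ (tabulate (part G⁺ w (T i))))
      ≡⟨ ℕ∑.∑ᶠ-cong (λ i → trans (ℕ∑.∑-tabulate (ecr ℓ) (part G⁺ w (T i))) (ℕ∑.∑ᶠ-cong (ecr-part G⁺ w ℓ (T i)))) ⟩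
    ℕ∑.∑ᶠ (λ i → ℕ∑.∑ᶠ (λ e → if does (e Subset.∈? T i) then ecr ℓ (ends G⁺ e) else 0))
      ≡⟨ ℕ∑.∑ᶠ-swap (λ i e → if does (e Subset.∈? T i) then ecr ℓ (ends G⁺ e) else 0) ⟩
    ℕ∑.∑ᶠ (λ e → ℕ∑.∑ᶠ (λ i → if does (e Subset.∈? T i) then ecr ℓ (ends G⁺ e) else 0))
      ≤⟨ ∑ᶠ-≤ (λ e → ∑ᶠ-unique (λ i → does (e Subset.∈? T i)) (ecr ℓ (ends G⁺ e)) (once e)) ⟩
    ℕ∑.∑ᶠ (λ e → ecr ℓ (ends G⁺ e))
      ≡⟨ ∑ᶠ-↑ m (λ e → ecr ℓ (ends G⁺ e)) ⟩
    ℕ∑.∑ᶠ (λ e → ecr ℓ (ends G⁺ (e ↑ˡ f))) + ℕ∑.∑ᶠ (λ e → ecr ℓ (ends G⁺ (m ↑ʳ e)))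
      ≤⟨ +-mono-≤ (≤-reflexive (trans (ℕ∑.∑ᶠ-cong (λ e → cong (ecr ℓ) (ends-old e))) (sym (ℕ∑.∑-tabulate (ecr ℓ) (ends G)))))
                  (≤-trans (∑ᶠ-≤ (λ e → ecr≤1 (ends G⁺ (m ↑ʳ e)))) (≤-reflexive (trans (∑ᶠ-const f 1) (*-identityʳ f)))) ⟩
    ecut ℓ (edgeList G) + f ∎
    where
    open ≤-Reasoning
    ecr≤1 : ∀ e → ecr ℓ e ≤ 1
    ecr≤1 (u , v) with does (ℓ u ≟ ℓ v)
    ... | true  = z≤n
    ... | false = ≤-refl
    member : ∀ {e S} → does (e Subset.∈? S) ≡ true → e Subset.∈ S
    member {e} {S} eq with yes e∈ ← e Subset.∈? S = e∈
    once : ∀ e {i j} → i ≢ j → does (e Subset.∈? T i) ≡ true → does (e Subset.∈? T j) ≡ true → ⊥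
    once e i≢j e∈i e∈j = disjoint i≢j (e , Subset.x∈p∩q⁺ (member e∈i , member e∈j))

  -- One of the four trees avoids the at most three added edges.
  trees⇒Connected : f ≤ 3 → DisjointSpanningTrees G⁺ 4 → Connected (whole G)
  trees⇒Connected f≤3 (T , trees , disjoint) with Fin.any? (λ i → ¬? (Fin.any? λ a → (m ↑ʳ a) Subset.∈? T i))
  ... | yes (i , unused) = (w , Subset.∈⊤) , λ {u} {v} _ _ → old (proj₂ (proj₁ (trees i)) {u} {v} Subset.∈⊤ Subset.∈⊤)
    where
    step : ∀ {u v} → Step (spanning G⁺ (T i)) u v → Step (whole G) u v
    step (e , e∈ , joins) with splitAt m e in eq
    ... | inj₁ e′ = e′ , Subset.∈⊤ , joins
    ... | inj₂ a  = contradiction (a , subst (Subset._∈ T i) (sym (splitAt⁻¹-↑ʳ eq)) e∈) unused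
    old : ∀ {u v} → Walk (spanning G⁺ (T i)) u v → Walk (whole G) u v
    old ε          = ε
    old (s ◅ walk) = step s ◅ old walk
  ... | no all-used = contradiction (injective⇒≤ injective) (<⇒≱ (s≤s f≤3))
    where
    used : ∀ i → ∃ λ a → (m ↑ʳ a) Subset.∈ T i
    used i = decidable-stable (Fin.any? λ a → (m ↑ʳ a) Subset.∈? T i) λ unused → all-used (i , unused)
    injective : ∀ {i j} → proj₁ (used i) ≡ proj₁ (used j) → i ≡ j
    injective {i} {j} eq = decidable-stable (i ≟ j) λ i≢j → disjoint i≢j
      (m ↑ʳ proj₁ (used i) , Subset.x∈p∩q⁺ (proj₂ (used i) ,
        subst (λ a → (m ↑ʳ a) Subset.∈ T j) (sym eq) (proj₂ (used j))))

∈-comprehension⁺ : ∀ {m} {P : Fin m → Set} (P? : Decidable P) {e} → P e → e Subset.∈ comprehension P?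
∈-comprehension⁺ P? {e} p = lookup⇒[]= e _ (trans (lookup∘tabulate (does ∘ P?) e) (dec-true (P? e) p))

∈-comprehension⁻ : ∀ {m} {P : Fin m → Set} (P? : Decidable P) {e} → e Subset.∈ comprehension P? → P e
∈-comprehension⁻ P? {e} e∈ with P? e | trans (sym (lookup∘tabulate (does ∘ P?) e)) ([]=⇒lookup e∈)
... | yes p | _ = p

ZeroSum-0 : ∀ n → ZeroSum {n} (λ _ → 0₃)
ZeroSum-0 n = []₃⇒3∣ _ (trans (cong [_]₃ (sum≡∑ᶠ {n} (λ _ → 0)))
  (trans ([∑ᶠ]₃ {n} (λ _ → 0)) (ℤ₃∑.∑ᶠ-ε {n} λ _ → refl)))

-- Back to orientations of the graph

module _ {n m : ℕ} (G : Graph n m) where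

  -- A subset of the edges is a vector of Booleans and so encodes an orientation; exhaustive search
  -- over subsets removes the double negation.
  βOrientation? : ∀ β (D : Vec.Vec Bool m → Orientation m) →
    ¬ ¬ (∃ λ s → IsβOrientation G β (D s)) → ∃ λ s → IsβOrientation G β (D s)
  βOrientation? β D = decidable-stable
    (Subset.anySubset? λ s → all? λ v → balancedAt? G β (total (D s)) v)

  edgeList-∈ : EndsIn (allFin n) (edgeList G)
  edgeList-∈ = All.tabulate⁺ λ e → ∈-allFin _ , ∈-allFin _

  ℤ₃Conn⇒ℤ₃-Connected : ℤ₃Conn (allFin n) (edgeList G) → ℤ₃-Connected G
  ℤ₃Conn⇒ℤ₃-Connected conn β zero-sum =
    let s , balanced = βOrientation? β Vec.lookup
          (conn {[]} {charges β} (edgeList-∈ , [] , All.tabulate⁺ λ v → ∈-allFin v) (sym (chg-full β zero-sum))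
           >>= λ sol → return (orientation sol)) in
    Vec.lookup s , balanced
    where
    orientation : Sol (allFin n) (edgeList G) [] (charges β) → ∃ λ s → IsβOrientation G β (Vec.lookup s)
    orientation (mkSol ds pw bal) with chosen (ends G) pw
    ... | s , refl = s , λ v → flow⇒balanced G β (total (Vec.lookup s)) v (begin
      ℤ₃∑.∑ᶠ (flow G (total (Vec.lookup s)) v)
        ≡⟨ ℤ₃∑.∑ᶠ-cong (λ e → trans (flow-just G (total (Vec.lookup s)) v e refl)
                                    (cong (fl (is v)) (arc≡arcOf G e (Vec.lookup s e)))) ⟩
      ℤ₃∑.∑ᶠ (λ e → fl (is v) (arcOf (Vec.lookup s e) (ends G e)))
        ≡⟨ ℤ₃∑.∑-tabulate (fl (is v)) (λ e → arcOf (Vec.lookup s e) (ends G e)) ⟨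
      net (is v) (tabulate (λ e → arcOf (Vec.lookup s e) (ends G e)))
        ≡⟨ ⊕-identityʳ _ ⟨
      net (is v) (tabulate (λ e → arcOf (Vec.lookup s e) (ends G e))) ⊕ 0₃
        ≡⟨ bal (∈-allFin v) ⟩
      chg (is v) (charges β)
        ≡⟨ chg-is v β ⟩
      β v ∎)
      where open ≡-Reasoning

  fl-sum : ∀ (A : VSet n) e → fl A e ≡ ℤ₃∑.∑ᶠ (λ v → if A v then fl (is v) e else 0₃)
  fl-sum A (a , b) = sym (begin
    ℤ₃∑.∑ᶠ (λ v → if A v then fl (is v) (a , b) else 0₃)
      ≡⟨ ℤ₃∑.∑ᶠ-cong (λ v → trans (split (A v) (is v a) (is v b))
           (cong₂ (λ p q → (if p then ι (A v) else 0₃) ⊕ ⊝ (if q then ι (A v) else 0₃))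
                  (does-sym v a) (does-sym v b))) ⟩
    ℤ₃∑.∑ᶠ (λ v → at a v ⊕ ⊝ at b v)
      ≡⟨ ℤ₃∑.∑ᶠ-∙ (at a) (λ v → ⊝ at b v) ⟩
    ℤ₃∑.∑ᶠ (at a) ⊕ ℤ₃∑.∑ᶠ (λ v → ⊝ at b v)
      ≡⟨ cong₂ _⊕_ (∑ᶠ-δ a (ι ∘ A)) (trans (∑ᶠ-⊝ (at b)) (cong ⊝_ (∑ᶠ-δ b (ι ∘ A)))) ⟩
    ι (A a) ⊕ ⊝ ι (A b) ∎)
    where
    open ≡-Reasoning
    at : Fin n → Fin n → ℤ₃
    at a v = if does (a ≟ v) then ι (A v) else 0₃
    split : ∀ c p q → (if c then ι p ⊕ ⊝ ι q else 0₃) ≡ (if p then ι c else 0₃) ⊕ ⊝ (if q then ι c else 0₃)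
    split true  true  true  = refl
    split true  true  false = refl
    split true  false true  = refl
    split true  false false = refl
    split false true  true  = refl
    split false true  false = refl
    split false false true  = refl
    split false false false = refl

  -- For β = 0 a bridge would carry all of the flow out of one of its sides.
  ℤ₃-Connected⇒noBridge : Fin n → ℤ₃-Connected G → ¬ HasBridge (whole G)
  ℤ₃-Connected⇒noBridge w conn (e , e∈ , u , v , walk , ¬walk) =
    -- The side of the bridge is the set reachable from `u` without `e`. Deciding membership costs a
    -- double negation, which the negative goal absorbs.
    finite-lem (Walk (deleteEdge (whole G) e) u) cut-off
    where
    cut-off : ¬ (∀ z → Dec (Walk (deleteEdge (whole G) e) u z))
    cut-off reach with walk-crosses G w (whole G) (does ∘ reach) walk
                         (dec-true (reach u) ε) (dec-false (reach v) ¬walk)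
                     | conn (λ _ → 0₃) (ZeroSum-0 n)
    ... | e′ , _ , crossing | D , balanced = unbalanced (begin
      fl A (arc G e (D e))
        ≡⟨ ℤ₃∑.∑ᶠ-single (λ e → fl A (arc G e (D e))) e (λ e″ e″≢e → uncrossed-fl (D e″) (uncrossed e″≢e)) ⟨
      ℤ₃∑.∑ᶠ (λ e → fl A (arc G e (D e)))
        ≡⟨ ℤ₃∑.∑ᶠ-cong (λ e → fl-sum A (arc G e (D e))) ⟩
      ℤ₃∑.∑ᶠ (λ e → ℤ₃∑.∑ᶠ (λ v → if A v then fl (is v) (arc G e (D e)) else 0₃))
        ≡⟨ ℤ₃∑.∑ᶠ-swap (λ e v → if A v then fl (is v) (arc G e (D e)) else 0₃) ⟩
      ℤ₃∑.∑ᶠ (λ v → ℤ₃∑.∑ᶠ (λ e → if A v then fl (is v) (arc G e (D e)) else 0₃))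
        ≡⟨ ℤ₃∑.∑ᶠ-ε vanishing ⟩
      0₃ ∎)
      where
      open ≡-Reasoning
      A : VSet n
      A = does ∘ reach
      reached : ∀ {x} → A x ≡ true → Walk (deleteEdge (whole G) e) u x
      reached {x} Ax with yes walk ← reach x = walk
      uncrossed : ∀ {e″} → e″ ≢ e → cr A (ends G e″) ≡ 0
      uncrossed {e″} e″≢e with A (proj₁ (ends G e″)) in Aa | A (proj₂ (ends G e″)) in Ab
      ... | true  | true  = refl
      ... | false | false = refl
      ... | true  | false = contradiction
        (reached Aa ◅◅ ((e″ , Subset.x∈p∧x≢y⇒x∈p-y Subset.∈⊤ e″≢e , inj₁ refl) ◅ ε))
        (λ walk → separated A (dec-true (reach _) walk) Ab refl)
      ... | false | true  = contradiction
        (reached Ab ◅◅ ((e″ , Subset.x∈p∧x≢y⇒x∈p-y Subset.∈⊤ e″≢e , inj₂ refl) ◅ ε))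
        (λ walk → separated A (dec-true (reach _) walk) Aa refl)
      uncrossed-fl : ∀ {e} b → cr A (ends G e) ≡ 0 → fl A (arc G e b) ≡ 0₃
      uncrossed-fl {e} true  eq with A (proj₁ (ends G e)) | A (proj₂ (ends G e))
      ... | true  | true  = refl
      ... | false | false = refl
      uncrossed-fl {e} false eq with A (proj₁ (ends G e)) | A (proj₂ (ends G e))
      ... | true  | true  = refl
      ... | false | false = refl
      crossing-fl : ∀ {e} b → cr A (ends G e) ≡ 1 → fl A (arc G e b) ≢ 0₃
      crossing-fl {e} true  eq with A (proj₁ (ends G e)) | A (proj₂ (ends G e))
      ... | true  | false = λ ()
      ... | false | true  = λ ()
      crossing-fl {e} false eq with A (proj₁ (ends G e)) | A (proj₂ (ends G e))
      ... | true  | false = λ ()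
      ... | false | true  = λ ()
      unbalanced : fl A (arc G e (D e)) ≢ 0₃
      unbalanced with e′ ≟ e
      ... | yes refl = crossing-fl (D e) crossing
      ... | no e′≢e with () ← trans (sym crossing) (uncrossed e′≢e)
      vanishing : ∀ v → ℤ₃∑.∑ᶠ (λ e → if A v then fl (is v) (arc G e (D e)) else 0₃) ≡ 0₃
      vanishing v with A v
      ... | true  = trans (sym (ℤ₃∑.∑ᶠ-cong (λ e → flow-just G (total D) v e refl)))
                          (balanced⇒flow G (λ _ → 0₃) (total D) v (balanced v))
      ... | false = ℤ₃∑.∑ᶠ-ε {m} λ _ → refl

  noBridge⇒ℤ₃-Connected : Fin n → Dense 3 (allFin n) (edgeList G) → ¬ HasBridge (whole G) → ℤ₃-Connected G
  noBridge⇒ℤ₃-Connected w dense ¬bridge = ℤ₃Conn⇒ℤ₃-Connected (PInv⇒ℤ₃Conn record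
    { ends∈ = edgeList-∈
    ; dense = dense
    ; cut≥2 = subst (Cut≥2 (allFin n)) (part-⊤ G w) (noBridge⇒Cut≥2 G w {allFin n} (whole G) ¬bridge
                (subst (Dense 3 (allFin n)) (sym (part-⊤ G w)) dense)) })

  module _ (z : Fin n) (deg≤7 : degree G z ≤ 7) (κ : κ′≥2 (deleteVertex G z))
           (dense : Dense 0 (allFin n) (edgeList G)) where

    private
      w : Fin n
      w = proj₁ (proj₁ (proj₁ κ))

      H : Subgraph G
      H = deleteVertex G z

      C : VSet n
      C = ∁ (is z)

      outside : ∀ {v} → v ≢ z → C v ≡ true
      outside {v} v≢z = cong not (is-≢ {x = z} {v} (v≢z ∘ sym))

      Cz : C z ≡ false
      Cz = cong not (is-refl z)

      w∈ : w ∈ allFin n ∣ᵥ C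
      w∈ = ∈-filter⁺ (member? C) (∈-allFin w)
        (outside λ w≡z → ∉-del Subset.⊤ z (subst (Subset._∈ _) w≡z (proj₂ (proj₁ (proj₁ κ)))))

      data Status (e : Fin m) : Set where
        kept : e Subset.∈ edges H → proj₁ (ends G e) ≢ z → proj₂ (ends G e) ≢ z → Status e
        lost : e Subset.∉ edges H → e Subset.∈ incidentEdges G z →
               (proj₁ (ends G e) ≡ z × proj₂ (ends G e) ≢ z) ⊎ (proj₁ (ends G e) ≢ z × proj₂ (ends G e) ≡ z) →
               Status e

      status : ∀ e → Status e
      status e with incident? G z e
      ... | no ¬inc = kept (Subset.x∉p⇒x∈∁p (¬inc ∘ ∈-comprehension⁻ (incident? G z)))
                           (¬inc ∘ inj₁) (¬inc ∘ inj₂)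
      ... | yes inc = lost (Subset.x∈p⇒x∉∁p e∈) e∈ (one-end inc)
        where
        e∈ = ∈-comprehension⁺ (incident? G z) inc
        one-end : Incident G z e → (proj₁ (ends G e) ≡ z × proj₂ (ends G e) ≢ z) ⊎
                                   (proj₁ (ends G e) ≢ z × proj₂ (ends G e) ≡ z)
        one-end (inj₁ a≡z) = inj₁ (a≡z , λ b≡z → loopless G e (trans a≡z (sym b≡z)))
        one-end (inj₂ b≡z) = inj₂ ((λ a≡z → loopless G e (trans a≡z (sym b≡z))) , b≡z)

      is-z : ∀ {v} → v ≡ z → is z v ≡ true
      is-z refl = is-refl z

      not-z : ∀ {v} → v ≢ z → is z v ≡ false
      not-z {v} v≢z = is-≢ {x = z} {v} (v≢z ∘ sym)

      cut-z : cut (is z) (edgeList G) ≡ degree G z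
      cut-z = trans (ℕ∑.∑-tabulate (cr (is z)) (ends G))
        (trans (ℕ∑.∑ᶠ-cong edgewise) (sym (card (does ∘ incident? G z))))
        where
        edgewise : ∀ e → cr (is z) (ends G e) ≡ ⟦ does (incident? G z e) ⟧
        edgewise e with status e
        ... | kept e∈ a≢z b≢z = trans (cong₂ (λ a b → ⟦ a xor b ⟧) (not-z a≢z) (not-z b≢z))
          (cong ⟦_⟧ (sym (dec-false (incident? G z e) λ { (inj₁ a≡z) → a≢z a≡z ; (inj₂ b≡z) → b≢z b≡z })))
        ... | lost e∉ e∈ (inj₁ (a≡z , b≢z)) = trans (cong₂ (λ a b → ⟦ a xor b ⟧) (is-z a≡z) (not-z b≢z))
          (cong ⟦_⟧ (sym (dec-true (incident? G z e) (inj₁ a≡z))))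
        ... | lost e∉ e∈ (inj₂ (a≢z , b≡z)) = trans (cong₂ (λ a b → ⟦ a xor b ⟧) (not-z a≢z) (is-z b≡z))
          (cong ⟦_⟧ (sym (dec-true (incident? G z e) (inj₂ b≡z))))

      es : List (Edge n)
      es = tabulate (part G w (edges H))

      ecut-es : ∀ {k} (ℓ : Fin n → Fin k) → ecut ℓ (edgeList G ∣ₑ C) ≡ ecut ℓ es
      ecut-es ℓ = trans (ℕ∑.∑-filter (ecr ℓ) (inside? C) (edgeList G))
        (trans (ℕ∑.∑-tabulate (λ e → if does (inside? C e) then ecr ℓ e else 0) (ends G))
        (trans (ℕ∑.∑ᶠ-cong edgewise) (sym (ℕ∑.∑-tabulate (ecr ℓ) (part G w (edges H))))))
        where
        edgewise : ∀ e → (if does (inside? C (ends G e)) then ecr ℓ (ends G e) else 0) ≡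
                         ecr ℓ (part G w (edges H) e)
        edgewise e with status e
        ... | kept e∈ a≢z b≢z = trans
          (cong (if_then ecr ℓ (ends G e) else 0)
            (dec-true (inside? C (ends G e)) (cong₂ _∧_ (outside a≢z) (outside b≢z))))
          (cong (ecr ℓ) (sym (part-∈ G w e∈)))
        ... | lost e∉ _ ends-z = trans
          (cong (if_then ecr ℓ (ends G e) else 0) (dec-false (inside? C (ends G e)) (not-inside ends-z)))
          (sym (trans (ecr-part G w ℓ (edges H) e)
            (cong (if_then ecr ℓ (ends G e) else 0) (dec-false (e Subset.∈? edges H) e∉))))
          where
          not-inside : (proj₁ (ends G e) ≡ z × proj₂ (ends G e) ≢ z) ⊎
                       (proj₁ (ends G e) ≢ z × proj₂ (ends G e) ≡ z) →
                       ¬ C (proj₁ (ends G e)) ∧ C (proj₂ (ends G e)) ≡ true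
          not-inside (inj₁ (a≡z , _)) ins with () ← trans (sym ins) (∧-left (cong not (is-z a≡z)))
          not-inside (inj₂ (_ , b≡z)) ins with () ← trans (sym ins) (∧-right {C (proj₁ (ends G e))} (cong not (is-z b≡z)))

      dense-es : Dense 3 (allFin n ∣ᵥ C) es
      dense-es k ℓ sur = +-cancelʳ-≤ 4 (4 * k) _ (begin
        4 * k + 4
          ≤⟨ without-bound {c = 0} {allFin n} {edgeList G} dense (∈-allFin z) k ℓ sur ⟩
        (ecut ℓ (edgeList G ∣ₑ C) + cut (is z) (edgeList G)) + 0
          ≡⟨ +-identityʳ _ ⟩
        ecut ℓ (edgeList G ∣ₑ C) + cut (is z) (edgeList G)
          ≡⟨ cong₂ _+_ (ecut-es ℓ) cut-z ⟩
        ecut ℓ es + degree G z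
          -- Of the at most 7 edges at `z`, four are matched by `z` being a part of its own, which
          -- leaves the deficit 3.
          ≤⟨ +-monoʳ-≤ (ecut ℓ es) deg≤7 ⟩
        ecut ℓ es + 7
          ≡⟨ +-assoc (ecut ℓ es) 3 4 ⟨
        (ecut ℓ es + 3) + 4 ∎)
        where open ≤-Reasoning

      es-∈ : EndsIn (allFin n ∣ᵥ C) es
      es-∈ = All.tabulate⁺ λ e → located e (status e)
        where
        located : ∀ e → Status e → proj₁ (part G w (edges H) e) ∈ allFin n ∣ᵥ C ×
                                   proj₂ (part G w (edges H) e) ∈ allFin n ∣ᵥ C
        located e (kept e∈ a≢z b≢z) rewrite part-∈ G w {edges H} {e} e∈ =
          ∈-filter⁺ (member? C) (∈-allFin _) (outside a≢z) , ∈-filter⁺ (member? C) (∈-allFin _) (outside b≢z)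
        located e (lost e∉ _ _) rewrite dec-false (e Subset.∈? edges H) e∉ = w∈ , w∈

      conn : ℤ₃Conn (allFin n ∣ᵥ C) es
      conn = PInv⇒ℤ₃Conn record
        { ends∈ = es-∈
        ; dense = dense-es
        ; cut≥2 = noBridge⇒Cut≥2 G w {allFin n ∣ᵥ C} H (proj₂ κ) dense-es }

    extendable : ⟨ℤ₃⟩-ExtendableAt G z
    extendable β zero-sum P pre balanced-z =
      let s , balanced = βOrientation? β D
            -- Here `es` takes the place of the filtered list in `R`: it has one entry for each edge
            -- of `G`, so that an orientation can be read off by index.
            (conn (es-∈ , proj₂ (R.located (edgeList-∈ , [] , All.tabulate⁺ λ v → ∈-allFin v))) R.charge-zero
             >>= λ sol → return (orientation sol)) in
      D s , (λ e d eq → cong (fromMaybe (Vec.lookup s e)) eq) , balanced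
      where
      open ≡-Reasoning

      D : Vec.Vec Bool m → Orientation m
      D s e = fromMaybe (Vec.lookup s e) (P e)

      oriented : ∀ {e} → e Subset.∈ incidentEdges G z → ∃ λ d → P e ≡ just d
      oriented {e} e∈ with P e | Equivalence.from (pre e) e∈
      ... | just d | _ = d , refl

      unoriented : ∀ {e} → e Subset.∈ edges H → P e ≡ nothing
      unoriented {e} e∈ with P e in eq
      ... | nothing = refl
      ... | just d  = contradiction (Equivalence.to (pre e) (subst Is-just (sym eq) (is-just tt)))
                                    (Subset.x∈∁p⇒x∉p e∈)

      fl-away : ∀ e d → proj₁ (ends G e) ≢ z → proj₂ (ends G e) ≢ z → fl (is z) (arc G e d) ≡ 0₃
      fl-away e true  a≢z b≢z = cong₂ (λ a b → ι a ⊕ ⊝ ι b) (not-z a≢z) (not-z b≢z)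
      fl-away e false a≢z b≢z = cong₂ (λ a b → ι a ⊕ ⊝ ι b) (not-z b≢z) (not-z a≢z)

      -- At z only the pre-oriented edges matter, however the others are directed.
      at-z : ∀ (b : Fin m → Bool) → ℤ₃∑.∑ᶠ (λ e → fl (is z) (arc G e (fromMaybe (b e) (P e)))) ≡ β z
      at-z b = trans (ℤ₃∑.∑ᶠ-cong λ e → edgewise e (status e)) (balanced⇒flow G β P z balanced-z)
        where
        edgewise : ∀ e → Status e → fl (is z) (arc G e (fromMaybe (b e) (P e))) ≡ flow G P z e
        edgewise e (kept e∈ a≢z b≢z) = trans (fl-away e (fromMaybe (b e) (P e)) a≢z b≢z) (sym (flow-nothing G P z e (unoriented e∈)))
        edgewise e (lost e∉ e∈ _) = let d , eq = oriented e∈ in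
          trans (cong (fl (is z) ∘ arc G e ∘ fromMaybe (b e)) eq) (sym (flow-just G P z e eq))

      -- The default `true` is given to edges not at `z`; they do not affect the balance at `z`, and
      -- `Restrict` keeps only the arcs across the boundary.
      preArc : Fin m → Edge n
      preArc e = arc G e (fromMaybe true (P e))

      preArcs-~ : Pointwise _~_ (tabulate preArc) (edgeList G)
      preArcs-~ = Pointwise.tabulate⁺ λ e →
        subst (_~ ends G e) (sym (arc≡arcOf G e _)) (arcOf-~ (fromMaybe true (P e)) (ends G e))

      q : QuotientSol C (allFin n) (edgeList G) [] (charges β)
      q = removalSol {x = z} {st = []} (tabulate preArc) preArcs-~ (sym (chg-full β zero-sum)) (begin
        net (is z) (tabulate preArc) ⊕ 0₃   ≡⟨ ⊕-identityʳ _ ⟩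
        net (is z) (tabulate preArc)        ≡⟨ ℤ₃∑.∑-tabulate (fl (is z)) preArc ⟩
        ℤ₃∑.∑ᶠ (fl (is z) ∘ preArc)         ≡⟨ at-z (λ _ → true) ⟩
        β z                                 ≡⟨ chg-is z β ⟨
        chg (is z) (charges β)              ∎)

      module R = Restrict q

      orientation : Sol (allFin n ∣ᵥ C) es R.st′ (charges β ∣ᵦ C) → ∃ λ s → IsβOrientation G β (D s)
      orientation (mkSol ds pw bal) with chosen (part G w (edges H)) pw
      ... | s , refl = s , λ v → flow⇒balanced G β (total (D s)) v (trans
        (ℤ₃∑.∑ᶠ-cong λ e → flow-just G (total (D s)) v e refl) (at v))
        where
        newArc : Fin m → Edge n
        newArc e = arcOf (Vec.lookup s e) (part G w (edges H) e)
        away : ∀ v → v ≢ z → ∀ e → Status e →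
          fl (is v) (arc G e (D s e)) ≡ fl (is v) (newArc e) ⊕ σ (is v) (stubsOf C (preArc e))
        away v v≢z e (kept e∈ a≢z b≢z) rewrite unoriented e∈ | part-∈ G w {edges H} {e} e∈
          | outside a≢z | outside b≢z =
          trans (cong (fl (is v)) (arc≡arcOf G e (Vec.lookup s e))) (sym (⊕-identityʳ _))
        away v v≢z e (lost e∉ e∈ ends-z) with d , eq ← oriented e∈
          rewrite eq | dec-false (e Subset.∈? edges H) e∉ =
          trans (stub d ends-z) (cong (_⊕ σ (is v) (stubsOf C (arc G e d))) (sym (loop (Vec.lookup s e))))
          where
          cancel : ∀ a → a ⊕ ⊝ a ≡ 0₃
          cancel = from-yes (all? λ a → (a ⊕ ⊝ a) ≟ 0₃)
          loop : ∀ b → fl (is v) (arcOf b (w , w)) ≡ 0₃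
          loop true  = cancel (ι (is v w))
          loop false = cancel (ι (is v w))
          leaving : ∀ {a b} → a ≢ z → b ≡ z → fl (is v) (a , b) ≡ σ (is v) (stubsOf C (a , b))
          leaving {a} a≢z refl rewrite outside a≢z | Cz | is-≢ v≢z with is v a
          ... | true  = refl
          ... | false = refl
          entering : ∀ {a b} → a ≡ z → b ≢ z → fl (is v) (a , b) ≡ σ (is v) (stubsOf C (a , b))
          entering {b = b} refl b≢z rewrite outside b≢z | Cz | is-≢ v≢z with is v b
          ... | true  = refl
          ... | false = refl
          stub : ∀ d → (proj₁ (ends G e) ≡ z × proj₂ (ends G e) ≢ z) ⊎
                       (proj₁ (ends G e) ≢ z × proj₂ (ends G e) ≡ z) →
                 fl (is v) (arc G e d) ≡ σ (is v) (stubsOf C (arc G e d))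
          stub true  (inj₁ (a≡z , b≢z)) = entering a≡z b≢z
          stub true  (inj₂ (a≢z , b≡z)) = leaving a≢z b≡z
          stub false (inj₁ (a≡z , b≢z)) = leaving b≢z a≡z
          stub false (inj₂ (a≢z , b≡z)) = entering b≡z a≢z
        at : ∀ v → ℤ₃∑.∑ᶠ (λ e → fl (is v) (arc G e (D s e))) ≡ β v
        at v with v ≟ z
        ... | yes refl = at-z (Vec.lookup s)
        ... | no v≢z   = begin
          ℤ₃∑.∑ᶠ (λ e → fl (is v) (arc G e (D s e)))
            ≡⟨ ℤ₃∑.∑ᶠ-cong (λ e → away v v≢z e (status e)) ⟩
          ℤ₃∑.∑ᶠ (λ e → fl (is v) (newArc e) ⊕ σ (is v) (stubsOf C (preArc e)))
            ≡⟨ ℤ₃∑.∑ᶠ-∙ (fl (is v) ∘ newArc) (σ (is v) ∘ stubsOf C ∘ preArc) ⟩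
          ℤ₃∑.∑ᶠ (fl (is v) ∘ newArc) ⊕ ℤ₃∑.∑ᶠ (σ (is v) ∘ stubsOf C ∘ preArc)
            ≡⟨ cong₂ _⊕_ (ℤ₃∑.∑-tabulate (fl (is v)) newArc)
                         (ℤ₃∑.∑-tabulate (σ (is v) ∘ stubsOf C) preArc) ⟨
          net (is v) (tabulate newArc) ⊕ ℤ₃∑.∑ (σ (is v) ∘ stubsOf C) (tabulate preArc)
            ≡⟨ cong (net (is v) (tabulate newArc) ⊕_) (R.σ-st′ (is v)) ⟨
          net (is v) (tabulate newArc) ⊕ σ (is v) R.st′
            ≡⟨ bal (∈-filter⁺ (member? C) (∈-allFin v) (outside v≢z)) ⟩
          chg (is v) (charges β ∣ᵦ C)
            ≡⟨ R.chg-restrict (is v) ⟩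
          chg (is v ∩ C) (charges β)
            ≡⟨ chg-cong (is-∩ {C = C} {v} (outside v≢z)) (charges β) ⟩
          chg (is v) (charges β)
            ≡⟨ chg-is v β ⟩
          β v ∎

theorem1p9 : ∀ {n m : ℕ} (G : Graph n m) →
    (∀ (f : ℕ) → F[ G , 4 ]≡ f → f ≤ 3 →
    (¬ HasBridge (whole G) → ℤ₃-Connected G) ×
    (ℤ₃-Connected G ⇔ κ′≥2 (whole G)))
    ×
    (F[ G , 4 ]≡ 0 →
    ∀ (v : Fin n) → degree G v ≤ 7 →
    κ′≥2 (deleteVertex G v) → ⟨ℤ₃⟩-ExtendableAt G v)
theorem1p9 {n} G = part-i , part-ii
  where
  part-i : ∀ f → F[ G , 4 ]≡ f → f ≤ 3 →
    (¬ HasBridge (whole G) → ℤ₃-Connected G) × (ℤ₃-Connected G ⇔ κ′≥2 (whole G))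
  part-i f ((A , packing@(_ , trees , _)) , _) f≤3 =
    connected , mk⇔ (λ conn → trees⇒Connected G A w f≤3 packing , ℤ₃-Connected⇒noBridge G w conn)
                    (connected ∘ proj₂)
    where
    -- A spanning tree is nonempty by definition, which yields a vertex to carry the loops of
    -- `part`.
    w : Fin n
    w = proj₁ (proj₁ (proj₁ (trees zero)))
    connected : ¬ HasBridge (whole G) → ℤ₃-Connected G
    connected = noBridge⇒ℤ₃-Connected G w
      (Dense-mono {U = allFin n} {edgeList G} f≤3 (trees⇒Dense G A w packing))
  part-ii : F[ G , 4 ]≡ 0 → ∀ v → degree G v ≤ 7 → κ′≥2 (deleteVertex G v) → ⟨ℤ₃⟩-ExtendableAt G v
  part-ii ((A , packing) , _) v deg≤7 κ = extendable G v deg≤7 κ (trees⇒Dense G A v packing)
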